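{- Let $F(x)$ denote the number of integers $n=pqr\le x$ with $p,q,r$ primes, $3\le p<q<r$, such that the cyclotomic polynomial $\Phi_n$ has all coefficients in $\{ -1,0,1\}$. Then, as $x\to\infty$, $$F(x)\ge (2C_2+o(1))\frac{x}{\log x},\qquad C_2=\left(\sum_p\frac{1}{p(p-1)}\right)^2,$$ the sum running over all primes $p$.
   Context: $\Phi_n(x)=\prod_{1\le j\le n,\ \gcd(j,n)=1}(x-e^{2\pi ij/n})$ is the $n$-th cyclotomic polynomial, which has integer coefficients. -}

module Defs where

open import Data.Bool using (Bool; true; false; _∧_; if_then_else_)
open import Data.Nat as ℕ using (ℕ; zero; suc; _≡ᵇ_; _<ᵇ_; _≤ᵇ_; _∸_)
open import Data.Nat.Divisibility using (_∣?_)
open import Data.Nat.Primality using (prime?)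
open import Data.Integer as ℤ using (ℤ; +_; -[1+_]; ∣_∣)
open import Data.List using (List; []; _∷_; _++_; [_]; map; filter; foldr; reverse; replicate; length; upTo)
open import Data.Bool.ListAction using (any; all)
open import Data.Product using (_×_; _,_; proj₁; proj₂)
open import Relation.Nullary.Decidable using (isYes)
open import Data.Rational as ℚ using (ℚ; 0ℚ; 1ℚ; _/_)

-- Integer polynomials as coefficient lists.
-- Convention "low-first": [a₀ , a₁ , … , a_d] represents a₀ + a₁ x + … + a_d x^d.

polyAdd : List ℤ → List ℤ → List ℤ
polyAdd [] q = q
polyAdd p [] = p
polyAdd (a ∷ p) (b ∷ q) = (a ℤ.+ b) ∷ polyAdd p q

polyMul : List ℤ → List ℤ → List ℤ
polyMul [] q = []
polyMul (a ∷ p) q = polyAdd (map (a ℤ.*_) q) (+ 0 ∷ polyMul p q)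

xPowMinusOne : ℕ → List ℤ
xPowMinusOne zero = []
xPowMinusOne (suc n) = -[1+ 0 ] ∷ (replicate n (+ 0) ++ [ + 1 ])

-- Long division by a MONIC polynomial, both in "high-first" convention
-- (leading coefficient first).  Returns the quotient (high-first).
-- The first argument is fuel (the length of the dividend suffices).
private
  subPrefix : List ℤ → List ℤ → List ℤ
  subPrefix xs [] = xs
  subPrefix [] ys = map ℤ.-_ ys
  subPrefix (x ∷ xs) (y ∷ ys) = (x ℤ.- y) ∷ subPrefix xs ys

divMonicHF : ℕ → List ℤ → List ℤ → List ℤ
divMonicHF zero a b = []
divMonicHF (suc f) [] b = []
divMonicHF (suc f) (a₀ ∷ as) [] = []
divMonicHF (suc f) (a₀ ∷ as) (b₀ ∷ bs) =
  if length (a₀ ∷ as) <ᵇ length (b₀ ∷ bs) then []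
  else a₀ ∷ divMonicHF f (subPrefix as (map (a₀ ℤ.*_) bs)) (b₀ ∷ bs)

polyDivMonic : List ℤ → List ℤ → List ℤ
polyDivMonic a b = reverse (divMonicHF (length a) (reverse a) (reverse b))

-- Cyclotomic polynomials, via the standard recursion
--   Φ_m(x) = (x^m - 1) / ∏_{d ∣ m, d < m} Φ_d(x)   (m ≥ 1),
-- which is equivalent to the root-of-unity definition (x^m - 1 = ∏_{d∣m} Φ_d).

newCyclo : ℕ → List (ℕ × List ℤ) → List ℤ
newCyclo m tbl =
  polyDivMonic (xPowMinusOne m)
    (foldr polyMul [ + 1 ] (map proj₂ (filter (λ e → proj₁ e ∣? m) tbl)))

cycloTable : ℕ → List (ℕ × List ℤ)
cycloTable zero = []
cycloTable (suc n) = cycloTable n ++ [ (suc n , newCyclo (suc n) (cycloTable n)) ]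

-- Φ_n as a low-first coefficient list (n ≥ 1; Φ_0 is unused and set to []).
cyclotomic : ℕ → List ℤ
cyclotomic zero = []
cyclotomic (suc n) = newCyclo (suc n) (cycloTable n)

isFlat : List ℤ → Bool
isFlat p = all (λ c → ∣ c ∣ ≤ᵇ 1) p

isPrimeᵇ : ℕ → Bool
isPrimeᵇ p = isYes (prime? p)

isOddTernary : ℕ → Bool
isOddTernary n =
  any (λ p → any (λ q → any (λ r →
        (3 ≤ᵇ p) ∧ (p <ᵇ q) ∧ (q <ᵇ r) ∧ isPrimeᵇ p ∧ isPrimeᵇ q ∧ isPrimeᵇ r
          ∧ ((p ℕ.* q ℕ.* r) ≡ᵇ n))
      (upTo (suc n))) (upTo (suc n))) (upTo (suc n))

countUpTo : (ℕ → Bool) → ℕ → ℕ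
countUpTo P zero = 0
countUpTo P (suc x) = countUpTo P x ℕ.+ (if P (suc x) then 1 else 0)

F : ℕ → ℕ
F x = countUpTo (λ n → isOddTernary n ∧ isFlat (cyclotomic n)) x

primeTerm : ℕ → ℚ
primeTerm zero = 0ℚ
primeTerm (suc zero) = 0ℚ
primeTerm (suc (suc k)) =
  if isPrimeᵇ (suc (suc k)) then + 1 / (suc (suc k) ℕ.* suc k) else 0ℚ

-- S N = Σ_{p ≤ N prime} 1/(p(p-1)); increases to √C₂ as N → ∞
S : ℕ → ℚ
S zero = 0ℚ
S (suc N) = S N ℚ.+ primeTerm (suc N)

expTerm : ℚ → ℕ → ℚ
expTerm y zero = 1ℚ
expTerm y (suc k) = expTerm y k ℚ.* y ℚ.* (+ 1 / suc k)

-- expSum y M = Σ_{k=0}^{M} y^k / k!  ; for y ≥ 0 this increases to e^y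
expSum : ℚ → ℕ → ℚ
expSum y zero = 1ℚ
expSum y (suc M) = expSum y M ℚ.+ expTerm y (suc M)

{-# OPTIONS --safe #-}

-- F(x) log x / x tends to infinity, because Φ_3qr is flat for a positive proportion of the
-- numbers 3qr.
--
-- Flatness. For primes 3 < q < r, Φ_3qr = (1 + x + x²) B, where the coefficient of B at qi + rj is a product
-- χ(i) χ(j) of coefficients of (1 - y)/(1 - y³), up to a correction for the second representation. A coefficient
-- of Φ_3qr is thus a sum of three consecutive coefficients of B. If 3ur - qv = ±1 with 6u < q and
-- 3 ∣ v + r, then passing to a neighbouring number changes (i, j) by (-v, 3u) modulo (r, q), with at most one
-- wrap-around in two steps, and a finite check modulo 3 bounds all such sums by 1. The divisibility holds
-- as soon as the sign is the residue of qr modulo 3, so about one sixth of all residues r modulo q are good.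
--
-- Counting. Fix a dyadic block of primes q in [Y, 2Y). By the Chinese remainder theorem the indicators of
-- good residues modulo distinct q are uncorrelated, so the number of q for which n is good has small
-- variance over n < N. Hence all but few n < N, in particular most primes r < N, are good for a positive
-- proportion of the q; no information about primes in residue classes is needed. With N ≈ x/Y, Chebyshev's lower
-- bound for π (from the integrality of lcm(1..N) times the integrals of x^i (1 - x)^j over [0,1]) and Abel summation
-- over Y = 2^j, the blocks j ∈ (J, 2J] contribute at least a constant multiple of x / log x, and the
-- number of such ranges with log log x ≲ J and 2J ≤ log x / 8 is unbounded.

module Submission where

open import Data.Nat as ℕ using (ℕ; zero; suc; z≤n; s≤s; NonZero; _∸_)
import Data.Nat.Properties as ℕ
open import Data.Nat.Tactic.RingSolver using () renaming (solve-∀ to ℕ-solve)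
open import Data.Integer.Tactic.RingSolver using () renaming (solve-∀ to ℤ-solve)
open import Data.Product using (_×_; _,_; ∃-syntax; proj₁; proj₂)
open import Data.Sum using (_⊎_; inj₁; inj₂)
open import Data.Empty using (⊥; ⊥-elim)
open import Relation.Nullary using (Dec; yes; no; ¬_; does)
open import Relation.Binary.PropositionalEquality
  using (_≡_; _≢_; refl; sym; trans; cong; cong₂; subst; subst₂; module ≡-Reasoning)

-- The sign attached to a pair (q, r) is the residue of qr modulo 3, so goodness is not periodic in
-- r modulo q, and second moments cannot be applied to it directly. The sign is therefore frozen:
-- for each class ρ modulo 3 the offset `off q ρ` is used for all n < N, which restores the period
-- q. Primes of class ρ are picked out only afterwards, through the pointwise bound 2μw - μ² ≥ -(w -
-- μ)², whose right side may be summed over all n; no exceptional set has to be handled. Chebyshev's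
-- lower bound for π alone finds no primes in a single block [Y, 2Y). A weighted sum over blocks
-- survives, since Abel summation turns it into a sum of values of π with positive coefficients, up
-- to one boundary term for which π(n) ≤ n suffices. The range of exponents i is dictated by two
-- errors. Each block loses a multiple of L N with L about log₂ x and N = 2^(T-i); this is geometric
-- in i, so starting near log₂ L keeps the total below 2^T. The incomplete periods cost a multiple
-- of K³, K being the top of the block, which must stay below N and ends the range near T/4.

-- Finite integer sums, indicators and linear congruences.

module Sums where

  open import Data.Nat.Divisibility using (_∣_; _∣?_; divides; ∣m+n∣m⇒∣n; m∣m*n; ∣n⇒∣m*n; ∣⇒≤)
  open import Data.Nat.DivMod using (_%_; _/_; m≡m%n+[m/n]*n; m%n<n)
  open import Data.Nat.Coprimality using (Coprime; coprime-divisor; coprime-Bézout)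
  open import Data.Nat.GCD using (module Bézout)
  open import Data.Integer as ℤ using (ℤ; +_; _+_; _*_; _≤_; +≤+; 0ℤ; 1ℤ)
  open import Data.Integer.Properties
  open import Data.Bool using (if_then_else_)

  ∑ : ℕ → (ℕ → ℤ) → ℤ
  ∑ zero    f = 0ℤ
  ∑ (suc n) f = ∑ n f + f n

  ∑-cong : ∀ n {f g} → (∀ i → i ℕ.< n → f i ≡ g i) → ∑ n f ≡ ∑ n g
  ∑-cong zero    h = refl
  ∑-cong (suc n) h = cong₂ _+_ (∑-cong n (λ i i<n → h i (ℕ.m<n⇒m<1+n i<n))) (h n ℕ.≤-refl)

  ∑-mono : ∀ n {f g} → (∀ i → i ℕ.< n → f i ≤ g i) → ∑ n f ≤ ∑ n g
  ∑-mono zero    h = ≤-refl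
  ∑-mono (suc n) h = +-mono-≤ (∑-mono n (λ i i<n → h i (ℕ.m<n⇒m<1+n i<n))) (h n ℕ.≤-refl)

  ∑-const : ∀ n c → ∑ n (λ _ → c) ≡ + n * c
  ∑-const zero    c = refl
  ∑-const (suc n) c = trans (cong (_+ c) (∑-const n c)) (lem (+ n) c)
    where
    lem : ∀ n c → n * c + c ≡ (1ℤ + n) * c
    lem = ℤ-solve

  ∑-zero : ∀ n {f} → (∀ i → i ℕ.< n → f i ≡ 0ℤ) → ∑ n f ≡ 0ℤ
  ∑-zero n h = trans (∑-cong n h) (trans (∑-const n 0ℤ) (*-zeroʳ (+ n)))

  ∑-nonneg : ∀ n {f} → (∀ i → i ℕ.< n → 0ℤ ≤ f i) → 0ℤ ≤ ∑ n f
  ∑-nonneg n {f} h = subst (_≤ ∑ n f) (∑-zero n {λ _ → 0ℤ} (λ _ _ → refl)) (∑-mono n h)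

  ∑-+ : ∀ n f g → ∑ n (λ i → f i + g i) ≡ ∑ n f + ∑ n g
  ∑-+ zero    f g = refl
  ∑-+ (suc n) f g = trans (cong (_+ (f n + g n)) (∑-+ n f g)) (lem (∑ n f) (∑ n g) (f n) (g n))
    where
    lem : ∀ a b c d → a + b + (c + d) ≡ a + c + (b + d)
    lem = ℤ-solve

  ∑-*ˡ : ∀ n c f → ∑ n (λ i → c * f i) ≡ c * ∑ n f
  ∑-*ˡ zero    c f = sym (*-zeroʳ c)
  ∑-*ˡ (suc n) c f = trans (cong (_+ c * f n) (∑-*ˡ n c f)) (sym (*-distribˡ-+ c (∑ n f) (f n)))

  ∑-*ʳ : ∀ n c f → ∑ n (λ i → f i * c) ≡ ∑ n f * c
  ∑-*ʳ n c f = trans (∑-cong n (λ i _ → *-comm (f i) c)) (trans (∑-*ˡ n c f) (*-comm c (∑ n f)))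

  ∑-swap : ∀ m n (f : ℕ → ℕ → ℤ) → ∑ m (λ i → ∑ n (f i)) ≡ ∑ n (λ j → ∑ m (λ i → f i j))
  ∑-swap zero    n f = sym (∑-zero n (λ _ _ → refl))
  ∑-swap (suc m) n f =
    trans (cong (_+ ∑ n (f m)) (∑-swap m n f)) (sym (∑-+ n (λ j → ∑ m (λ i → f i j)) (f m)))

  ∑-split : ∀ m n f → ∑ (m ℕ.+ n) f ≡ ∑ m f + ∑ n (λ i → f (m ℕ.+ i))
  ∑-split m zero    f = trans (cong (λ k → ∑ k f) (ℕ.+-identityʳ m)) (sym (+-identityʳ _))
  ∑-split m (suc n) f rewrite ℕ.+-suc m n =
    trans (cong (_+ f (m ℕ.+ n)) (∑-split m n f)) (+-assoc (∑ m f) _ _)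

  ∑-head : ∀ n f → ∑ (suc n) f ≡ f 0 + ∑ n (λ i → f (suc i))
  ∑-head n f = trans (∑-split 1 n f) (cong (_+ ∑ n (λ i → f (suc i))) (+-identityˡ (f 0)))

  ∑-single : ∀ n {f} i₀ → i₀ ℕ.< n → (∀ i → i ℕ.< n → i ≢ i₀ → f i ≡ 0ℤ) → ∑ n f ≡ f i₀
  ∑-single (suc n) {f} i₀ i₀<1+n h with i₀ ℕ.≟ n
  ... | yes refl = trans
    (cong (_+ f n) (∑-zero n (λ i i<n → h i (ℕ.m<n⇒m<1+n i<n) (ℕ.<⇒≢ i<n)))) (+-identityˡ (f n))
  ... | no i₀≢n = trans
    (cong₂ _+_ (∑-single n i₀ (ℕ.≤∧≢⇒< (ℕ.≤-pred i₀<1+n) i₀≢n) (λ i i<n → h i (ℕ.m<n⇒m<1+n i<n)))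
      (h n ℕ.≤-refl (λ n≡i₀ → i₀≢n (sym n≡i₀)))) (+-identityʳ (f i₀))

  -- Converts uniqueness into an upper bound; it is applied to the multiplier u in `h≤1` and to the
  -- pair of primes with a given product.
  ∑-exclusive : ∀ n {f} → (∀ i → i ℕ.< n → f i ≤ 1ℤ) →
    (∀ i j → i ℕ.< n → j ℕ.< n → f i ≢ 0ℤ → f j ≢ 0ℤ → i ≡ j) → ∑ n f ≤ 1ℤ
  ∑-exclusive zero    b e = +≤+ z≤n
  ∑-exclusive (suc n) {f} b e with f n ≟ 0ℤ
  ... | yes fn≡0 = ≤-trans
    (≤-reflexive (trans (cong (λ z → ∑ n f + z) fn≡0) (+-identityʳ (∑ n f))))
    (∑-exclusive n (λ i i<n → b i (ℕ.m<n⇒m<1+n i<n))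
      (λ i j i<n j<n → e i j (ℕ.m<n⇒m<1+n i<n) (ℕ.m<n⇒m<1+n j<n)))
  ... | no fn≢0 = ≤-trans
    (≤-reflexive (trans (cong (_+ f n) (∑-zero n rest)) (+-identityˡ (f n)))) (b n ℕ.≤-refl)
    where
    rest : ∀ i → i ℕ.< n → f i ≡ 0ℤ
    rest i i<n with f i ≟ 0ℤ
    ... | yes z = z
    ... | no nz = ⊥-elim (ℕ.<⇒≢ i<n (e i n (ℕ.m<n⇒m<1+n i<n) ℕ.≤-refl nz fn≢0))

  ⟦_⟧ : ∀ {a} {P : Set a} → Dec P → ℤ
  ⟦ d ⟧ = if does d then 1ℤ else 0ℤ

  ⟦⟧-yes : ∀ {a} {P : Set a} (d : Dec P) → P → ⟦ d ⟧ ≡ 1ℤ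
  ⟦⟧-yes (yes _) p = refl
  ⟦⟧-yes (no ¬p) p = ⊥-elim (¬p p)

  ⟦⟧-no : ∀ {a} {P : Set a} (d : Dec P) → ¬ P → ⟦ d ⟧ ≡ 0ℤ
  ⟦⟧-no (yes p) ¬p = ⊥-elim (¬p p)
  ⟦⟧-no (no _)  ¬p = refl

  ⟦⟧-≢0 : ∀ {a} {P : Set a} (d : Dec P) → ⟦ d ⟧ ≢ 0ℤ → P
  ⟦⟧-≢0 (yes p) _ = p
  ⟦⟧-≢0 (no _)  h = ⊥-elim (h refl)

  ⟦⟧-cong : ∀ {a b} {P : Set a} {Q : Set b} (d : Dec P) (e : Dec Q) → (P → Q) → (Q → P) → ⟦ d ⟧ ≡ ⟦ e ⟧
  ⟦⟧-cong (yes p) e to from = sym (⟦⟧-yes e (to p))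
  ⟦⟧-cong (no ¬p) e to from = sym (⟦⟧-no e (λ q → ¬p (from q)))

  0≤⟦⟧ : ∀ {a} {P : Set a} (d : Dec P) → 0ℤ ≤ ⟦ d ⟧
  0≤⟦⟧ (yes _) = +≤+ z≤n
  0≤⟦⟧ (no _)  = +≤+ z≤n

  ⟦⟧≤1 : ∀ {a} {P : Set a} (d : Dec P) → ⟦ d ⟧ ≤ 1ℤ
  ⟦⟧≤1 (yes _) = +≤+ (s≤s z≤n)
  ⟦⟧≤1 (no _)  = +≤+ z≤n

  linear-congruence : ∀ a c p .{{_ : NonZero p}} → Coprime a p → ∃[ j ] (j ℕ.< p × p ∣ a ℕ.* j ℕ.+ c)
  linear-congruence a c p a⊥p = reduce (solution (coprime-Bézout a⊥p))
    where
    solution : Bézout.Identity 1 a p → ∃[ k ] p ∣ a ℕ.* k ℕ.+ c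
    -- Here x inverts a modulo p, so x times -c is wanted; `c * pred p` plays the part of -c in ℕ.
    -- In the other case x a ≡ -1 already, and `x * c` works.
    solution (Bézout.+- x y 1+yp≡xa) = x ℕ.* (c ℕ.* ℕ.pred p) , divides (c ℕ.+ y ℕ.* (c ℕ.* ℕ.pred p)) (begin
        a ℕ.* (x ℕ.* (c ℕ.* ℕ.pred p)) ℕ.+ c         ≡⟨ lem₁ a x (c ℕ.* ℕ.pred p) c ⟩
        (x ℕ.* a) ℕ.* (c ℕ.* ℕ.pred p) ℕ.+ c         ≡⟨ cong (λ z → z ℕ.* (c ℕ.* ℕ.pred p) ℕ.+ c) (sym 1+yp≡xa) ⟩
        (1 ℕ.+ y ℕ.* p) ℕ.* (c ℕ.* ℕ.pred p) ℕ.+ c   ≡⟨ lem₂ y p c (ℕ.pred p) ⟩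
        c ℕ.* suc (ℕ.pred p) ℕ.+ y ℕ.* (c ℕ.* ℕ.pred p) ℕ.* p ≡⟨ cong (λ z → c ℕ.* z ℕ.+ y ℕ.* (c ℕ.* ℕ.pred p) ℕ.* p) (ℕ.suc-pred p) ⟩
        c ℕ.* p ℕ.+ y ℕ.* (c ℕ.* ℕ.pred p) ℕ.* p     ≡⟨ sym (ℕ.*-distribʳ-+ p c _) ⟩
        (c ℕ.+ y ℕ.* (c ℕ.* ℕ.pred p)) ℕ.* p         ∎)
      where
      open ≡-Reasoning
      lem₁ : ∀ a x k c → a ℕ.* (x ℕ.* k) ℕ.+ c ≡ (x ℕ.* a) ℕ.* k ℕ.+ c
      lem₁ = ℕ-solve
      lem₂ : ∀ y p c m → (1 ℕ.+ y ℕ.* p) ℕ.* (c ℕ.* m) ℕ.+ c ≡ c ℕ.* (1 ℕ.+ m) ℕ.+ y ℕ.* (c ℕ.* m) ℕ.* p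
      lem₂ = ℕ-solve
    solution (Bézout.-+ x y 1+xa≡yp) = x ℕ.* c , divides (y ℕ.* c) (begin
        a ℕ.* (x ℕ.* c) ℕ.+ c      ≡⟨ lem₁ a x c ⟩
        (1 ℕ.+ x ℕ.* a) ℕ.* c      ≡⟨ cong (ℕ._* c) 1+xa≡yp ⟩
        y ℕ.* p ℕ.* c              ≡⟨ lem₂ y p c ⟩
        y ℕ.* c ℕ.* p              ∎)
      where
      open ≡-Reasoning
      lem₁ : ∀ a x c → a ℕ.* (x ℕ.* c) ℕ.+ c ≡ (1 ℕ.+ x ℕ.* a) ℕ.* c
      lem₁ = ℕ-solve
      lem₂ : ∀ y p c → y ℕ.* p ℕ.* c ≡ y ℕ.* c ℕ.* p
      lem₂ = ℕ-solve
    reduce : ∃[ k ] p ∣ a ℕ.* k ℕ.+ c → ∃[ j ] (j ℕ.< p × p ∣ a ℕ.* j ℕ.+ c)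
    reduce (k , p∣) = k % p , m%n<n k p ,
      ∣m+n∣m⇒∣n (subst (p ∣_) eq p∣) (∣n⇒∣m*n (a ℕ.* (k / p)) (m∣m*n 1))
      where
      lem : ∀ a r d p c → a ℕ.* (r ℕ.+ d ℕ.* p) ℕ.+ c ≡ a ℕ.* d ℕ.* (p ℕ.* 1) ℕ.+ (a ℕ.* r ℕ.+ c)
      lem = ℕ-solve
      eq : a ℕ.* k ℕ.+ c ≡ a ℕ.* (k / p) ℕ.* (p ℕ.* 1) ℕ.+ (a ℕ.* (k % p) ℕ.+ c)
      eq = trans (cong (λ z → a ℕ.* z ℕ.+ c) (m≡m%n+[m/n]*n k p)) (lem a (k % p) (k / p) p c)

  private
    congruence-≤ : ∀ {a c p i j} → Coprime a p → i ℕ.≤ j → j ℕ.< p →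
      p ∣ a ℕ.* i ℕ.+ c → p ∣ a ℕ.* j ℕ.+ c → i ≡ j
    congruence-≤ {a} {c} {p} {i} {j} a⊥p i≤j j<p p∣i p∣j = small (j ℕ.∸ i) refl
      where
      lem : ∀ a i d c → a ℕ.* (i ℕ.+ d) ℕ.+ c ≡ (a ℕ.* i ℕ.+ c) ℕ.+ a ℕ.* d
      lem = ℕ-solve
      p∣j-i : p ∣ j ℕ.∸ i
      p∣j-i = coprime-divisor (λ where (x , y) → a⊥p (y , x)) (∣m+n∣m⇒∣n
        (subst (p ∣_) (trans (cong (λ z → a ℕ.* z ℕ.+ c) (sym (ℕ.m+[n∸m]≡n i≤j))) (lem a i (j ℕ.∸ i) c)) p∣j) p∣i)
      small : ∀ d → j ℕ.∸ i ≡ d → i ≡ j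
      small zero    eq = ℕ.≤-antisym i≤j (ℕ.m∸n≡0⇒m≤n eq)
      small (suc d) eq = ⊥-elim (ℕ.<-irrefl refl (ℕ.<-≤-trans j<p
        (ℕ.≤-trans (subst (p ℕ.≤_) (sym eq) (∣⇒≤ (subst (p ∣_) eq p∣j-i))) (ℕ.m∸n≤m j i))))

  congruence-unique : ∀ {a c p i j} → Coprime a p → i ℕ.< p → j ℕ.< p →
    p ∣ a ℕ.* i ℕ.+ c → p ∣ a ℕ.* j ℕ.+ c → i ≡ j
  congruence-unique {i = i} {j} a⊥p i<p j<p p∣i p∣j with ℕ.≤-total i j
  ... | inj₁ i≤j = congruence-≤ a⊥p i≤j j<p p∣i p∣j
  ... | inj₂ j≤i = sym (congruence-≤ a⊥p j≤i i<p p∣j p∣i)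

  ∑-linear-congruence : ∀ a c p .{{_ : NonZero p}} → Coprime a p →
    ∑ p (λ j → ⟦ p ∣? a ℕ.* j ℕ.+ c ⟧) ≡ 1ℤ
  ∑-linear-congruence a c p a⊥p = single (linear-congruence a c p a⊥p)
    where
    single : ∃[ j ] (j ℕ.< p × p ∣ a ℕ.* j ℕ.+ c) → ∑ p (λ j → ⟦ p ∣? a ℕ.* j ℕ.+ c ⟧) ≡ 1ℤ
    single (j₀ , j₀<p , p∣) = trans
      (∑-single p j₀ j₀<p (λ j j<p j≢j₀ → ⟦⟧-no (p ∣? a ℕ.* j ℕ.+ c)
        (λ p∣j → j≢j₀ (congruence-unique a⊥p j<p j₀<p p∣j p∣))))
      (⟦⟧-yes (p ∣? a ℕ.* j₀ ℕ.+ c) p∣)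

-- Formal power series over ℤ.

module Series where

  open import Data.Nat.Divisibility using (_∣?_; ∣m+n∣m⇒∣n; ∣m∣n⇒∣m+n; ∣-refl; ∣⇒≤; _∣0)
  open import Data.Integer as ℤ using (ℤ; -_; _+_; _-_; _*_; 0ℤ; 1ℤ)
  open import Data.Integer.Properties
  open import Algebra.Bundles using (CommutativeRing)
  open Sums

  Ser : Set
  Ser = ℕ → ℤ

  infix  4 _≈_
  infixl 7 _⊛_
  infixl 6 _⊕_

  _≈_ : Ser → Ser → Set
  f ≈ g = ∀ n → f n ≡ g n

  tail : Ser → Ser
  tail f n = f (suc n)

  _⊕_ : Ser → Ser → Ser
  (f ⊕ g) n = f n + g n

  ⊖_ : Ser → Ser
  (⊖ f) n = - f n

  _·_ : ℤ → Ser → Ser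
  (c · f) n = c * f n

  𝟘 : Ser
  𝟘 n = 0ℤ

  𝟙 : Ser
  𝟙 zero    = 1ℤ
  𝟙 (suc n) = 0ℤ

  _⊛_ : Ser → Ser → Ser
  (f ⊛ g) zero    = f 0 * g 0
  (f ⊛ g) (suc n) = f 0 * g (suc n) + (tail f ⊛ g) n

  ⊛-cong : ∀ {f f₁ g g₁} → f ≈ f₁ → g ≈ g₁ → f ⊛ g ≈ f₁ ⊛ g₁
  ⊛-cong p q zero    = cong₂ _*_ (p 0) (q 0)
  ⊛-cong p q (suc n) = cong₂ _+_ (cong₂ _*_ (p 0) (q (suc n))) (⊛-cong (λ k → p (suc k)) q n)

  ⊛-sucʳ : ∀ f g n → (f ⊛ g) (suc n) ≡ (f ⊛ tail g) n + f (suc n) * g 0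
  ⊛-sucʳ f g zero    = refl
  ⊛-sucʳ f g (suc n) = trans
    (cong (λ z → f 0 * g (suc (suc n)) + z) (⊛-sucʳ (tail f) g n))
    (sym (+-assoc (f 0 * g (suc (suc n))) _ _))

  ⊛-comm : ∀ f g → f ⊛ g ≈ g ⊛ f
  ⊛-comm f g zero    = *-comm (f 0) (g 0)
  ⊛-comm f g (suc n) = begin
    f 0 * g (suc n) + (tail f ⊛ g) n   ≡⟨ cong₂ _+_ (*-comm (f 0) _) (⊛-comm (tail f) g n) ⟩
    g (suc n) * f 0 + (g ⊛ tail f) n   ≡⟨ +-comm _ ((g ⊛ tail f) n) ⟩
    (g ⊛ tail f) n + g (suc n) * f 0   ≡⟨ sym (⊛-sucʳ g f n) ⟩
    (g ⊛ f) (suc n)                    ∎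
    where open ≡-Reasoning

  ⊛-distribʳ : ∀ h f g → (f ⊕ g) ⊛ h ≈ (f ⊛ h) ⊕ (g ⊛ h)
  ⊛-distribʳ h f g zero    = *-distribʳ-+ (h 0) (f 0) (g 0)
  ⊛-distribʳ h f g (suc n) = trans
    (cong (λ z → (f 0 + g 0) * h (suc n) + z) (⊛-distribʳ h (tail f) (tail g) n))
    (lem (f 0) (g 0) (h (suc n)) _ _)
    where
    lem : ∀ a b c d e → (a + b) * c + (d + e) ≡ a * c + d + (b * c + e)
    lem = ℤ-solve

  ⊛-distribˡ : ∀ h f g → h ⊛ (f ⊕ g) ≈ (h ⊛ f) ⊕ (h ⊛ g)
  ⊛-distribˡ h f g n = trans (⊛-comm h (f ⊕ g) n)
    (trans (⊛-distribʳ h f g n) (cong₂ _+_ (⊛-comm f h n) (⊛-comm g h n)))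

  ·-⊛ : ∀ c f g → (c · f) ⊛ g ≈ c · (f ⊛ g)
  ·-⊛ c f g zero    = *-assoc c (f 0) (g 0)
  ·-⊛ c f g (suc n) = trans (cong (λ z → c * f 0 * g (suc n) + z) (·-⊛ c (tail f) g n))
    (lem c (f 0) (g (suc n)) _)
    where
    lem : ∀ c a b d → c * a * b + c * d ≡ c * (a * b + d)
    lem = ℤ-solve

  ⊛-assoc : ∀ f g h → (f ⊛ g) ⊛ h ≈ f ⊛ (g ⊛ h)
  ⊛-assoc f g h zero    = *-assoc (f 0) (g 0) (h 0)
  ⊛-assoc f g h (suc n) = begin
    f 0 * g 0 * h (suc n) + (((f 0 · tail g) ⊕ (tail f ⊛ g)) ⊛ h) n
      ≡⟨ cong (λ z → f 0 * g 0 * h (suc n) + z) (trans (⊛-distribʳ h (f 0 · tail g) (tail f ⊛ g) n)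
          (cong₂ _+_ (·-⊛ (f 0) (tail g) h n) (⊛-assoc (tail f) g h n))) ⟩
    f 0 * g 0 * h (suc n) + (f 0 * (tail g ⊛ h) n + (tail f ⊛ (g ⊛ h)) n)
      ≡⟨ lem (f 0) (g 0) (h (suc n)) _ _ ⟩
    f 0 * (g 0 * h (suc n) + (tail g ⊛ h) n) + (tail f ⊛ (g ⊛ h)) n ∎
    where
    open ≡-Reasoning
    lem : ∀ a b c d e → a * b * c + (a * d + e) ≡ a * (b * c + d) + e
    lem = ℤ-solve

  𝟘-⊛ : ∀ f → 𝟘 ⊛ f ≈ 𝟘
  𝟘-⊛ f zero    = refl
  𝟘-⊛ f (suc n) = trans (+-identityˡ _) (𝟘-⊛ f n)

  𝟙-⊛ : ∀ f → 𝟙 ⊛ f ≈ f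
  𝟙-⊛ f zero    = *-identityˡ (f 0)
  𝟙-⊛ f (suc n) = trans (cong₂ _+_ (*-identityˡ (f (suc n))) (𝟘-⊛ f n)) (+-identityʳ (f (suc n)))

  -- Bundled so that the ring and monoid solvers can rearrange long products of series.
  series : CommutativeRing _ _
  series = record
    { Carrier = Ser ; _≈_ = _≈_ ; _+_ = _⊕_ ; _*_ = _⊛_ ; -_ = ⊖_ ; 0# = 𝟘 ; 1# = 𝟙
    ; isCommutativeRing = record
      { isRing = record
        { +-isAbelianGroup = record
          { isGroup = record
            { isMonoid = record
              { isSemigroup = record
                { isMagma = record
                  { isEquivalence = record
                    { refl = λ n → refl ; sym = λ p n → sym (p n) ; trans = λ p q n → trans (p n) (q n) }
                  ; ∙-cong = λ p q n → cong₂ _+_ (p n) (q n) }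
                ; assoc = λ f g h n → +-assoc (f n) (g n) (h n) }
              ; identity = (λ f n → +-identityˡ (f n)) , (λ f n → +-identityʳ (f n)) }
            ; inverse = (λ f n → +-inverseˡ (f n)) , (λ f n → +-inverseʳ (f n))
            ; ⁻¹-cong = λ p n → cong -_ (p n) }
          ; comm = λ f g n → +-comm (f n) (g n) }
        ; *-cong = ⊛-cong
        ; *-assoc = ⊛-assoc
        ; *-identity = 𝟙-⊛ , (λ f n → trans (⊛-comm f 𝟙 n) (𝟙-⊛ f n))
        ; distrib = ⊛-distribˡ , ⊛-distribʳ }
      ; *-comm = ⊛-comm } }

  open CommutativeRing series public
    using () renaming (refl to ≈-refl; sym to ≈-sym; trans to ≈-trans; setoid to Ser-setoid)

  -- Multiplication by a series with constant term 1 is a unitriangular map on coefficients: the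
  -- heads agree first, and subtracting their contribution leaves the same problem for the tails.
  ⊛-cancelʳ-≤ : ∀ m {f h} g → g 0 ≡ 1ℤ → (∀ k → k ℕ.≤ m → (f ⊛ g) k ≡ (h ⊛ g) k) → f m ≡ h m
  ⊛-cancelʳ-≤ zero {f} {h} g g₀≡1 eq = trans (unit (f 0)) (trans (eq 0 z≤n) (sym (unit (h 0))))
    where
    unit : ∀ a → a ≡ a * g 0
    unit a = trans (sym (*-identityʳ a)) (cong (a *_) (sym g₀≡1))
  ⊛-cancelʳ-≤ (suc m) {f} {h} g g₀≡1 eq = ⊛-cancelʳ-≤ m g g₀≡1 λ k k≤m →
    +-cancelˡ (f 0 * g (suc k)) _ _ (trans (eq (suc k) (s≤s k≤m))
      (cong (λ z → z * g (suc k) + (tail h ⊛ g) k) (sym (⊛-cancelʳ-≤ 0 {f} {h} g g₀≡1 (λ j j≤0 → eq j (ℕ.≤-trans j≤0 z≤n))))))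
    where
    undo : ∀ a b → - a + (a + b) ≡ b
    undo = ℤ-solve
    +-cancelˡ : ∀ a b c → a + b ≡ a + c → b ≡ c
    +-cancelˡ a b c e = trans (sym (undo a b)) (trans (cong (λ w → - a + w) e) (undo a c))

  ⊛-cancelʳ : ∀ {f h} g → g 0 ≡ 1ℤ → f ⊛ g ≈ h ⊛ g → f ≈ h
  ⊛-cancelʳ g g₀≡1 eq m = ⊛-cancelʳ-≤ m g g₀≡1 (λ k _ → eq k)

  shift : ℕ → Ser → Ser
  shift zero    f n       = f n
  shift (suc a) f zero    = 0ℤ
  shift (suc a) f (suc n) = shift a f n

  X : ℕ → Ser
  X a = shift a 𝟙

  shift-+ : ∀ a f n → shift a f (a ℕ.+ n) ≡ f n
  shift-+ zero    f n = refl
  shift-+ (suc a) f n = shift-+ a f n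

  shift-< : ∀ a f {n} → n ℕ.< a → shift a f n ≡ 0ℤ
  shift-< (suc a) f {zero}  _         = refl
  shift-< (suc a) f {suc n} (s≤s n<a) = shift-< a f n<a

  X-⊛ : ∀ a f → X a ⊛ f ≈ shift a f
  X-⊛ zero    f n       = 𝟙-⊛ f n
  X-⊛ (suc a) f zero    = refl
  X-⊛ (suc a) f (suc n) = trans (+-identityˡ _) (X-⊛ a f n)

  shift-shift : ∀ a b f → shift a (shift b f) ≈ shift (a ℕ.+ b) f
  shift-shift zero    b f n       = refl
  shift-shift (suc a) b f zero    = refl
  shift-shift (suc a) b f (suc n) = shift-shift a b f n

  z : ℕ → Ser
  z a = 𝟙 ⊕ (⊖ X a)

  z-⊛ : ∀ a f n → (z a ⊛ f) n ≡ f n - shift a f n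
  z-⊛ a f n = trans (⊛-distribʳ f 𝟙 (⊖ X a) n) (cong₂ _+_ (𝟙-⊛ f n)
    (trans (⊛-cong {g = f} (λ k → sym (-1*i≡-i (X a k))) (λ _ → refl) n)
      (trans (·-⊛ (- 1ℤ) (X a) f n) (trans (-1*i≡-i _) (cong -_ (X-⊛ a f n))))))

  z-0 : ∀ a .{{_ : NonZero a}} → z a 0 ≡ 1ℤ
  z-0 (suc a) = refl

  ⊛-0 : ∀ {f g} → f 0 ≡ 1ℤ → g 0 ≡ 1ℤ → (f ⊛ g) 0 ≡ 1ℤ
  ⊛-0 p q = cong₂ _*_ p q

  -- The series 1/(1 - x^a), inverse to `z a`.
  G : ℕ → Ser
  G a n = ⟦ a ∣? n ⟧

  z-⊛-G : ∀ a .{{_ : NonZero a}} → z a ⊛ G a ≈ 𝟙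
  z-⊛-G a n = trans (z-⊛ a (G a) n) (coeff (ℕ.≤-<-connex a n))
    where
    below : ∀ n → n ℕ.< a → G a n - 0ℤ ≡ 𝟙 n
    below zero    _   = cong (_- 0ℤ) (⟦⟧-yes (a ∣? 0) (a ∣0))
    below (suc n) n<a = cong (_- 0ℤ) (⟦⟧-no (a ∣? suc n) (λ a∣ → ℕ.<⇒≱ n<a (∣⇒≤ a∣)))
    𝟙-pos : ∀ n → ℕ.NonZero n → 𝟙 n ≡ 0ℤ
    𝟙-pos (suc n) _ = refl
    coeff : ∀ {n} → (a ℕ.≤ n) ⊎ (n ℕ.< a) → G a n - shift a (G a) n ≡ 𝟙 n
    coeff {n} (inj₂ n<a) = trans (cong (λ w → G a n - w) (shift-< a (G a) n<a)) (below n n<a)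
    coeff {n} (inj₁ a≤n) = subst (λ n → G a n - shift a (G a) n ≡ 𝟙 n) (ℕ.m+[n∸m]≡n a≤n)
      (trans (cong₂ _-_ (⟦⟧-cong (a ∣? (a ℕ.+ (n ℕ.∸ a))) (a ∣? (n ℕ.∸ a)) (λ h → ∣m+n∣m⇒∣n h ∣-refl) (∣m∣n⇒∣m+n ∣-refl))
          (shift-+ a (G a) (n ℕ.∸ a)))
        (trans (+-inverseʳ (G a (n ℕ.∸ a))) (sym (𝟙-pos (a ℕ.+ (n ℕ.∸ a)) (ℕ.>-nonZero (ℕ.<-≤-trans (ℕ.>-nonZero⁻¹ a) (ℕ.m≤m+n a _)))))))

  ∑ˢ : ℕ → (ℕ → Ser) → Ser
  ∑ˢ N f n = ∑ N (λ j → f j n)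

  ∑ˢ-⊛ : ∀ N f g → ∑ˢ N f ⊛ g ≈ ∑ˢ N (λ j → f j ⊛ g)
  ∑ˢ-⊛ zero    f g n = 𝟘-⊛ g n
  ∑ˢ-⊛ (suc N) f g n = trans (⊛-distribʳ g (∑ˢ N f) (f N) n) (cong (_+ (f N ⊛ g) n) (∑ˢ-⊛ N f g n))

  geometric : ∀ a N → z a ⊛ ∑ˢ N (λ j → X (a ℕ.* j)) ≈ z (a ℕ.* N)
  geometric a zero n rewrite ℕ.*-zeroʳ a = trans (trans (⊛-comm (z a) 𝟘 n) (𝟘-⊛ (z a) n)) (sym (+-inverseʳ (𝟙 n)))
  geometric a (suc N) n = begin
    (z a ⊛ (S ⊕ X (a ℕ.* N))) n               ≡⟨ ⊛-distribˡ (z a) S (X (a ℕ.* N)) n ⟩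
    (z a ⊛ S) n + (z a ⊛ X (a ℕ.* N)) n       ≡⟨ cong₂ _+_ (geometric a N n) (z-⊛ a (X (a ℕ.* N)) n) ⟩
    (𝟙 n - X (a ℕ.* N) n) + (X (a ℕ.* N) n - shift a (X (a ℕ.* N)) n)
      ≡⟨ lem (𝟙 n) (X (a ℕ.* N) n) _ ⟩
    𝟙 n - shift a (X (a ℕ.* N)) n             ≡⟨ cong (λ w → 𝟙 n - w) (shift-shift a (a ℕ.* N) 𝟙 n) ⟩
    𝟙 n - X (a ℕ.+ a ℕ.* N) n                 ≡⟨ cong (λ k → 𝟙 n - X k n) (sym (ℕ.*-suc a N)) ⟩
    𝟙 n - X (a ℕ.* suc N) n                   ∎
    where
    open ≡-Reasoning
    S = ∑ˢ N (λ j → X (a ℕ.* j))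
    lem : ∀ a b c → (a - b) + (b - c) ≡ a - c
    lem = ℤ-solve

-- Long division of coefficient lists as division of reversed power series.

module CyclotomicLists where

  open import Defs hiding (S)
  open import Data.Nat using (_<ᵇ_)
  open import Data.Nat.Divisibility using (_∣_; _∣?_)
  open import Data.Integer as ℤ using (ℤ; +_; -_; _+_; _-_; _*_; 0ℤ; 1ℤ; ∣_∣)
  open import Data.Integer.Properties
  open import Data.Bool using (true; false; if_then_else_; T; _∧_)
  open import Data.Bool.Properties using (T-≡)
  open import Data.List
    using (List; []; _∷_; _++_; [_]; _∷ʳ_; map; filter; foldr; reverse; replicate; length; applyUpTo)
  open import Data.List.Properties
    using (length-map; length-reverse; reverse-involutive; unfold-reverse; length-++; length-replicate; map-++; filter-++; filter-accept; filter-reject; applyUpTo-∷ʳ)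
  open import Data.List.Relation.Binary.Permutation.Propositional as ↭ using (_↭_)
  open import Function.Bundles using (Equivalence)
  open Sums
  open Series

  -- With a list of length at most L read as a polynomial P of degree < L,
  -- this is the series x^(L-1) P(1/x): long division works on leading coefficients.
  R : ℕ → List ℤ → Ser
  R L       []      = 𝟘
  R zero    (a ∷ p) = 𝟘
  R (suc L) (a ∷ p) = (a · X L) ⊕ R L p

  R-add : ∀ L p q → R L (polyAdd p q) ≈ R L p ⊕ R L q
  R-add L       []      q       n = sym (+-identityˡ (R L q n))
  R-add L       (a ∷ p) []      n = sym (+-identityʳ (R L (a ∷ p) n))
  R-add zero    (a ∷ p) (b ∷ q) n = refl
  R-add (suc L) (a ∷ p) (b ∷ q) n = trans (cong (λ w → (a + b) * X L n + w) (R-add L p q n)) (lem a b (X L n) _ _)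
    where
    lem : ∀ a b x c d → (a + b) * x + (c + d) ≡ a * x + c + (b * x + d)
    lem = ℤ-solve

  R-map : ∀ L a p → R L (map (a *_) p) ≈ a · R L p
  R-map L       a []      n = sym (*-zeroʳ a)
  R-map zero    a (b ∷ p) n = sym (*-zeroʳ a)
  R-map (suc L) a (b ∷ p) n = trans (cong (λ w → a * b * X L n + w) (R-map L a p n)) (lem a b (X L n) _)
    where
    lem : ∀ a b x c → a * b * x + a * c ≡ a * (b * x + c)
    lem = ℤ-solve

  shift-⊕ : ∀ k f g → shift k (f ⊕ g) ≈ shift k f ⊕ shift k g
  shift-⊕ zero    f g n       = refl
  shift-⊕ (suc k) f g zero    = refl
  shift-⊕ (suc k) f g (suc n) = shift-⊕ k f g n

  shift-· : ∀ k a f → shift k (a · f) ≈ a · shift k f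
  shift-· zero    a f n       = refl
  shift-· (suc k) a f zero    = sym (*-zeroʳ a)
  shift-· (suc k) a f (suc n) = shift-· k a f n

  shift-𝟘 : ∀ k → shift k 𝟘 ≈ 𝟘
  shift-𝟘 zero    n       = refl
  shift-𝟘 (suc k) zero    = refl
  shift-𝟘 (suc k) (suc n) = shift-𝟘 k n

  R-pad : ∀ k L q → length q ℕ.≤ L → R (k ℕ.+ L) q ≈ shift k (R L q)
  R-pad k L       []      _         n = sym (shift-𝟘 k n)
  R-pad k (suc L) (a ∷ q) (s≤s q≤L) n rewrite ℕ.+-suc k L = begin
    a * X (k ℕ.+ L) n + R (k ℕ.+ L) q n
      ≡⟨ cong₂ _+_ (cong (a *_) (sym (shift-shift k L 𝟙 n))) (R-pad k L q q≤L n) ⟩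
    a * shift k (X L) n + shift k (R L q) n
      ≡⟨ cong (_+ shift k (R L q) n) (sym (shift-· k a (X L) n)) ⟩
    shift k (a · X L) n + shift k (R L q) n
      ≡⟨ sym (shift-⊕ k (a · X L) (R L q) n) ⟩
    shift k (R (suc L) (a ∷ q)) n ∎
    where open ≡-Reasoning

  R-0∷ : ∀ L p → R (suc L) (0ℤ ∷ p) ≈ R L p
  R-0∷ L p n = trans (cong (_+ R L p n) (*-zeroˡ (X L n))) (+-identityˡ (R L p n))

  -- Reversal is multiplicative: x^M P(1/x) times x^(N-1) Q(1/x) is x^(M+N-1) (PQ)(1/x), which
  -- explains the asymmetric lengths `suc M` and `N`.
  R-mul : ∀ M N p q → length p ℕ.≤ suc M → length q ℕ.≤ N →
    R (M ℕ.+ N) (polyMul p q) ≈ R (suc M) p ⊛ R N q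
  R-mul M N []      q _         _   n = sym (𝟘-⊛ (R N q) n)
  R-mul M N (a ∷ p) q (s≤s p≤M) q≤N n = begin
    R (M ℕ.+ N) (polyAdd (map (a *_) q) (0ℤ ∷ polyMul p q)) n
      ≡⟨ R-add (M ℕ.+ N) (map (a *_) q) (0ℤ ∷ polyMul p q) n ⟩
    R (M ℕ.+ N) (map (a *_) q) n + R (M ℕ.+ N) (0ℤ ∷ polyMul p q) n
      ≡⟨ cong₂ _+_ first (rest M p p≤M) ⟩
    ((a · X M) ⊛ R N q) n + (R M p ⊛ R N q) n
      ≡⟨ sym (⊛-distribʳ (R N q) (a · X M) (R M p) n) ⟩
    (((a · X M) ⊕ R M p) ⊛ R N q) n ∎
    where
    open ≡-Reasoning
    first : R (M ℕ.+ N) (map (a *_) q) n ≡ ((a · X M) ⊛ R N q) n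
    first = trans (R-map (M ℕ.+ N) a q n) (trans (cong (a *_) (trans (R-pad M N q q≤N n) (sym (X-⊛ M (R N q) n))))
      (sym (·-⊛ a (X M) (R N q) n)))
    rest : ∀ M p → length p ℕ.≤ M → R (M ℕ.+ N) (0ℤ ∷ polyMul p q) n ≡ (R M p ⊛ R N q) n
    rest zero    []  _   = trans (zeros N) (sym (𝟘-⊛ (R N q) n))
      where
      zeros : ∀ N → R N (0ℤ ∷ []) n ≡ 0ℤ
      zeros zero    = refl
      zeros (suc N) = R-0∷ N [] n
    rest (suc M) p p≤M = trans (R-0∷ (M ℕ.+ N) (polyMul p q) n) (R-mul M N p q p≤M q≤N n)

  length-polyAdd : ∀ p q → length (polyAdd p q) ≡ length p ℕ.⊔ length q
  length-polyAdd []      q       = refl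
  length-polyAdd (a ∷ p) []      = refl
  length-polyAdd (a ∷ p) (b ∷ q) = cong suc (length-polyAdd p q)

  length-polyMul : ∀ {d e} p q → length p ≡ suc d → length q ≡ suc e → length (polyMul p q) ≡ suc (d ℕ.+ e)
  length-polyMul {zero} {e} (a ∷ []) q refl |q| = trans (length-polyAdd (map (a *_) q) (0ℤ ∷ []))
    (trans (cong (ℕ._⊔ 1) (trans (length-map (a *_) q) |q|)) (cong suc (ℕ.⊔-identityʳ e)))
  length-polyMul {suc d} {e} (a ∷ p@(_ ∷ _)) q eq |q| = trans (length-polyAdd (map (a *_) q) (0ℤ ∷ polyMul p q))
    (trans (cong₂ ℕ._⊔_ (trans (length-map (a *_) q) |q|) (cong suc (length-polyMul p q (ℕ.suc-injective eq) |q|)))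
      (cong suc (ℕ.m≤n⇒m⊔n≡n (ℕ.≤-trans (ℕ.m≤n+m e d) (ℕ.n≤1+n _)))))

  record Reversed (l : List ℤ) (d : ℕ) (f : Ser) : Set where
    constructor reversed
    field
      length≡ : length l ≡ suc d
      coeffs  : R (suc d) l ≈ f
  open Reversed

  Reversed-mul : ∀ {p q d e f g} → Reversed p d f → Reversed q e g → Reversed (polyMul p q) (d ℕ.+ e) (f ⊛ g)
  Reversed-mul {p} {q} {d} {e} rp rq = reversed (length-polyMul p q (length≡ rp) (length≡ rq)) λ n →
    trans (cong (λ k → R k (polyMul p q) n) (sym (ℕ.+-suc d e)))
      (trans (R-mul d (suc e) p q (ℕ.≤-reflexive (length≡ rp)) (ℕ.≤-reflexive (length≡ rq)) n)
        (⊛-cong (coeffs rp) (coeffs rq) n))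

  hf : List ℤ → Ser
  hf []      n       = 0ℤ
  hf (a ∷ p) zero    = a
  hf (a ∷ p) (suc n) = hf p n

  hf-∷ʳ : ∀ p a → hf (p ∷ʳ a) ≈ (a · X (length p)) ⊕ hf p
  hf-∷ʳ []      a zero    = sym (trans (+-identityʳ (a * 1ℤ)) (*-identityʳ a))
  hf-∷ʳ []      a (suc n) = sym (trans (+-identityʳ (a * 0ℤ)) (*-zeroʳ a))
  hf-∷ʳ (b ∷ p) a zero    = sym (trans (cong (_+ b) (*-zeroʳ a)) (+-identityˡ b))
  hf-∷ʳ (b ∷ p) a (suc n) = hf-∷ʳ p a n

  hf-reverse : ∀ p → hf (reverse p) ≈ R (length p) p
  hf-reverse []      n = refl
  hf-reverse (a ∷ p) n = trans (cong (λ l → hf l n) (unfold-reverse a p)) (trans (hf-∷ʳ (reverse p) a n)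
    (cong₂ (λ k w → a * X k n + w) (length-reverse p) (hf-reverse p n)))

  R-vanish : ∀ L p n → L ℕ.≤ n → R L p n ≡ 0ℤ
  R-vanish L       []      n L≤n = refl
  R-vanish zero    (a ∷ p) n L≤n = refl
  R-vanish (suc L) (a ∷ p) n L<n = trans (cong₂ (λ v w → a * v + w) (X-≢ L n L<n) (R-vanish L p n (ℕ.<⇒≤ L<n)))
    (trans (+-identityʳ (a * 0ℤ)) (*-zeroʳ a))
    where
    X-≢ : ∀ L n → L ℕ.< n → X L n ≡ 0ℤ
    X-≢ zero    (suc n) _         = refl
    X-≢ (suc L) (suc n) (s≤s L<n) = X-≢ L n L<n

  -- The subtraction in divMonicHF is a private name of Defs; unification recovers it.
  mutual
    sub : List ℤ → List ℤ → List ℤ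
    sub = _

    divMonicHF-step : ∀ f a as b bs → divMonicHF (suc f) (a ∷ as) (b ∷ bs) ≡
      (if length (a ∷ as) <ᵇ length (b ∷ bs) then [] else a ∷ divMonicHF f (sub as (map (a *_) bs)) (b ∷ bs))
    divMonicHF-step f a as b bs with map (a *_) bs
    ... | ys = refl

  length-sub : ∀ xs ys → length ys ℕ.≤ length xs → length (sub xs ys) ≡ length xs
  length-sub xs       []       _       = refl
  length-sub (x ∷ xs) (y ∷ ys) (s≤s h) = cong suc (length-sub xs ys h)

  hf-sub : ∀ xs ys n → length ys ℕ.≤ length xs → hf (sub xs ys) n ≡ hf xs n - hf ys n
  hf-sub xs       []       n       _       = sym (+-identityʳ (hf xs n))
  hf-sub (x ∷ xs) (y ∷ ys) zero    _       = refl
  hf-sub (x ∷ xs) (y ∷ ys) (suc n) (s≤s h) = hf-sub xs ys n h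

  hf-map : ∀ a p n → hf (map (a *_) p) n ≡ a * hf p n
  hf-map a []      n       = sym (*-zeroʳ a)
  hf-map a (b ∷ p) zero    = refl
  hf-map a (b ∷ p) (suc n) = hf-map a p n

  -- A division step emits the leading coefficient, which is `W 0` because the divisor is monic, and
  -- leaves a remainder whose leading part is `tail W` times the divisor. Hence the digits are those
  -- of the quotient of power series, and only the first `length a` coefficients of the identity
  -- enter.
  divMonicHF-series : ∀ f a b bs W → length a ℕ.≤ f → b ≡ 1ℤ →
    (∀ k → k ℕ.< length a → (W ⊛ hf (b ∷ bs)) k ≡ hf a k) →
    (length (divMonicHF f a (b ∷ bs)) ≡ length a ∸ length bs) ×
    (∀ k → k ℕ.< length a ∸ length bs → hf (divMonicHF f a (b ∷ bs)) k ≡ W k)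
  divMonicHF-series zero    []       b bs W _         b≡1 eq = sym (ℕ.0∸n≡0 (length bs)) , λ k k< → ⊥-elim (ℕ.n≮0 (subst (k ℕ.<_) (ℕ.0∸n≡0 (length bs)) k<))
  divMonicHF-series (suc f) []       b bs W _         b≡1 eq = sym (ℕ.0∸n≡0 (length bs)) , λ k k< → ⊥-elim (ℕ.n≮0 (subst (k ℕ.<_) (ℕ.0∸n≡0 (length bs)) k<))
  divMonicHF-series (suc f) (a ∷ as) b bs W (s≤s len) b≡1 eq
    rewrite divMonicHF-step f a as b bs with suc (length as) <ᵇ suc (length bs) in lt
  ... | true  = sym short , λ k k< → ⊥-elim (ℕ.n≮0 (subst (k ℕ.<_) short k<))
    where
    short : suc (length as) ∸ length bs ≡ 0
    short = ℕ.m≤n⇒m∸n≡0 (ℕ.≤-pred (ℕ.<ᵇ⇒< (suc (length as)) (suc (length bs)) (Equivalence.from T-≡ lt)))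
  ... | false = trans (cong suc (trans (proj₁ ih) (cong (_∸ length bs) |as′|))) (sym long) , values
    where
    bs≤as : length bs ℕ.≤ length as
    bs≤as = ℕ.≤-pred (ℕ.≮⇒≥ λ h → subst T lt (ℕ.<⇒<ᵇ h))
    mbs≤as : length (map (a *_) bs) ℕ.≤ length as
    mbs≤as = subst (ℕ._≤ length as) (sym (length-map (a *_) bs)) bs≤as
    as′ = sub as (map (a *_) bs)
    |as′| : length as′ ≡ length as
    |as′| = length-sub as (map (a *_) bs) mbs≤as
    long : suc (length as) ∸ length bs ≡ suc (length as ∸ length bs)
    long = ℕ.+-∸-assoc 1 bs≤as
    W0 : W 0 ≡ a
    W0 = trans (sym (*-identityʳ (W 0))) (trans (cong (W 0 *_) (sym b≡1)) (eq 0 (s≤s z≤n)))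
    undo : ∀ a b → b ≡ a + b - a
    undo = ℤ-solve
    eq′ : ∀ k → k ℕ.< length as′ → (tail W ⊛ hf (b ∷ bs)) k ≡ hf as′ k
    eq′ k k< = begin
      (tail W ⊛ hf (b ∷ bs)) k
        ≡⟨ undo (W 0 * hf bs k) _ ⟩
      (W ⊛ hf (b ∷ bs)) (suc k) - W 0 * hf bs k
        ≡⟨ cong₂ (λ v w → v - w * hf bs k) (eq (suc k) (s≤s (subst (k ℕ.<_) |as′| k<))) W0 ⟩
      hf as k - a * hf bs k
        ≡⟨ cong (λ w → hf as k - w) (sym (hf-map a bs k)) ⟩
      hf as k - hf (map (a *_) bs) k
        ≡⟨ sym (hf-sub as (map (a *_) bs) k mbs≤as) ⟩
      hf as′ k ∎
      where open ≡-Reasoning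
    ih = divMonicHF-series f as′ b bs (tail W) (subst (ℕ._≤ f) (sym |as′|) len) b≡1 eq′
    values : ∀ k → k ℕ.< suc (length as) ∸ length bs → hf (a ∷ divMonicHF f as′ (b ∷ bs)) k ≡ W k
    values zero    _  = sym W0
    values (suc k) k< = proj₂ ih k (subst (λ l → k ℕ.< l ∸ length bs) (sym |as′|) (ℕ.≤-pred (subst (suc k ℕ.<_) long k<)))

  -- Describes the quotient up to its degree while W is merely a series. This is the form used for
  -- Φ_3qr, where a bound on every coefficient of the series is enough.
  polyDivMonic-series : ∀ {a b d e f g} W → Reversed a d f → Reversed b e g → g 0 ≡ 1ℤ → e ℕ.≤ d →
    (∀ k → k ℕ.≤ d → (W ⊛ g) k ≡ f k) →
    (length (polyDivMonic a b) ≡ suc (d ∸ e)) × (∀ k → k ℕ.≤ d ∸ e → R (suc (d ∸ e)) (polyDivMonic a b) k ≡ W k)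
  polyDivMonic-series {a} {b} {d} {e} {f} {g} W ra rb g0 e≤d eq = go (reverse b) refl
    where
    Sb : hf (reverse b) ≈ g
    Sb n = trans (hf-reverse b n) (trans (cong (λ k → R k b n) (length≡ rb)) (coeffs rb n))
    Sa : hf (reverse a) ≈ f
    Sa n = trans (hf-reverse a n) (trans (cong (λ k → R k a n) (length≡ ra)) (coeffs ra n))
    |a| : length (reverse a) ≡ suc d
    |a| = trans (length-reverse a) (length≡ ra)
    go : ∀ l → reverse b ≡ l →
      (length (polyDivMonic a b) ≡ suc (d ∸ e)) × (∀ k → k ℕ.≤ d ∸ e → R (suc (d ∸ e)) (polyDivMonic a b) k ≡ W k)
    go [] rev≡ with () ← trans (sym (length≡ rb)) (trans (sym (length-reverse b)) (cong length rev≡))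
    go (b₀ ∷ bs) rev≡ = lenq , λ k k≤ → begin
        R (suc (d ∸ e)) (polyDivMonic a b) k                      ≡⟨ cong (λ l → R l (polyDivMonic a b) k) (sym lenq) ⟩
        R (length (polyDivMonic a b)) (polyDivMonic a b) k        ≡⟨ cong (λ l → R l (polyDivMonic a b) k) (length-reverse q) ⟩
        R (length q) (reverse q) k                                ≡⟨ R-reverse k ⟩
        hf q k                                                     ≡⟨ cong (λ l → hf (divMonicHF (length a) (reverse a) l) k) rev≡ ⟩
        hf (divMonicHF (length a) (reverse a) (b₀ ∷ bs)) k         ≡⟨ proj₂ main k (subst (k ℕ.<_) (sym sizes) (s≤s k≤)) ⟩
        W k                                                       ∎
      where
      open ≡-Reasoning
      q = divMonicHF (length a) (reverse a) (reverse b)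
      R-reverse : ∀ k → R (length q) (reverse q) k ≡ hf q k
      R-reverse k = trans (cong (λ l → R l (reverse q) k) (sym (length-reverse q)))
        (trans (sym (hf-reverse (reverse q) k)) (cong (λ l → hf l k) (reverse-involutive q)))
      |bs| : length bs ≡ e
      |bs| = ℕ.suc-injective (trans (cong length (sym rev≡)) (trans (length-reverse b) (length≡ rb)))
      main = divMonicHF-series (length a) (reverse a) b₀ bs W (ℕ.≤-reflexive (length-reverse a))
        (trans (cong (λ l → hf l 0) (sym rev≡)) (trans (Sb 0) g0))
        (λ k k< → trans (⊛-cong {f = W} (λ _ → refl) (λ n → trans (cong (λ l → hf l n) (sym rev≡)) (Sb n)) k)
          (trans (eq k (ℕ.≤-pred (subst (k ℕ.<_) |a| k<))) (sym (Sa k))))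
      sizes : length (reverse a) ∸ length bs ≡ suc (d ∸ e)
      sizes = trans (cong₂ _∸_ |a| |bs|) (ℕ.+-∸-assoc 1 e≤d)
      lenq : length (polyDivMonic a b) ≡ suc (d ∸ e)
      lenq = trans (length-reverse q) (trans (cong (λ l → length (divMonicHF (length a) (reverse a) l)) rev≡)
        (trans (proj₁ main) sizes))

  -- Once W is known to stop at the degree of the quotient, list and series agree at all indices, so
  -- the quotient can enter further products; this is used for Φ₁, Φ_p and Φ_pq.
  Reversed-div : ∀ {a b d e f g} W → Reversed a d f → Reversed b e g → g 0 ≡ 1ℤ → e ℕ.≤ d →
    W ⊛ g ≈ f → (∀ k → d ∸ e ℕ.< k → W k ≡ 0ℤ) → Reversed (polyDivMonic a b) (d ∸ e) W
  Reversed-div {a} {b} {d} {e} W ra rb g0 e≤d eq vanish = reversed (proj₁ main) values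
    where
    main = polyDivMonic-series W ra rb g0 e≤d (λ k _ → eq k)
    values : R (suc (d ∸ e)) (polyDivMonic a b) ≈ W
    values k with ℕ.≤-<-connex k (d ∸ e)
    ... | inj₁ k≤ = proj₂ main k k≤
    ... | inj₂ k> = trans (R-vanish (suc (d ∸ e)) (polyDivMonic a b) k k>) (sym (vanish k k>))

  isFlat-R : ∀ L l → length l ≡ L → (∀ k → k ℕ.< L → ∣ R L l k ∣ ℕ.≤ 1) → isFlat l ≡ true
  isFlat-R zero    []      _   _ = refl
  isFlat-R (suc L) (a ∷ l) len b = cong₂ _∧_ (Equivalence.to T-≡ (ℕ.≤⇒≤ᵇ (subst (λ w → ∣ w ∣ ℕ.≤ 1) top (b L ℕ.≤-refl))))
    (isFlat-R L l (ℕ.suc-injective len) (λ k k<L → subst (λ w → ∣ w ∣ ℕ.≤ 1) (low k k<L) (b k (ℕ.m<n⇒m<1+n k<L))))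
    where
    top : a * X L L + R L l L ≡ a
    top = trans (cong₂ (λ v w → a * v + w) (trans (cong (X L) (sym (ℕ.+-identityʳ L))) (shift-+ L 𝟙 0)) (R-vanish L l L ℕ.≤-refl))
      (trans (+-identityʳ (a * 1ℤ)) (*-identityʳ a))
    low : ∀ k → k ℕ.< L → a * X L k + R L l k ≡ R L l k
    low k k<L = trans (cong (λ v → a * v + R L l k) (shift-< L 𝟙 k<L)) (trans (cong (_+ R L l k) (*-zeroʳ a)) (+-identityˡ _))

  -- Reversal turns x^m - 1 into 1 - x^m, which is invertible as a power series; all later
  -- identities are between such binomials.
  Reversed-xPowMinusOne : ∀ n → Reversed (xPowMinusOne (suc n)) (suc n) (z (suc n))
  Reversed-xPowMinusOne n = reversed
    (cong suc (trans (length-++ (replicate n 0ℤ)) (trans (cong (ℕ._+ 1) (length-replicate n)) (ℕ.+-comm n 1))))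
    (λ k → trans (cong₂ _+_ (-1*i≡-i (X (suc n) k)) (zeros n k)) (+-comm (- X (suc n) k) (𝟙 k)))
    where
    zeros : ∀ n → R (suc n) (replicate n 0ℤ ++ [ 1ℤ ]) ≈ 𝟙
    zeros zero    k = trans (+-identityʳ (1ℤ * 𝟙 k)) (*-identityˡ (𝟙 k))
    zeros (suc n) k = trans (R-0∷ (suc n) (replicate n 0ℤ ++ [ 1ℤ ]) k) (zeros n k)

  divisorsBelow : ℕ → ℕ → List ℕ
  divisorsBelow m n = filter (_∣? m) (applyUpTo suc n)

  filter-cycloTable : ∀ m n → map proj₂ (filter (λ e → proj₁ e ∣? m) (cycloTable n)) ≡ map cyclotomic (divisorsBelow m n)
  filter-cycloTable m zero    = refl
  filter-cycloTable m (suc n) = begin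
    map proj₂ (filter P? (cycloTable n ++ [ (suc n , cyclotomic (suc n)) ]))
      ≡⟨ cong (map proj₂) (filter-++ P? (cycloTable n) _) ⟩
    map proj₂ (filter P? (cycloTable n) ++ filter P? [ (suc n , cyclotomic (suc n)) ])
      ≡⟨ map-++ proj₂ (filter P? (cycloTable n)) _ ⟩
    map proj₂ (filter P? (cycloTable n)) ++ map proj₂ (filter P? [ (suc n , cyclotomic (suc n)) ])
      ≡⟨ cong₂ _++_ (filter-cycloTable m n) last ⟩
    map cyclotomic (divisorsBelow m n) ++ map cyclotomic (filter (_∣? m) [ suc n ])
      ≡⟨ sym (map-++ cyclotomic (divisorsBelow m n) _) ⟩
    map cyclotomic (divisorsBelow m n ++ filter (_∣? m) [ suc n ])
      ≡⟨ cong (map cyclotomic) (sym (filter-++ (_∣? m) (applyUpTo suc n) _)) ⟩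
    map cyclotomic (filter (_∣? m) (applyUpTo suc n ∷ʳ suc n))
      ≡⟨ cong (λ l → map cyclotomic (filter (_∣? m) l)) (applyUpTo-∷ʳ suc n) ⟩
    map cyclotomic (divisorsBelow m (suc n)) ∎
    where
    open ≡-Reasoning
    P? : (e : ℕ × List ℤ) → Dec (proj₁ e ∣ m)
    P? e = proj₁ e ∣? m
    last : map proj₂ (filter P? [ (suc n , cyclotomic (suc n)) ]) ≡ map cyclotomic (filter (_∣? m) [ suc n ])
    last with suc n ∣? m
    ... | yes d = trans (cong (map proj₂) (filter-accept P? d)) (cong (map cyclotomic) (sym (filter-accept (_∣? m) d)))
    ... | no ¬d = trans (cong (map proj₂) (filter-reject P? ¬d)) (cong (map cyclotomic) (sym (filter-reject (_∣? m) ¬d)))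

  -- Degree and series are tied to the factors by equations stored in `cons`: series are compared
  -- only up to `≈`, and exchanging two factors reassociates both the sum of degrees and the
  -- product.
  data Product : List ℕ → ℕ → Ser → Set where
    nil  : ∀ {F} → 𝟙 ≈ F → Product [] 0 F
    cons : ∀ {d ds e E E′ f F F′} → Reversed (cyclotomic d) e f → Product ds E F →
      e ℕ.+ E ≡ E′ → f ⊛ F ≈ F′ → Product (d ∷ ds) E′ F′

  Product-reversed : ∀ {ds E F} → Product ds E F → Reversed (foldr polyMul [ 1ℤ ] (map cyclotomic ds)) E F
  Product-reversed (nil F) = reversed refl (λ n → trans (trans (+-identityʳ (1ℤ * 𝟙 n)) (*-identityˡ (𝟙 n))) (F n))
  Product-reversed (cons r P refl eq) = let m = Reversed-mul r (Product-reversed P) in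
    reversed (length≡ m) (λ n → trans (coeffs m n) (eq n))

  -- The table lists divisors by size, but whether R or 3Q comes first among the divisors of 3QR
  -- depends on the primes. Products are therefore matched up to permutation.
  Product-↭ : ∀ {ds ds′ E F} → ds ↭ ds′ → Product ds E F → Product ds′ E F
  Product-↭ ↭.refl P = P
  Product-↭ (↭.prep x p) (cons r P e f) = cons r (Product-↭ p P) e f
  Product-↭ (↭.swap x y p) (cons {e = a} {f = f} r (cons {e = b} {E = c} {f = g} {F = h} s P refl eq) refl eq′) =
    cons s (cons r (Product-↭ p P) refl ≈-refl)
      (trans (sym (ℕ.+-assoc b a c)) (trans (cong (ℕ._+ c) (ℕ.+-comm b a)) (ℕ.+-assoc a b c)))
      (≈-trans (≈-sym (⊛-assoc g f h)) (≈-trans (⊛-cong (⊛-comm g f) (≈-refl {h}))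
        (≈-trans (⊛-assoc f g h) (≈-trans (⊛-cong (≈-refl {f}) eq) eq′))))
  Product-↭ (↭.trans p q) P = Product-↭ q (Product-↭ p P)

-- The polynomials Φ₁, Φ_p and Φ_pq.

module SmallCyclotomics where

  open import Defs hiding (S; F)
  open import Data.Nat using (_+_; _*_; _≤_; _<_)
  open import Data.Nat.Properties
  open import Data.Nat.Divisibility
  open import Data.Nat.Coprimality as Coprimality using (Coprime; coprime-divisor)
  open import Data.Nat.Primality using (Prime; prime⇒nonZero; prime⇒nonTrivial; prime⇒irreducible)
  open import Data.Integer as ℤ using (ℤ; 0ℤ; 1ℤ)
  import Data.Integer.Properties as ℤ
  open import Data.List using ([]; _∷_; [_]; foldr; map; filter; applyUpTo)
  open import Data.List.Membership.Propositional using (_∈_)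
  open import Data.List.Membership.Propositional.Properties using (∈-filter⁺; ∈-filter⁻; ∈-applyUpTo⁺; ∈-applyUpTo⁻)
  open import Data.List.Membership.Propositional.Properties.WithK using (unique∧set⇒bag)
  open import Data.List.Relation.Binary.BagAndSetEquality using (∼bag⇒↭)
  open import Data.List.Relation.Binary.Permutation.Propositional using (_↭_; ↭-sym)
  open import Data.List.Relation.Unary.Any using (here; there)
  open import Data.List.Relation.Unary.All as All using (All)
  open import Data.List.Relation.Unary.AllPairs as AllPairs using ()
  open import Data.List.Relation.Unary.Unique.Propositional using (Unique)
  open import Data.List.Relation.Unary.Unique.Propositional.Properties using (filter⁺; applyUpTo⁺₁)
  open import Function.Bundles using (mk⇔)
  open import Algebra.Bundles using (CommutativeRing)
  open import Data.Maybe using (nothing)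
  open Sums
  open Series
  open CyclotomicLists

  module Rearrange {c ℓ} (𝓡 : CommutativeRing c ℓ) where
    open import Tactic.RingSolver using (solve-∀)
    open import Tactic.RingSolver.Core.AlmostCommutativeRing using (AlmostCommutativeRing; fromCommutativeRing)

    private
      ring : AlmostCommutativeRing c ℓ
      ring = fromCommutativeRing 𝓡 (λ _ → nothing)
    open AlmostCommutativeRing ring using () renaming (_*_ to _∙_; _≈_ to _∼_)

    two-pairs : ∀ z g s p q → (z ∙ (g ∙ s)) ∙ (z ∙ (p ∙ q)) ∼ (z ∙ p) ∙ g ∙ ((z ∙ q) ∙ s)
    two-pairs = solve-∀ ring

  open Rearrange series

  divisors-↭ : ∀ n ds → Unique ds → (∀ {d} → d ∈ ds → d ∣ suc n × d ≢ suc n) →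
    (∀ {d} → d ∣ suc n → d ≢ suc n → d ∈ ds) → divisorsBelow (suc n) n ↭ ds
  divisors-↭ n ds unique sound complete = ∼bag⇒↭ (unique∧set⇒bag
    (filter⁺ (_∣? suc n) {xs = applyUpTo suc n} (applyUpTo⁺₁ suc n (λ i<j _ eq → <⇒≢ i<j (suc-injective eq)))) unique (mk⇔ to from))
    where
    to : ∀ {d} → d ∈ divisorsBelow (suc n) n → d ∈ ds
    to d∈ with ∈-filter⁻ (_∣? suc n) {xs = applyUpTo suc n} d∈
    ... | d∈range , d∣ with ∈-applyUpTo⁻ suc d∈range
    ... | i , i<n , refl = complete d∣ (λ eq → <⇒≢ i<n (suc-injective eq))
    from : ∀ {d} → d ∈ ds → d ∈ divisorsBelow (suc n) n
    from {zero}  d∈ with () ← 0∣⇒≡0 (proj₁ (sound d∈))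
    from {suc d} d∈ = ∈-filter⁺ (_∣? suc n)
      (∈-applyUpTo⁺ suc (≤∧≢⇒< (≤-pred (∣⇒≤ (proj₁ (sound d∈)))) (λ eq → proj₂ (sound d∈) (cong suc eq)))) (proj₁ (sound d∈))

  newCyclo-divisor : ∀ n {ds E F} → divisorsBelow (suc n) n ↭ ds → Product ds E F →
    Reversed (foldr polyMul [ 1ℤ ] (map proj₂ (filter (λ e → proj₁ e ∣? suc n) (cycloTable n)))) E F
  newCyclo-divisor n {E = E} {F} perm P = subst (λ l → Reversed (foldr polyMul [ 1ℤ ] l) E F)
    (sym (filter-cycloTable (suc n) n)) (Product-reversed (Product-↭ (↭-sym perm) P))

  Reversed-cyclotomic : ∀ n {ds E F} W → divisorsBelow (suc n) n ↭ ds → Product ds E F → F 0 ≡ 1ℤ → E ≤ suc n →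
    W ⊛ F ≈ z (suc n) → (∀ k → suc n ∸ E < k → W k ≡ 0ℤ) → Reversed (cyclotomic (suc n)) (suc n ∸ E) W
  Reversed-cyclotomic n W perm P F0 E≤ eq vanish =
    Reversed-div W (Reversed-xPowMinusOne n) (newCyclo-divisor n perm P) F0 E≤ eq vanish

  Φ₁ : Reversed (cyclotomic 1) 1 (z 1)
  Φ₁ = Reversed-cyclotomic 0 (z 1) (divisors-↭ 0 [] AllPairs.[] (λ ()) (λ d∣1 d≢1 → ⊥-elim (d≢1 (∣1⇒≡1 d∣1)))) (nil ≈-refl) refl z≤n
    (λ n → trans (⊛-comm (z 1) 𝟙 n) (𝟙-⊛ (z 1) n)) (λ where
      (suc zero) (s≤s ())
      (suc (suc k)) _ → refl)

  prime⇒coprime′ : ∀ {p d} → Prime p → ¬ p ∣ d → Coprime d p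
  prime⇒coprime′ pp p∤d (x∣d , x∣p) with prime⇒irreducible pp x∣p
  ... | inj₁ x≡1 = x≡1
  ... | inj₂ refl = ⊥-elim (p∤d x∣d)

  ∣-prime-* : ∀ {p m d} → Prime p → d ∣ p * m → d ∣ m ⊎ (∃[ e ] (d ≡ p * e × e ∣ m))
  ∣-prime-* {p} {m} {d} pp d∣ with p ∣? d
  ... | no p∤d = inj₁ (coprime-divisor (prime⇒coprime′ pp p∤d) d∣)
  ... | yes (divides e refl) = inj₂ (e , *-comm e p , *-cancelˡ-∣ p {{prime⇒nonZero pp}} (subst (_∣ p * m) (*-comm e p) d∣))

  prime∤1 : ∀ {p} → Prime p → ¬ p ∣ 1
  prime∤1 pp p∣1 = ℕ.nonTrivial⇒≢1 {{prime⇒nonTrivial pp}} (∣1⇒≡1 p∣1)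

  prime∣prime⇒≡ : ∀ {p q} → Prime p → Prime q → p ∣ q → p ≡ q
  prime∣prime⇒≡ pp pq p∣q with prime⇒irreducible pq p∣q
  ... | inj₁ p≡1 = ⊥-elim (ℕ.nonTrivial⇒≢1 {{prime⇒nonTrivial pp}} p≡1)
  ... | inj₂ p≡q = p≡q

  -- The exponents are written `1 * j` to match `geometric` with a = 1.
  repunit : ℕ → Ser
  repunit p = ∑ˢ p (λ j → X (1 * j))

  z-repunit : ∀ p → z 1 ⊛ repunit p ≈ z p
  z-repunit p n = trans (geometric 1 p n) (cong (λ k → z k n) (*-identityˡ p))

  repunit-0 : ∀ p .{{_ : NonZero p}} → repunit p 0 ≡ 1ℤ
  repunit-0 p = trans (sym (ℤ.*-identityˡ (repunit p 0))) (trans (z-repunit p 0) (z-0 p))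

  X-vanish : ∀ {a k} → a < k → X a k ≡ 0ℤ
  X-vanish {zero}  {suc k} _         = refl
  X-vanish {suc a} {suc k} (s≤s a<k) = X-vanish {a} {k} a<k

  Φₚ : ∀ {n} → Prime (suc n) → Reversed (cyclotomic (suc n)) n (repunit (suc n))
  Φₚ {n} pp = Reversed-cyclotomic n (repunit (suc n))
    (divisors-↭ n [ 1 ] (All.[] AllPairs.∷ AllPairs.[]) (λ where (here refl) → 1∣ suc n , λ eq → ℕ.nonTrivial⇒≢1 {{prime⇒nonTrivial pp}} (sym eq)) complete)
    (cons Φ₁ (nil ≈-refl) refl (λ k → trans (⊛-comm (z 1) 𝟙 k) (𝟙-⊛ (z 1) k))) refl (s≤s z≤n)
    (λ k → trans (⊛-comm (repunit (suc n)) (z 1) k) (z-repunit (suc n) k))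
    (λ k n<k → ∑-zero (suc n) (λ j j≤n → X-vanish (≤-<-trans (≤-reflexive (*-identityˡ j)) (≤-<-trans (≤-pred j≤n) n<k))))
    where
    complete : ∀ {d} → d ∣ suc n → d ≢ suc n → d ∈ [ 1 ]
    complete d∣ d≢ with prime⇒irreducible pp d∣
    ... | inj₁ refl = here refl
    ... | inj₂ refl = ⊥-elim (d≢ refl)

  -- The generating function of the numerical semigroup ⟨p, q⟩; Φ_pq is 1 - x times it.
  semigroup : ℕ → ℕ → Ser
  semigroup p q = G p ⊛ ∑ˢ p (λ j → X (q * j))

  semigroup-coeff : ∀ p q n → semigroup p q n ≡ ∑ p (λ j → shift (q * j) (G p) n)
  semigroup-coeff p q n = trans (⊛-comm (G p) (∑ˢ p (λ j → X (q * j))) n) (trans (∑ˢ-⊛ p (λ j → X (q * j)) (G p) n)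
    (∑-cong p (λ j _ → X-⊛ (q * j) (G p) n)))

  -- Sylvester's conductor of the semigroup generated by P = p + 1 and Q = q + 1. Let j < P solve Qj
  -- ≡ n modulo P. If Qj exceeded n, the difference would be a positive multiple of P, yet it is at
  -- most Qp - pq = p. The congruence appears as pQj + n ≡ 0 to stay in ℕ.
  semigroup-conductor : ∀ p q n → Coprime (suc q) (suc p) → p * q ≤ n → semigroup (suc p) (suc q) n ≡ 1ℤ
  semigroup-conductor p q n q⊥p pq≤n = trans (semigroup-coeff (suc p) (suc q) n)
    (trans (∑-cong (suc p) (λ j j<p → term j j<p (≤-<-connex (suc q * j) n)))
      (∑-linear-congruence (p * suc q) n (suc p) pq⊥p))
    where
    pq⊥p : Coprime (p * suc q) (suc p)
    pq⊥p {x} (x∣pq , x∣p) = q⊥p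
      (∣m+n∣m⇒∣n (subst (x ∣_) (+-comm (suc q) (p * suc q)) (∣m⇒∣m*n (suc q) x∣p)) x∣pq , x∣p)
    lem₁ : ∀ p Q j d → p * Q * j + (Q * j + d) ≡ (1 + p) * (Q * j) + d
    lem₁ = ℕ-solve
    lem₂ : ∀ p Q j → p * Q * j + Q * j ≡ (1 + p) * (Q * j)
    lem₂ = ℕ-solve
    term : ∀ j → j < suc p → suc q * j ≤ n ⊎ n < suc q * j →
      shift (suc q * j) (G (suc p)) n ≡ ⟦ suc p ∣? p * suc q * j + n ⟧
    term j j<p (inj₁ qj≤n) = trans
      (trans (cong (shift (suc q * j) (G (suc p))) (sym (m+[n∸m]≡n qj≤n))) (shift-+ (suc q * j) (G (suc p)) (n ∸ suc q * j)))
      (⟦⟧-cong (suc p ∣? n ∸ suc q * j) (suc p ∣? p * suc q * j + n)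
        (λ d → subst (suc p ∣_) (sym eq) (∣m∣n⇒∣m+n (m∣m*n (suc q * j)) d))
        (λ d → ∣m+n∣m⇒∣n (subst (suc p ∣_) eq d) (m∣m*n (suc q * j))))
      where
      eq : p * suc q * j + n ≡ suc p * (suc q * j) + (n ∸ suc q * j)
      eq = trans (cong (p * suc q * j +_) (sym (m+[n∸m]≡n qj≤n))) (lem₁ p (suc q) j (n ∸ suc q * j))
    term j j<p (inj₂ n<qj) = trans (shift-< (suc q * j) (G (suc p)) n<qj)
      (sym (⟦⟧-no (suc p ∣? p * suc q * j + n) contra))
      where
      gap = suc q * j ∸ n
      lem₃ : ∀ p q → (1 + q) * p ≡ p + p * q
      lem₃ = ℕ-solve
      gap<p : gap < suc p
      gap<p = s≤s (m≤n+o⇒m∸n≤o (suc q * j) n (≤-trans (*-monoʳ-≤ (suc q) (≤-pred j<p))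
        (≤-trans (≤-reflexive (lem₃ p q)) (≤-trans (+-monoʳ-≤ p pq≤n) (≤-reflexive (+-comm p n))))))
      contra : ¬ suc p ∣ p * suc q * j + n
      contra d = <⇒≱ gap<p (∣⇒≤ {{ℕ.>-nonZero (m<n⇒0<n∸m n<qj)}} (∣m+n∣m⇒∣n (subst (suc p ∣_) (sym eq) (m∣m*n (suc q * j))) d))
        where
        eq : p * suc q * j + n + gap ≡ suc p * (suc q * j)
        eq = trans (+-assoc (p * suc q * j) n gap) (trans (cong (p * suc q * j +_) (m+[n∸m]≡n (<⇒≤ n<qj))) (lem₂ p (suc q) j))

  semigroup-z : ∀ p q .{{_ : NonZero p}} → z p ⊛ G p ⊛ (z q ⊛ ∑ˢ p (λ j → X (q * j))) ≈ z (q * p)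
  semigroup-z p q = ≈-trans (⊛-cong (z-⊛-G p) (geometric q p)) (𝟙-⊛ (z (q * p)))

  -- From the conductor on, the coefficients of `semigroup` are constantly 1, so the factor 1 - x
  -- ends the series at degree pq = (P - 1)(Q - 1).
  Φₚᵩ : ∀ p q → Prime (suc p) → Prime (suc q) → suc p ≢ suc q →
    Reversed (cyclotomic (suc p * suc q)) (p * q) (z 1 ⊛ semigroup (suc p) (suc q))
  Φₚᵩ p q pp pq p≢q = subst (λ d → Reversed (cyclotomic (suc p * suc q)) d W) degree
    (Reversed-cyclotomic (q + p * suc q) W
      (divisors-↭ (q + p * suc q) ds unique sound complete)
      (cons Φ₁ (cons (Φₚ pp) (cons (Φₚ pq) (nil ≈-refl) refl (λ k → trans (⊛-comm (repunit Q) 𝟙 k) (𝟙-⊛ (repunit Q) k))) refl ≈-refl) refl ≈-refl)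
      (⊛-0 {z 1} {repunit P ⊛ repunit Q} refl (⊛-0 {repunit P} {repunit Q} (repunit-0 P) (repunit-0 Q)))
      (s≤s (≤-trans (≤-reflexive (trans (cong (p +_) (+-identityʳ q)) (+-comm p q))) (+-monoʳ-≤ q (m≤m*n p Q))))
      (≈-trans (two-pairs (z 1) (G P) (∑ˢ P (λ j → X (Q * j))) (repunit P) (repunit Q))
        (≈-trans (⊛-cong (⊛-cong (z-repunit P) (≈-refl {G P})) (⊛-cong (z-repunit Q) (≈-refl {∑ˢ P (λ j → X (Q * j))})))
          (≈-trans (semigroup-z P Q) (λ k → cong (λ m → z m k) (*-comm Q P)))))
      (λ k k> → vanish k (subst (_< k) degree k>)))
    where
    P = suc p
    Q = suc q
    W = z 1 ⊛ semigroup P Q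
    ds = 1 ∷ P ∷ Q ∷ []
    q⊥p : Coprime Q P
    q⊥p = prime⇒coprime′ pp (λ P∣Q → p≢q (prime∣prime⇒≡ pp pq P∣Q))
    lem : ∀ p q → q + p * (1 + q) ≡ (p + (q + 0)) + p * q
    lem = ℕ-solve
    degree : suc (q + p * suc q) ∸ (1 + (p + (q + 0))) ≡ p * q
    degree = trans (cong (_∸ (p + (q + 0))) (lem p q)) (m+n∸m≡n (p + (q + 0)) (p * q))
    vanish : ∀ k → p * q < k → W k ≡ 0ℤ
    vanish (suc k) (s≤s pq≤k) = trans (z-⊛ 1 (semigroup P Q) (suc k))
      (cong₂ ℤ._-_ (semigroup-conductor p q (suc k) q⊥p (m≤n⇒m≤1+n pq≤k)) (semigroup-conductor p q k q⊥p pq≤k))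
    1≢ : ∀ {r} → Prime r → 1 ≢ r
    1≢ {r} pr eq = prime∤1 pr (subst (r ∣_) (sym eq) ∣-refl)
    unique : Unique ds
    unique = (1≢ pp All.∷ 1≢ pq All.∷ All.[]) AllPairs.∷ (p≢q All.∷ All.[]) AllPairs.∷ All.[] AllPairs.∷ AllPairs.[]
    sound : ∀ {d} → d ∈ ds → d ∣ P * Q × d ≢ P * Q
    sound (here refl)                 = 1∣ (P * Q) , λ eq → 1≢ pp (sym (m*n≡1⇒m≡1 P Q (sym eq)))
    sound (there (here refl))         = m∣m*n Q , λ eq → 1≢ pq (*-cancelˡ-≡ 1 Q P (trans (*-identityʳ P) eq))
    sound (there (there (here refl))) = n∣m*n P , λ eq → 1≢ pp (*-cancelʳ-≡ 1 P Q (trans (*-identityˡ Q) eq))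
    complete : ∀ {d} → d ∣ P * Q → d ≢ P * Q → d ∈ ds
    complete d∣ d≢ with ∣-prime-* pp d∣
    complete d∣ d≢ | inj₁ d∣q with prime⇒irreducible pq d∣q
    ... | inj₁ refl = here refl
    ... | inj₂ refl = there (there (here refl))
    complete d∣ d≢ | inj₂ (e , refl , e∣q) with prime⇒irreducible pq e∣q
    ... | inj₁ refl = there (here (*-identityʳ P))
    ... | inj₂ refl = ⊥-elim (d≢ refl)

-- Three consecutive coefficients, reduced to a finite check modulo 3.

module Flatness where

  open import Data.Nat using (_≤?_; _<?_)
  open import Data.Nat.Divisibility using (_∣_; _∣?_; ∣m+n∣m⇒∣n; ∣m∣n⇒∣m+n; ∣-refl; _∣0)
  open import Data.Integer as ℤ using (ℤ; _+_; _-_; _*_; 0ℤ; 1ℤ; -1ℤ; ∣_∣)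
  open import Data.List using (List; []; _∷_)
  open import Data.List.Membership.Propositional using (_∈_)
  open import Data.List.Relation.Unary.All as All using (All; all?)
  open import Data.List.Relation.Unary.Any using (here; there)
  open import Relation.Nullary.Decidable using (toWitness)
  open import Data.Unit using (tt)
  open Sums

  -- The coefficients of (1 - y)/(1 - y³).
  χ : ℕ → ℤ
  χ 0                   = 1ℤ
  χ 1                   = -1ℤ
  χ 2                   = 0ℤ
  χ (suc (suc (suc n))) = χ n

  χ-+3* : ∀ k a → χ (a ℕ.+ 3 ℕ.* k) ≡ χ a
  χ-+3* zero    a = cong χ (ℕ.+-identityʳ a)
  χ-+3* (suc k) a = trans (cong χ (lem a k)) (χ-+3* k a)
    where
    lem : ∀ a k → a ℕ.+ 3 ℕ.* (1 ℕ.+ k) ≡ 3 ℕ.+ (a ℕ.+ 3 ℕ.* k)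
    lem = ℕ-solve

  χ-cong : ∀ a b k l → a ℕ.+ 3 ℕ.* k ≡ b ℕ.+ 3 ℕ.* l → χ a ≡ χ b
  χ-cong a b k l eq = trans (sym (χ-+3* k a)) (trans (cong χ eq) (χ-+3* l b))

  χ-suc : ∀ n → χ (suc n) ≡ ⟦ 3 ∣? suc n ⟧ - ⟦ 3 ∣? n ⟧
  χ-suc 0 = refl
  χ-suc 1 = refl
  χ-suc 2 = refl
  χ-suc (suc (suc (suc n))) = trans (χ-suc n) (cong₂ _-_ (period (suc n)) (period n))
    where
    period : ∀ n → ⟦ 3 ∣? n ⟧ ≡ ⟦ 3 ∣? 3 ℕ.+ n ⟧
    period n = ⟦⟧-cong (3 ∣? n) (3 ∣? 3 ℕ.+ n) (∣m∣n⇒∣m+n ∣-refl) (λ d → ∣m+n∣m⇒∣n d ∣-refl)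

  -- The values of χ along a, a + R, a + 2R when 3 ∤ R: the first three arise from R ≡ 1, the last
  -- three from R ≡ 2.
  triples : List (ℤ × ℤ × ℤ)
  triples = (1ℤ , -1ℤ , 0ℤ) ∷ (-1ℤ , 0ℤ , 1ℤ) ∷ (0ℤ , 1ℤ , -1ℤ)
          ∷ (1ℤ , 0ℤ , -1ℤ) ∷ (-1ℤ , 1ℤ , 0ℤ) ∷ (0ℤ , -1ℤ , 1ℤ) ∷ []

  χ-triple : ∀ a R → ¬ 3 ∣ R → (χ a , χ (a ℕ.+ R) , χ (a ℕ.+ 2 ℕ.* R)) ∈ triples
  χ-triple a 0 3∤R = ⊥-elim (3∤R (3 ∣0))
  χ-triple 0 1 _ = here refl
  χ-triple 1 1 _ = there (here refl)
  χ-triple 2 1 _ = there (there (here refl))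
  χ-triple (suc (suc (suc a))) 1 3∤R = χ-triple a 1 3∤R
  χ-triple 0 2 _ = there (there (there (here refl)))
  χ-triple 1 2 _ = there (there (there (there (here refl))))
  χ-triple 2 2 _ = there (there (there (there (there (here refl)))))
  χ-triple (suc (suc (suc a))) 2 3∤R = χ-triple a 2 3∤R
  χ-triple a (suc (suc (suc R))) 3∤R = subst (_∈ triples)
    (cong₂ (λ b c → χ a , b , c) (χ-cong (a ℕ.+ R) (a ℕ.+ (3 ℕ.+ R)) 1 0 (lem₁ a R))
      (χ-cong (a ℕ.+ 2 ℕ.* R) (a ℕ.+ 2 ℕ.* (3 ℕ.+ R)) 2 0 (lem₂ a R)))
    (χ-triple a R (λ d → 3∤R (∣m∣n⇒∣m+n ∣-refl d)))
    where
    lem₁ : ∀ a R → a ℕ.+ R ℕ.+ 3 ≡ a ℕ.+ (3 ℕ.+ R) ℕ.+ 0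
    lem₁ = ℕ-solve
    lem₂ : ∀ a R → a ℕ.+ 2 ℕ.* R ℕ.+ 6 ≡ a ℕ.+ 2 ℕ.* (3 ℕ.+ R) ℕ.+ 0
    lem₂ = ℕ-solve

  chains : List (ℤ × ℤ × ℤ × ℤ × ℤ × ℤ)
  chains = (0ℤ , 0ℤ , 0ℤ , 0ℤ , 0ℤ , 0ℤ) ∷ (1ℤ , 0ℤ , 0ℤ , 0ℤ , 0ℤ , 0ℤ) ∷ (1ℤ , 1ℤ , 0ℤ , 0ℤ , 0ℤ , 0ℤ)
         ∷ (1ℤ , 1ℤ , 1ℤ , 0ℤ , 0ℤ , 0ℤ) ∷ (1ℤ , 1ℤ , 1ℤ , 1ℤ , 0ℤ , 0ℤ) ∷ (1ℤ , 1ℤ , 1ℤ , 1ℤ , 1ℤ , 0ℤ)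
         ∷ (1ℤ , 1ℤ , 1ℤ , 1ℤ , 1ℤ , 1ℤ) ∷ []

  chain : ∀ {P₁ P₂ P₃ P₄ P₅ P₆ : Set} (d₁ : Dec P₁) (d₂ : Dec P₂) (d₃ : Dec P₃) (d₄ : Dec P₄) (d₅ : Dec P₅) (d₆ : Dec P₆) →
    (P₂ → P₁) → (P₃ → P₂) → (P₄ → P₃) → (P₅ → P₄) → (P₆ → P₅) →
    (⟦ d₁ ⟧ , ⟦ d₂ ⟧ , ⟦ d₃ ⟧ , ⟦ d₄ ⟧ , ⟦ d₅ ⟧ , ⟦ d₆ ⟧) ∈ chains
  chain (no ¬p) (yes p) _ _ _ _ f _ _ _ _ = ⊥-elim (¬p (f p))
  chain _ (no ¬p) (yes p) _ _ _ _ f _ _ _ = ⊥-elim (¬p (f p))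
  chain _ _ (no ¬p) (yes p) _ _ _ _ f _ _ = ⊥-elim (¬p (f p))
  chain _ _ _ (no ¬p) (yes p) _ _ _ _ f _ = ⊥-elim (¬p (f p))
  chain _ _ _ _ (no ¬p) (yes p) _ _ _ _ f = ⊥-elim (¬p (f p))
  chain (no _)  (no _)  (no _)  (no _)  (no _)  (no _)  _ _ _ _ _ = here refl
  chain (yes _) (no _)  (no _)  (no _)  (no _)  (no _)  _ _ _ _ _ = there (here refl)
  chain (yes _) (yes _) (no _)  (no _)  (no _)  (no _)  _ _ _ _ _ = there (there (here refl))
  chain (yes _) (yes _) (yes _) (no _)  (no _)  (no _)  _ _ _ _ _ = there (there (there (here refl)))
  chain (yes _) (yes _) (yes _) (yes _) (no _)  (no _)  _ _ _ _ _ = there (there (there (there (here refl))))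
  chain (yes _) (yes _) (yes _) (yes _) (yes _) (no _)  _ _ _ _ _ = there (there (there (there (there (here refl)))))
  chain (yes _) (yes _) (yes _) (yes _) (yes _) (yes _) _ _ _ _ _ = there (there (there (there (there (there (here refl))))))

  -- One coefficient of U V in the notation of `B-coeff`: the first summand comes from `X₀`, the
  -- second from the correction `X₀₁`, which starts QR later and carries the weight χ(j) + χ(j + Q).
  term : ℤ → ℤ → ℤ → ℤ → ℤ → ℤ → ℤ
  term s x A s₁ y B = s * (x * A) + (s + s₁) * (y * B)

  Bound : ((ℤ × ℤ × ℤ) → (ℤ × ℤ × ℤ) → (ℤ × ℤ × ℤ × ℤ × ℤ × ℤ) → ℤ) → Set
  Bound e = All (λ σ → All (λ α → All (λ x → ∣ e σ α x ∣ ℕ.≤ 1) chains) triples) triples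

  bound? : ∀ e → Dec (Bound e)
  bound? e = all? (λ σ → all? (λ α → all? (λ x → ∣ e σ α x ∣ ≤? 1) chains) triples) triples

  -- The sum of three consecutive coefficients, where (s, s₁, s₂) and (A, B, C) are values of χ along
  -- the residue classes of the two coordinates modulo 3, and x₁ ≥ … ≥ x₆ are the indicators of the
  -- thresholds that the coordinate i has passed. The three cases say when the coordinate j wraps
  -- around modulo Q.
  no-wrap wrap-first wrap-second : (ℤ × ℤ × ℤ) → (ℤ × ℤ × ℤ) → (ℤ × ℤ × ℤ × ℤ × ℤ × ℤ) → ℤ
  no-wrap (s , s₁ , s₂) (A , B , C) (x₁ , x₂ , x₃ , x₄ , x₅ , x₆) =
    term s x₁ A s₁ x₄ C + term s x₂ B s₁ x₅ A + term s x₃ C s₁ x₆ B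
  wrap-first (s , s₁ , s₂) (A , B , C) (x₁ , x₂ , x₃ , x₄ , x₅ , x₆) =
    term s x₃ A s₁ x₆ C + term s₂ x₁ C s x₄ B + term s₂ x₂ A s x₅ C
  wrap-second (s , s₁ , s₂) (A , B , C) (x₁ , x₂ , x₃ , x₄ , x₅ , x₆) =
    term s x₂ A s₁ x₅ C + term s x₃ B s₁ x₆ A + term s₂ x₁ A s x₄ C

  no-wrap-bound : Bound no-wrap
  no-wrap-bound = toWitness {a? = bound? no-wrap} tt

  wrap-first-bound : Bound wrap-first
  wrap-first-bound = toWitness {a? = bound? wrap-first} tt

  wrap-second-bound : Bound wrap-second
  wrap-second-bound = toWitness {a? = bound? wrap-second} tt

  lookup-bound : ∀ {e} → Bound e → ∀ {σ α x} → σ ∈ triples → α ∈ triples → x ∈ chains → ∣ e σ α x ∣ ℕ.≤ 1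
  lookup-bound b σ∈ α∈ x∈ = All.lookup (All.lookup (All.lookup b σ∈) α∈) x∈

  term-cong : ∀ {s s′ A A′ s₁ s₁′ B B′} x y → s ≡ s′ → A ≡ A′ → s₁ ≡ s₁′ → B ≡ B′ →
    term s x A s₁ y B ≡ term s′ x A′ s₁′ y B′
  term-cong x y refl refl refl refl = refl

  -- The coefficient at QI + Rj - 3QR, for j < Q, of
  -- (1 - x^Q)(1 - x^R)(1 - x^(3QR)) / ((1 - x^(3Q))(1 - x^(3R))(1 - x^(QR))).
  E : ℕ → ℕ → ℕ → ℕ → ℤ
  E R Q I j = term (χ j) ⟦ 3 ℕ.* R ≤? I ⟧ (χ I) (χ (j ℕ.+ Q)) ⟦ 4 ℕ.* R ≤? I ⟧ (χ (I ℕ.+ 2 ℕ.* R))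

  -- When Rt - Qv = ±1, these are three representations QI + Rj of consecutive numbers.
  record Steps (R Q v t I j : ℕ) : Set where
    constructor steps
    field
      {I₁ j₁ I₂ j₂} : ℕ
      j₁<Q  : j₁ ℕ.< Q
      j₂<Q  : j₂ ℕ.< Q
      step₁ : Q ℕ.* I₁ ℕ.+ R ℕ.* j₁ ℕ.+ Q ℕ.* v ≡ Q ℕ.* I ℕ.+ R ℕ.* j ℕ.+ R ℕ.* t
      step₂ : Q ℕ.* I₂ ℕ.+ R ℕ.* j₂ ℕ.+ Q ℕ.* v ≡ Q ℕ.* I₁ ℕ.+ R ℕ.* j₁ ℕ.+ R ℕ.* t
      bound : ∣ E R Q I j + E R Q I₁ j₁ + E R Q I₂ j₂ ∣ ℕ.≤ 1

  module _ (R Q v t i j : ℕ) (2v<R : 2 ℕ.* v ℕ.< R) (2t<Q : 2 ℕ.* t ℕ.< Q) (j<Q : j ℕ.< Q)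
    (3∤R : ¬ 3 ∣ R) (3∤Q : ¬ 3 ∣ Q) (3∣v+R : 3 ∣ v ℕ.+ R) (3∣t : 3 ∣ t) where

    private
      I = i ℕ.+ 2 ℕ.* v
      w = _∣_.quotient 3∣v+R
      t′ = _∣_.quotient 3∣t

      v+R≡ : 3 ℕ.* w ≡ v ℕ.+ R
      v+R≡ = trans (ℕ.*-comm 3 w) (sym (_∣_.equality 3∣v+R))

      t≡ : t ≡ 3 ℕ.* t′
      t≡ = trans (_∣_.equality 3∣t) (ℕ.*-comm t′ 3)

      w₁ : ∀ a b c → a ℕ.+ (v ℕ.+ R) ≡ b ℕ.+ 3 ℕ.* c → χ a ≡ χ b
      w₁ a b c eq = χ-cong a b w c (trans (cong (a ℕ.+_) v+R≡) eq)

      w₂ : ∀ a b c → a ℕ.+ 2 ℕ.* (v ℕ.+ R) ≡ b ℕ.+ 3 ℕ.* c → χ a ≡ χ b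
      w₂ a b c eq = χ-cong a b (2 ℕ.* w) c (trans (cong (a ℕ.+_) (trans (lem w) (cong (2 ℕ.*_) v+R≡))) eq)
        where
        lem : ∀ w → 3 ℕ.* (2 ℕ.* w) ≡ 2 ℕ.* (3 ℕ.* w)
        lem = ℕ-solve

      χ-t : ∀ a → χ (a ℕ.+ t) ≡ χ a
      χ-t a = trans (cong (λ t → χ (a ℕ.+ t)) t≡) (χ-+3* t′ a)

      σ : (χ j , χ (j ℕ.+ Q) , χ (j ℕ.+ 2 ℕ.* Q)) ∈ triples
      σ = χ-triple j Q 3∤Q

      α : (χ I , χ (I ℕ.+ R) , χ (I ℕ.+ 2 ℕ.* R)) ∈ triples
      α = χ-triple I R 3∤R

      -- Since v ≡ -R modulo 3, lowering the first coordinate by v acts on χ like raising it by R.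
      -- So `a₁` to `a₈` bring every value back to χ(I), χ(I + R) or χ(I + 2R).
      a₁ : χ (i ℕ.+ v) ≡ χ (I ℕ.+ R)
      a₁ = w₁ (i ℕ.+ v) (I ℕ.+ R) 0 (lem i v R)
        where
        lem : ∀ i v R → i ℕ.+ v ℕ.+ (v ℕ.+ R) ≡ i ℕ.+ 2 ℕ.* v ℕ.+ R ℕ.+ 0
        lem = ℕ-solve
      a₂ : χ (i ℕ.+ v ℕ.+ 2 ℕ.* R) ≡ χ I
      a₂ = w₁ (i ℕ.+ v ℕ.+ 2 ℕ.* R) I R (lem i v R)
        where
        lem : ∀ i v R → i ℕ.+ v ℕ.+ 2 ℕ.* R ℕ.+ (v ℕ.+ R) ≡ i ℕ.+ 2 ℕ.* v ℕ.+ 3 ℕ.* R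
        lem = ℕ-solve
      a₃ : χ i ≡ χ (I ℕ.+ 2 ℕ.* R)
      a₃ = w₂ i (I ℕ.+ 2 ℕ.* R) 0 (lem i v R)
        where
        lem : ∀ i v R → i ℕ.+ 2 ℕ.* (v ℕ.+ R) ≡ i ℕ.+ 2 ℕ.* v ℕ.+ 2 ℕ.* R ℕ.+ 0
        lem = ℕ-solve
      a₄ : χ (i ℕ.+ 2 ℕ.* R) ≡ χ (I ℕ.+ R)
      a₄ = w₂ (i ℕ.+ 2 ℕ.* R) (I ℕ.+ R) R (lem i v R)
        where
        lem : ∀ i v R → i ℕ.+ 2 ℕ.* R ℕ.+ 2 ℕ.* (v ℕ.+ R) ≡ i ℕ.+ 2 ℕ.* v ℕ.+ R ℕ.+ 3 ℕ.* R
        lem = ℕ-solve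
      a₅ : χ (i ℕ.+ v ℕ.+ R) ≡ χ (I ℕ.+ 2 ℕ.* R)
      a₅ = w₁ (i ℕ.+ v ℕ.+ R) (I ℕ.+ 2 ℕ.* R) 0 (lem i v R)
        where
        lem : ∀ i v R → i ℕ.+ v ℕ.+ R ℕ.+ (v ℕ.+ R) ≡ i ℕ.+ 2 ℕ.* v ℕ.+ 2 ℕ.* R ℕ.+ 0
        lem = ℕ-solve
      a₆ : χ (i ℕ.+ v ℕ.+ R ℕ.+ 2 ℕ.* R) ≡ χ (I ℕ.+ R)
      a₆ = w₁ (i ℕ.+ v ℕ.+ R ℕ.+ 2 ℕ.* R) (I ℕ.+ R) R (lem i v R)
        where
        lem : ∀ i v R → i ℕ.+ v ℕ.+ R ℕ.+ 2 ℕ.* R ℕ.+ (v ℕ.+ R) ≡ i ℕ.+ 2 ℕ.* v ℕ.+ R ℕ.+ 3 ℕ.* R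
        lem = ℕ-solve
      a₇ : χ (i ℕ.+ R) ≡ χ I
      a₇ = w₂ (i ℕ.+ R) I R (lem i v R)
        where
        lem : ∀ i v R → i ℕ.+ R ℕ.+ 2 ℕ.* (v ℕ.+ R) ≡ i ℕ.+ 2 ℕ.* v ℕ.+ 3 ℕ.* R
        lem = ℕ-solve
      a₈ : χ (i ℕ.+ R ℕ.+ 2 ℕ.* R) ≡ χ (I ℕ.+ 2 ℕ.* R)
      a₈ = w₂ (i ℕ.+ R ℕ.+ 2 ℕ.* R) (I ℕ.+ 2 ℕ.* R) R (lem i v R)
        where
        lem : ∀ i v R → i ℕ.+ R ℕ.+ 2 ℕ.* R ℕ.+ 2 ℕ.* (v ℕ.+ R) ≡ i ℕ.+ 2 ℕ.* v ℕ.+ 2 ℕ.* R ℕ.+ 3 ℕ.* R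
        lem = ℕ-solve

      sQ : χ (j ℕ.+ t ℕ.+ Q) ≡ χ (j ℕ.+ Q)
      sQ = trans (cong χ (lem j t Q)) (χ-t (j ℕ.+ Q))
        where
        lem : ∀ j t Q → j ℕ.+ t ℕ.+ Q ≡ j ℕ.+ Q ℕ.+ t
        lem = ℕ-solve
      -- Adding t does not change χ because 3 ∣ t, and subtracting Q is the same as adding 2Q modulo
      -- 3.
      b₁ : ∀ {j′} → Q ℕ.+ j′ ≡ j ℕ.+ t → χ j′ ≡ χ (j ℕ.+ 2 ℕ.* Q)
      b₁ {j′} eq = χ-cong j′ (j ℕ.+ 2 ℕ.* Q) Q t′ (trans (lem₁ j′ Q) (trans (cong (ℕ._+ 2 ℕ.* Q) eq)
        (trans (cong (λ t → j ℕ.+ t ℕ.+ 2 ℕ.* Q) t≡) (lem₂ j Q t′))))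
        where
        lem₁ : ∀ j Q → j ℕ.+ 3 ℕ.* Q ≡ (Q ℕ.+ j) ℕ.+ 2 ℕ.* Q
        lem₁ = ℕ-solve
        lem₂ : ∀ j Q t → j ℕ.+ 3 ℕ.* t ℕ.+ 2 ℕ.* Q ≡ j ℕ.+ 2 ℕ.* Q ℕ.+ 3 ℕ.* t
        lem₂ = ℕ-solve
      b₂ : ∀ {j′} → Q ℕ.+ j′ ≡ j ℕ.+ t → χ (j′ ℕ.+ Q) ≡ χ j
      b₂ {j′} eq = trans (cong χ (trans (ℕ.+-comm j′ Q) eq)) (χ-t j)

      drop : ∀ a b c {K} → a ≡ b ℕ.+ c → K ℕ.≤ b → K ℕ.≤ a
      drop a b c eq h = ℕ.≤-trans h (ℕ.≤-trans (ℕ.m≤m+n b c) (ℕ.≤-reflexive (sym eq)))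

      dropR : ∀ a b c → a ≡ b ℕ.+ c → 4 ℕ.* R ℕ.≤ b ℕ.+ R → 3 ℕ.* R ℕ.≤ a
      dropR a b c eq h = drop a b c eq (ℕ.+-cancelʳ-≤ R (3 ℕ.* R) b (ℕ.≤-trans (ℕ.≤-reflexive (ℕ.+-comm (3 ℕ.* R) R)) h))

      widen : ∀ {a} → 4 ℕ.* R ℕ.≤ i ℕ.+ a → a ℕ.≤ R → 3 ℕ.* R ℕ.≤ i
      widen h a≤R = dropR i i 0 (sym (ℕ.+-identityʳ i)) (ℕ.≤-trans h (ℕ.+-monoʳ-≤ i a≤R))

      e₁ : i ℕ.+ 2 ℕ.* v ≡ i ℕ.+ v ℕ.+ v
      e₁ = lem i v
        where
        lem : ∀ i v → i ℕ.+ 2 ℕ.* v ≡ i ℕ.+ v ℕ.+ v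
        lem = ℕ-solve
      e₂ : i ℕ.+ v ℕ.+ R ≡ i ℕ.+ R ℕ.+ v
      e₂ = lem i v R
        where
        lem : ∀ i v R → i ℕ.+ v ℕ.+ R ≡ i ℕ.+ R ℕ.+ v
        lem = ℕ-solve
      up : ∀ {K} → K ℕ.≤ i ℕ.+ 2 ℕ.* v → K ℕ.≤ i ℕ.+ R
      up h = ℕ.≤-trans h (ℕ.+-monoʳ-≤ i (ℕ.<⇒≤ 2v<R))

      2t≡ : j ℕ.+ 2 ℕ.* t ≡ j ℕ.+ t ℕ.+ t
      2t≡ = lem j t
        where
        lem : ∀ j t → j ℕ.+ 2 ℕ.* t ≡ j ℕ.+ t ℕ.+ t
        lem = ℕ-solve

      straight : ∀ Q R i v j t → Q ℕ.* i ℕ.+ R ℕ.* (j ℕ.+ t) ℕ.+ Q ℕ.* v ≡ Q ℕ.* (i ℕ.+ v) ℕ.+ R ℕ.* j ℕ.+ R ℕ.* t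
      straight = ℕ-solve

      wrapped : ∀ Q R i v j j′ t → Q ℕ.+ j′ ≡ j ℕ.+ t →
        Q ℕ.* (i ℕ.+ R) ℕ.+ R ℕ.* j′ ℕ.+ Q ℕ.* v ≡ Q ℕ.* (i ℕ.+ v) ℕ.+ R ℕ.* j ℕ.+ R ℕ.* t
      wrapped Q R i v j j′ t eq = trans (lem₁ Q R i v j′) (trans (cong (λ z → Q ℕ.* (i ℕ.+ v) ℕ.+ R ℕ.* z) eq) (lem₂ Q R i v j t))
        where
        lem₁ : ∀ Q R i v j → Q ℕ.* (i ℕ.+ R) ℕ.+ R ℕ.* j ℕ.+ Q ℕ.* v ≡ Q ℕ.* (i ℕ.+ v) ℕ.+ R ℕ.* (Q ℕ.+ j)
        lem₁ = ℕ-solve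
        lem₂ : ∀ Q R i v j t → Q ℕ.* (i ℕ.+ v) ℕ.+ R ℕ.* (j ℕ.+ t) ≡ Q ℕ.* (i ℕ.+ v) ℕ.+ R ℕ.* j ℕ.+ R ℕ.* t
        lem₂ = ℕ-solve

      reassoc : ∀ a → Q ℕ.* (i ℕ.+ v ℕ.+ v) ℕ.+ a ≡ Q ℕ.* I ℕ.+ a
      reassoc a = cong (λ z → Q ℕ.* z ℕ.+ a) (sym e₁)

    -- When j passes Q it drops by Q and the first coordinate gains R, which keeps QI + Rj on
    -- course. In each case the three first coordinates lie within R of each other, so passing 4R
    -- with the largest implies passing 3R with the smallest. Listed in decreasing order, their six
    -- indicators hence form one of the `chains`; the order is I, I - v, I - 2v only if nothing
    -- wraps.
    flat-steps : Steps R Q v t (i ℕ.+ 2 ℕ.* v) j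
    flat-steps with j ℕ.+ t <? Q | j ℕ.+ t ℕ.+ t <? Q
    ... | yes h₁ | yes h₂ = steps {I₁ = i ℕ.+ v} {j ℕ.+ t} {i} {j ℕ.+ t ℕ.+ t} h₁ h₂
      (trans (straight Q R (i ℕ.+ v) v j t) (cong (ℕ._+ R ℕ.* t) (reassoc (R ℕ.* j))))
      (straight Q R i v (j ℕ.+ t) t)
      (subst (λ w → ∣ w ∣ ℕ.≤ 1)
        (cong₂ _+_ (cong₂ _+_ (refl {x = E R Q I j})
            (term-cong ⟦ 3 ℕ.* R ≤? i ℕ.+ v ⟧ ⟦ 4 ℕ.* R ≤? i ℕ.+ v ⟧ (sym (χ-t j)) (sym a₁) (sym sQ) (sym a₂)))
          (term-cong ⟦ 3 ℕ.* R ≤? i ⟧ ⟦ 4 ℕ.* R ≤? i ⟧ (sym (trans (χ-t (j ℕ.+ t)) (χ-t j))) (sym a₃)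
            (sym (trans (cong χ (lem j t Q)) (trans (χ-t (j ℕ.+ t ℕ.+ Q)) sQ))) (sym a₄)))
        (lookup-bound {no-wrap} no-wrap-bound σ α
          (chain (3 ℕ.* R ≤? i ℕ.+ 2 ℕ.* v) (3 ℕ.* R ≤? i ℕ.+ v) (3 ℕ.* R ≤? i)
                 (4 ℕ.* R ≤? i ℕ.+ 2 ℕ.* v) (4 ℕ.* R ≤? i ℕ.+ v) (4 ℕ.* R ≤? i)
            (drop _ _ v e₁) (drop _ _ v refl) (λ h → widen h (ℕ.<⇒≤ 2v<R)) (drop _ _ v e₁) (drop _ _ v refl))))
      where
      lem : ∀ j t Q → j ℕ.+ t ℕ.+ t ℕ.+ Q ≡ j ℕ.+ t ℕ.+ Q ℕ.+ t
      lem = ℕ-solve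
    ... | yes h₁ | no h₂ = steps {I₁ = i ℕ.+ v} {j ℕ.+ t} {i ℕ.+ R} {j′} h₁
      (ℕ.+-cancelˡ-< Q j′ Q (subst (ℕ._< Q ℕ.+ Q) (sym eq) (ℕ.+-mono-<-≤ h₁ (ℕ.≤-trans (ℕ.m≤m+n t (t ℕ.+ 0)) (ℕ.<⇒≤ 2t<Q)))))
      (trans (straight Q R (i ℕ.+ v) v j t) (cong (ℕ._+ R ℕ.* t) (reassoc (R ℕ.* j))))
      (wrapped Q R i v (j ℕ.+ t) j′ t eq)
      (subst (λ w → ∣ w ∣ ℕ.≤ 1)
        (cong₂ _+_ (cong₂ _+_ (refl {x = E R Q I j})
            (term-cong ⟦ 3 ℕ.* R ≤? i ℕ.+ v ⟧ ⟦ 4 ℕ.* R ≤? i ℕ.+ v ⟧ (sym (χ-t j)) (sym a₁) (sym sQ) (sym a₂)))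
          (term-cong ⟦ 3 ℕ.* R ≤? i ℕ.+ R ⟧ ⟦ 4 ℕ.* R ≤? i ℕ.+ R ⟧ (sym c₁) (sym a₇) (sym c₂) (sym a₈)))
        (lookup-bound {wrap-second} wrap-second-bound σ α
          (chain (3 ℕ.* R ≤? i ℕ.+ R) (3 ℕ.* R ≤? i ℕ.+ 2 ℕ.* v) (3 ℕ.* R ≤? i ℕ.+ v)
                 (4 ℕ.* R ≤? i ℕ.+ R) (4 ℕ.* R ≤? i ℕ.+ 2 ℕ.* v) (4 ℕ.* R ≤? i ℕ.+ v)
            up (drop _ _ v e₁) (dropR _ _ v refl) up (drop _ _ v e₁))))
      where
      j′ = j ℕ.+ t ℕ.+ t ∸ Q
      eq : Q ℕ.+ j′ ≡ j ℕ.+ t ℕ.+ t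
      eq = ℕ.m+[n∸m]≡n (ℕ.≮⇒≥ h₂)
      c₁ : χ j′ ≡ χ (j ℕ.+ 2 ℕ.* Q)
      c₁ = χ-cong j′ (j ℕ.+ 2 ℕ.* Q) Q (2 ℕ.* t′) (trans (lem₁ j′ Q) (trans (cong (ℕ._+ 2 ℕ.* Q) eq)
        (trans (cong (λ t → j ℕ.+ t ℕ.+ t ℕ.+ 2 ℕ.* Q) t≡) (lem₂ j Q t′))))
        where
        lem₁ : ∀ j Q → j ℕ.+ 3 ℕ.* Q ≡ (Q ℕ.+ j) ℕ.+ 2 ℕ.* Q
        lem₁ = ℕ-solve
        lem₂ : ∀ j Q t → j ℕ.+ 3 ℕ.* t ℕ.+ 3 ℕ.* t ℕ.+ 2 ℕ.* Q ≡ j ℕ.+ 2 ℕ.* Q ℕ.+ 3 ℕ.* (2 ℕ.* t)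
        lem₂ = ℕ-solve
      c₂ : χ (j′ ℕ.+ Q) ≡ χ j
      c₂ = trans (cong χ (trans (ℕ.+-comm j′ Q) eq)) (trans (χ-t (j ℕ.+ t)) (χ-t j))
    ... | no h₁ | _ = steps {I₁ = i ℕ.+ v ℕ.+ R} {j′} {i ℕ.+ R} {j′ ℕ.+ t}
      (ℕ.≤-<-trans (ℕ.m≤m+n j′ t) j′+t<Q) j′+t<Q
      (trans (wrapped Q R (i ℕ.+ v) v j j′ t eq) (cong (ℕ._+ R ℕ.* t) (reassoc (R ℕ.* j))))
      (trans (straight Q R (i ℕ.+ R) v j′ t) (cong (λ z → Q ℕ.* z ℕ.+ R ℕ.* j′ ℕ.+ R ℕ.* t) (sym e₂)))
      (subst (λ w → ∣ w ∣ ℕ.≤ 1)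
        (cong₂ _+_ (cong₂ _+_ (refl {x = E R Q I j})
            (term-cong ⟦ 3 ℕ.* R ≤? i ℕ.+ v ℕ.+ R ⟧ ⟦ 4 ℕ.* R ≤? i ℕ.+ v ℕ.+ R ⟧ (sym (b₁ eq)) (sym a₅) (sym (b₂ eq)) (sym a₆)))
          (term-cong ⟦ 3 ℕ.* R ≤? i ℕ.+ R ⟧ ⟦ 4 ℕ.* R ≤? i ℕ.+ R ⟧ (sym (trans (χ-t j′) (b₁ eq))) (sym a₇)
            (sym (trans (cong χ (lem j′ t Q)) (trans (χ-t (j′ ℕ.+ Q)) (b₂ eq)))) (sym a₈)))
        (lookup-bound {wrap-first} wrap-first-bound σ α
          (chain (3 ℕ.* R ≤? i ℕ.+ v ℕ.+ R) (3 ℕ.* R ≤? i ℕ.+ R) (3 ℕ.* R ≤? i ℕ.+ 2 ℕ.* v)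
                 (4 ℕ.* R ≤? i ℕ.+ v ℕ.+ R) (4 ℕ.* R ≤? i ℕ.+ R) (4 ℕ.* R ≤? i ℕ.+ 2 ℕ.* v)
            (drop _ _ v e₂) up (dropR _ _ v e₁) (drop _ _ v e₂) up)))
      where
      j′ = j ℕ.+ t ∸ Q
      eq : Q ℕ.+ j′ ≡ j ℕ.+ t
      eq = ℕ.m+[n∸m]≡n (ℕ.≮⇒≥ h₁)
      -- From j < Q and 2t < Q follows j + 2t < 2Q, so a wrap in the first step excludes one in the
      -- second.
      j′+t<Q : j′ ℕ.+ t ℕ.< Q
      j′+t<Q = ℕ.+-cancelˡ-< Q (j′ ℕ.+ t) Q (subst (ℕ._< Q ℕ.+ Q)
        (trans 2t≡ (trans (cong (ℕ._+ t) (sym eq)) (ℕ.+-assoc Q j′ t))) (ℕ.+-mono-< j<Q 2t<Q))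
      lem : ∀ j t Q → j ℕ.+ t ℕ.+ Q ≡ j ℕ.+ Q ℕ.+ t
      lem = ℕ-solve

-- The coefficients of Φ_3QR / (1 + x + x²).

module TernaryCoefficients where

  open import Data.Nat using (_≤?_)
  open import Data.Nat.Divisibility
  open import Data.Nat.Coprimality using (Coprime)
  open import Data.Integer as ℤ using (ℤ; _+_; _-_; _*_; -_; 0ℤ; 1ℤ; ∣_∣)
  open import Data.Integer.Properties hiding (_≤?_)
  open import Data.List.Relation.Unary.All as All using (All; all?)
  open import Data.Unit using (tt)
  open import Relation.Nullary.Decidable using (toWitness)
  open Sums
  open Series
  open CyclotomicLists using (shift-⊕; shift-·)
  open SmallCyclotomics using (semigroup; repunit)
  open Flatness

  χ-sum : ∀ a Q → ¬ 3 ∣ Q → χ a + χ (a ℕ.+ Q) + χ (a ℕ.+ 2 ℕ.* Q) ≡ 0ℤ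
  χ-sum a Q 3∤Q = All.lookup zeros (χ-triple a Q 3∤Q)
    where
    zeros : All (λ σ → proj₁ σ + proj₁ (proj₂ σ) + proj₂ (proj₂ σ) ≡ 0ℤ) triples
    zeros = toWitness {a? = all? (λ σ → (proj₁ σ + proj₁ (proj₂ σ) + proj₂ (proj₂ σ)) ≟ 0ℤ) triples} tt

  shift-cong : ∀ k {f g} → f ≈ g → shift k f ≈ shift k g
  shift-cong zero    eq n       = eq n
  shift-cong (suc k) eq zero    = refl
  shift-cong (suc k) eq (suc n) = shift-cong k eq n

  shift-∑ˢ : ∀ k N f → shift k (∑ˢ N f) ≈ ∑ˢ N (λ j → shift k (f j))
  shift-∑ˢ zero    N f n       = refl
  shift-∑ˢ (suc k) N f zero    = sym (∑-zero N (λ _ _ → refl))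
  shift-∑ˢ (suc k) N f (suc n) = shift-∑ˢ k N f n

  shift-weighted : ∀ k N (c : ℕ → ℤ) (f : ℕ → Ser) n → shift k (∑ˢ N (λ j → c j · f j)) n ≡ ∑ N (λ j → c j * shift k (f j) n)
  shift-weighted k N c f n = trans (shift-∑ˢ k N (λ j → c j · f j) n) (∑-cong N (λ j _ → shift-· k (c j) (f j) n))

  -- U = (1 - x^Q)/(1 - x^(3Q)), and below V = (1 - x^R)(1 - x^(3QR))/((1 - x^(3R))(1 - x^(QR))),
  -- so that Φ_3QR = (1 + x + x²) U V.
  U : ℕ → Ser
  U Q = z Q ⊛ G (Q ℕ.* 3)

  U-expand : ∀ Q k → U Q k ≡ G (Q ℕ.* 3) k - shift Q (G (Q ℕ.* 3)) k
  U-expand Q = z-⊛ Q (G (Q ℕ.* 3))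

  U-* : ∀ Q .{{_ : NonZero Q}} i → U Q (Q ℕ.* i) ≡ χ i
  U-* Q zero = trans (cong (U Q) (ℕ.*-zeroʳ Q)) (trans (U-expand Q 0)
    (cong₂ _-_ (⟦⟧-yes (Q ℕ.* 3 ∣? 0) ((Q ℕ.* 3) ∣0)) (shift-< Q (G (Q ℕ.* 3)) (ℕ.>-nonZero⁻¹ Q))))
  U-* Q (suc i) = trans (U-expand Q (Q ℕ.* suc i)) (trans (cong₂ _-_ (reduce (suc i))
    (trans (cong (shift Q (G (Q ℕ.* 3))) (ℕ.*-suc Q i)) (trans (shift-+ Q (G (Q ℕ.* 3)) (Q ℕ.* i)) (reduce i)))) (sym (χ-suc i)))
    where
    reduce : ∀ i → ⟦ Q ℕ.* 3 ∣? Q ℕ.* i ⟧ ≡ ⟦ 3 ∣? i ⟧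
    reduce i = ⟦⟧-cong (Q ℕ.* 3 ∣? Q ℕ.* i) (3 ∣? i) (*-cancelˡ-∣ Q) (*-monoʳ-∣ Q)

  U-∤ : ∀ Q k → ¬ Q ∣ k → U Q k ≡ 0ℤ
  U-∤ Q k Q∤k = trans (U-expand Q k) (cong₂ _-_ (G-∤ k Q∤k) (below (ℕ.≤-<-connex Q k)))
    where
    G-∤ : ∀ k → ¬ Q ∣ k → G (Q ℕ.* 3) k ≡ 0ℤ
    G-∤ k Q∤k = ⟦⟧-no (Q ℕ.* 3 ∣? k) (λ d → Q∤k (∣-trans (m∣m*n 3) d))
    below : Q ℕ.≤ k ⊎ k ℕ.< Q → shift Q (G (Q ℕ.* 3)) k ≡ 0ℤ
    below (inj₂ k<Q) = shift-< Q (G (Q ℕ.* 3)) k<Q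
    below (inj₁ Q≤k) = trans (cong (shift Q (G (Q ℕ.* 3))) (sym (ℕ.m+[n∸m]≡n Q≤k)))
      (trans (shift-+ Q (G (Q ℕ.* 3)) (k ∸ Q)) (G-∤ (k ∸ Q) (λ d → Q∤k (subst (Q ∣_) (ℕ.m+[n∸m]≡n Q≤k) (∣m∣n⇒∣m+n ∣-refl d)))))

  U-z : ∀ Q .{{_ : NonZero Q}} → U Q ⊛ z (Q ℕ.* 3) ≈ z Q
  U-z Q = ≈-trans (⊛-assoc (z Q) (G (Q ℕ.* 3)) (z (Q ℕ.* 3)))
    (≈-trans (⊛-cong (≈-refl {z Q}) (≈-trans (⊛-comm (G (Q ℕ.* 3)) (z (Q ℕ.* 3))) (z-⊛-G (Q ℕ.* 3) {{ℕ.m*n≢0 Q 3}})))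
      (≈-trans (⊛-comm (z Q) 𝟙) (𝟙-⊛ (z Q))))

  module _ (Q R : ℕ) where

    X₀ X₀₁ V : Ser
    X₀  = ∑ˢ Q (λ j → χ j · X (R ℕ.* j))
    X₀₁ = ∑ˢ Q (λ j → (χ j + χ (j ℕ.+ Q)) · X (R ℕ.* j))
    V   = X₀ ⊕ shift (R ℕ.* Q) X₀₁

    private
      X₁ X₂ : Ser
      X₁ = ∑ˢ Q (λ j → χ (j ℕ.+ Q) · X (R ℕ.* j))
      X₂ = ∑ˢ Q (λ j → χ (j ℕ.+ 2 ℕ.* Q) · X (R ℕ.* j))

      T : ℕ → Ser
      T N = ∑ˢ N (λ j → χ j · X (R ℕ.* j))

      k = R ℕ.* Q

    X₀₁-split : X₀₁ ≈ X₀ ⊕ X₁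
    X₀₁-split n = trans (∑-cong Q (λ j _ → *-distribʳ-+ (X (R ℕ.* j) n) (χ j) (χ (j ℕ.+ Q)))) (∑-+ Q (λ j → χ j * X (R ℕ.* j) n) (λ j → χ (j ℕ.+ Q) * X (R ℕ.* j) n))

    X₀₁-neg : ¬ 3 ∣ Q → X₀₁ ≈ ⊖ X₂
    X₀₁-neg 3∤Q n = trans (∑-cong Q (λ j _ → trans (cong (_* X (R ℕ.* j) n) (negate (χ j + χ (j ℕ.+ Q)) (χ (j ℕ.+ 2 ℕ.* Q)) (χ-sum j Q 3∤Q)))
        (lem (χ (j ℕ.+ 2 ℕ.* Q)) (X (R ℕ.* j) n))))
      (trans (∑-*ˡ Q (- 1ℤ) (λ j → χ (j ℕ.+ 2 ℕ.* Q) * X (R ℕ.* j) n)) (-1*i≡-i (X₂ n)))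
      where
      negate : ∀ a b → a + b ≡ 0ℤ → a ≡ - b
      negate a b eq = trans (lem′ a b) (trans (cong (_- b) eq) (+-identityˡ (- b)))
        where
        lem′ : ∀ a b → a ≡ a + b - b
        lem′ = ℤ-solve
      lem : ∀ c x → - c * x ≡ - 1ℤ * (c * x)
      lem = ℤ-solve

    T-split : T (3 ℕ.* Q) ≈ X₀ ⊕ (shift k X₁ ⊕ shift k (shift k X₂))
    T-split n = trans (∑-split Q (Q ℕ.+ (Q ℕ.+ 0)) _) (cong (λ w → X₀ n + w)
      (trans (∑-split Q (Q ℕ.+ 0) _) (cong₂ _+_ first (trans (∑-split Q 0 _) (trans (+-identityʳ _) second)))))
      where
      X-move : ∀ d j → X (R ℕ.* (d ℕ.+ j)) n ≡ shift (R ℕ.* d) (X (R ℕ.* j)) n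
      X-move d j = trans (cong (λ m → X m n) (ℕ.*-distribˡ-+ R d j)) (sym (shift-shift (R ℕ.* d) (R ℕ.* j) 𝟙 n))
      first : ∑ Q (λ j → χ (Q ℕ.+ j) * X (R ℕ.* (Q ℕ.+ j)) n) ≡ shift k X₁ n
      first = trans (∑-cong Q (λ j _ → cong₂ _*_ (cong χ (ℕ.+-comm Q j)) (X-move Q j))) (sym (shift-weighted k Q (λ j → χ (j ℕ.+ Q)) (λ j → X (R ℕ.* j)) n))
      second : ∑ Q (λ j → χ (Q ℕ.+ (Q ℕ.+ j)) * X (R ℕ.* (Q ℕ.+ (Q ℕ.+ j))) n) ≡ shift k (shift k X₂) n
      second = trans (∑-cong Q (λ j _ → cong₂ _*_ (cong χ (lem Q j))
          (trans (X-move Q (Q ℕ.+ j)) (shift-cong k (λ m → trans (cong (λ w → X w m) (ℕ.*-distribˡ-+ R Q j)) (sym (shift-shift k (R ℕ.* j) 𝟙 m))) n))))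
        (sym (trans (shift-cong k (λ m → shift-weighted k Q w₂ (λ j → X (R ℕ.* j)) m) n)
          (shift-weighted k Q w₂ (λ j → shift k (X (R ℕ.* j))) n)))
        where
        w₂ : ℕ → ℤ
        w₂ j = χ (j ℕ.+ 2 ℕ.* Q)
        lem : ∀ Q j → Q ℕ.+ (Q ℕ.+ j) ≡ j ℕ.+ 2 ℕ.* Q
        lem = ℕ-solve

    -- With y = x^(QR) the right side is X₀ + y X₁ + y² X₂, and `χ-sum` gives X₀ + X₁ + X₂ = 0. It
    -- is thus divisible by 1 - y with quotient X₀ + y (X₀ + X₁), which is `V`.
    z-⊛-V : ¬ 3 ∣ Q → z k ⊛ V ≈ T (3 ℕ.* Q)
    z-⊛-V 3∤Q n = begin
      (z k ⊛ V) n                                               ≡⟨ z-⊛ k V n ⟩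
      V n - shift k V n                                         ≡⟨ cong (λ w → V n - w) (shift-⊕ k X₀ (shift k X₀₁) n) ⟩
      X₀ n + shift k X₀₁ n - (shift k X₀ n + shift k (shift k X₀₁) n)
        ≡⟨ cong₂ (λ v w → X₀ n + v - (shift k X₀ n + w))
            (trans (shift-cong k X₀₁-split n) (shift-⊕ k X₀ X₁ n))
            (trans (shift-cong k (shift-cong k (X₀₁-neg 3∤Q)) n) (trans (shift-cong k (shift-⊖ k X₂) n) (shift-⊖ k (shift k X₂) n))) ⟩
      X₀ n + (shift k X₀ n + shift k X₁ n) - (shift k X₀ n + - shift k (shift k X₂) n)
        ≡⟨ lem (X₀ n) (shift k X₀ n) (shift k X₁ n) (shift k (shift k X₂) n) ⟩
      X₀ n + (shift k X₁ n + shift k (shift k X₂) n)            ≡⟨ sym (T-split n) ⟩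
      T (3 ℕ.* Q) n                                             ∎
      where
      open ≡-Reasoning
      lem : ∀ a b c d → a + (b + c) - (b + - d) ≡ a + (c + d)
      lem = ℤ-solve
      shift-⊖ : ∀ k f → shift k (⊖ f) ≈ ⊖ shift k f
      shift-⊖ zero    f n       = refl
      shift-⊖ (suc k) f zero    = refl
      shift-⊖ (suc k) f (suc n) = shift-⊖ k f n

    -- The weights repeat 1, -1, 0, so each group of three terms is x^(3Ri) (1 - x^R).
    T-geometric : ∀ N → T (3 ℕ.* N) ≈ z R ⊛ ∑ˢ N (λ i → X (R ℕ.* 3 ℕ.* i))
    T-geometric zero    n = sym (trans (⊛-comm (z R) 𝟘 n) (𝟘-⊛ (z R) n))
    T-geometric (suc N) n = begin
      T (3 ℕ.* suc N) n
        ≡⟨ cong (λ m → T m n) (ℕ.*-suc 3 N) ⟩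
      T (3 ℕ.* N) n + χ (3 ℕ.* N) * X (R ℕ.* (3 ℕ.* N)) n + χ (1 ℕ.+ 3 ℕ.* N) * X (R ℕ.* suc (3 ℕ.* N)) n
        + χ (2 ℕ.+ 3 ℕ.* N) * X (R ℕ.* suc (suc (3 ℕ.* N))) n
        ≡⟨ cong₂ _+_ (cong₂ _+_ (cong₂ (λ a b → a + b * X (R ℕ.* (3 ℕ.* N)) n) (T-geometric N n) (χ-+3* N 0))
             (cong (_* X (R ℕ.* suc (3 ℕ.* N)) n) (χ-+3* N 1))) (cong (_* X (R ℕ.* suc (suc (3 ℕ.* N))) n) (χ-+3* N 2)) ⟩
      (z R ⊛ Y) n + 1ℤ * X (R ℕ.* (3 ℕ.* N)) n + - 1ℤ * X (R ℕ.* suc (3 ℕ.* N)) n + 0ℤ * X (R ℕ.* suc (suc (3 ℕ.* N))) n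
        ≡⟨ lem ((z R ⊛ Y) n) (X (R ℕ.* (3 ℕ.* N)) n) (X (R ℕ.* suc (3 ℕ.* N)) n) (X (R ℕ.* suc (suc (3 ℕ.* N))) n) ⟩
      (z R ⊛ Y) n + (X (R ℕ.* (3 ℕ.* N)) n - X (R ℕ.* suc (3 ℕ.* N)) n)
        ≡⟨ cong₂ (λ a b → (z R ⊛ Y) n + (X a n - b)) (sym (ℕ.*-assoc R 3 N))
             (trans (cong (λ m → X m n) (trans (ℕ.*-suc R (3 ℕ.* N)) (cong (R ℕ.+_) (sym (ℕ.*-assoc R 3 N))))) (sym (shift-shift R (R ℕ.* 3 ℕ.* N) 𝟙 n))) ⟩
      (z R ⊛ Y) n + (X (R ℕ.* 3 ℕ.* N) n - shift R (X (R ℕ.* 3 ℕ.* N)) n)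
        ≡⟨ cong (λ w → (z R ⊛ Y) n + w) (sym (z-⊛ R (X (R ℕ.* 3 ℕ.* N)) n)) ⟩
      (z R ⊛ Y) n + (z R ⊛ X (R ℕ.* 3 ℕ.* N)) n
        ≡⟨ sym (⊛-distribˡ (z R) Y (X (R ℕ.* 3 ℕ.* N)) n) ⟩
      (z R ⊛ (Y ⊕ X (R ℕ.* 3 ℕ.* N))) n ∎
      where
      open ≡-Reasoning
      Y = ∑ˢ N (λ i → X (R ℕ.* 3 ℕ.* i))
      lem : ∀ a b c d → a + 1ℤ * b + - 1ℤ * c + 0ℤ * d ≡ a + (b - c)
      lem = ℤ-solve

    V-z : ¬ 3 ∣ Q → (z k ⊛ V) ⊛ z (R ℕ.* 3) ≈ z R ⊛ z (R ℕ.* 3 ℕ.* Q)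
    V-z 3∤Q = ≈-trans (⊛-cong (≈-trans (z-⊛-V 3∤Q) (T-geometric Q)) (≈-refl {z (R ℕ.* 3)}))
      (≈-trans (⊛-assoc (z R) S (z (R ℕ.* 3))) (⊛-cong (≈-refl {z R})
        (≈-trans (⊛-comm S (z (R ℕ.* 3))) (geometric (R ℕ.* 3) Q))))
      where
      S = ∑ˢ Q (λ i → X (R ℕ.* 3 ℕ.* i))

    B : Ser
    B = U Q ⊛ V

    B-coeff : ∀ n → B n ≡ ∑ Q (λ j → χ j * shift (R ℕ.* j) (U Q) n)
      + shift k (∑ˢ Q (λ j → (χ j + χ (j ℕ.+ Q)) · shift (R ℕ.* j) (U Q))) n
    B-coeff n = trans (⊛-comm (U Q) V n) (trans (⊛-distribʳ (U Q) X₀ (shift k X₀₁) n) (cong₂ _+_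
        (weighted χ n)
        (trans (⊛-cong {g = U Q} (λ m → sym (X-⊛ k X₀₁ m)) (λ _ → refl) n)
          (trans (⊛-assoc (X k) X₀₁ (U Q) n) (trans (X-⊛ k (X₀₁ ⊛ U Q) n) (shift-cong k (weighted (λ j → χ j + χ (j ℕ.+ Q))) n))))))
      where
      weighted : ∀ (c : ℕ → ℤ) → ∑ˢ Q (λ j → c j · X (R ℕ.* j)) ⊛ U Q ≈ ∑ˢ Q (λ j → c j · shift (R ℕ.* j) (U Q))
      weighted c m = trans (∑ˢ-⊛ Q (λ j → c j · X (R ℕ.* j)) (U Q) m) (∑-cong Q (λ j _ →
        trans (·-⊛ (c j) (X (R ℕ.* j)) (U Q) m) (cong (c j *_) (X-⊛ (R ℕ.* j) (U Q) m))))

    module _ .{{_ : NonZero Q}} (R⊥Q : Coprime R Q) where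

      -- The value wanted is χ(I - c). To avoid truncated subtraction it is given as `χ (x I)`,
      -- where `x I` agrees with I - c modulo 3.
      shifted-U : ∀ c I j → (x : ℕ → ℕ) → (∀ d → I ≡ c ℕ.+ d → χ d ≡ χ (x I)) →
        shift (c ℕ.* Q ℕ.+ R ℕ.* j) (U Q) (Q ℕ.* I ℕ.+ R ℕ.* j) ≡ ⟦ c ≤? I ⟧ * χ (x I)
      shifted-U c I j x class = by (ℕ.≤-<-connex c I)
        where
        lem : ∀ Q c d e → Q ℕ.* (c ℕ.+ d) ℕ.+ e ≡ c ℕ.* Q ℕ.+ e ℕ.+ Q ℕ.* d
        lem = ℕ-solve
        by : c ℕ.≤ I ⊎ I ℕ.< c → shift (c ℕ.* Q ℕ.+ R ℕ.* j) (U Q) (Q ℕ.* I ℕ.+ R ℕ.* j) ≡ ⟦ c ≤? I ⟧ * χ (x I)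
        by (inj₁ c≤I) = trans (cong (shift (c ℕ.* Q ℕ.+ R ℕ.* j) (U Q))
              (trans (cong (λ I → Q ℕ.* I ℕ.+ R ℕ.* j) (sym (ℕ.m+[n∸m]≡n c≤I))) (lem Q c (I ∸ c) (R ℕ.* j))))
            (trans (shift-+ (c ℕ.* Q ℕ.+ R ℕ.* j) (U Q) (Q ℕ.* (I ∸ c)))
              (trans (U-* Q (I ∸ c)) (trans (class (I ∸ c) (sym (ℕ.m+[n∸m]≡n c≤I)))
                (trans (sym (*-identityˡ (χ (x I)))) (cong (_* χ (x I)) (sym (⟦⟧-yes (c ≤? I) c≤I)))))))
        by (inj₂ I<c) = trans (shift-< (c ℕ.* Q ℕ.+ R ℕ.* j) (U Q) (ℕ.+-monoˡ-< (R ℕ.* j)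
            (subst (Q ℕ.* I ℕ.<_) (ℕ.*-comm Q c) (ℕ.*-monoʳ-< Q I<c))))
          (sym (trans (cong (_* χ (x I)) (⟦⟧-no (c ≤? I) (ℕ.<⇒≱ I<c))) (*-zeroˡ (χ (x I)))))

      shifted-U-≢ : ∀ c I j j′ → j ℕ.< Q → j′ ℕ.< Q → j′ ≢ j →
        shift (c ℕ.* Q ℕ.+ R ℕ.* j′) (U Q) (Q ℕ.* I ℕ.+ R ℕ.* j) ≡ 0ℤ
      shifted-U-≢ c I j j′ j<Q j′<Q j′≢j = by (ℕ.≤-<-connex a (Q ℕ.* I ℕ.+ R ℕ.* j))
        where
        a = c ℕ.* Q ℕ.+ R ℕ.* j′
        by : a ℕ.≤ Q ℕ.* I ℕ.+ R ℕ.* j ⊎ Q ℕ.* I ℕ.+ R ℕ.* j ℕ.< a → shift a (U Q) (Q ℕ.* I ℕ.+ R ℕ.* j) ≡ 0ℤ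
        by (inj₂ lt) = shift-< a (U Q) lt
        by (inj₁ le) = trans (cong (shift a (U Q)) (sym (ℕ.m+[n∸m]≡n le))) (trans (shift-+ a (U Q) d)
            (U-∤ Q d (λ Q∣d → j′≢j (congruence-unique {c = ℕ.pred Q ℕ.* R ℕ.* j} R⊥Q j′<Q j<Q (left Q∣d) right))))
          where
          d = Q ℕ.* I ℕ.+ R ℕ.* j ∸ a
          lem₁ : ∀ R j q → (1 ℕ.+ q) ℕ.* (R ℕ.* j) ≡ R ℕ.* j ℕ.+ q ℕ.* R ℕ.* j
          lem₁ = ℕ-solve
          right : Q ∣ R ℕ.* j ℕ.+ ℕ.pred Q ℕ.* R ℕ.* j
          right = subst (Q ∣_) (trans (cong (ℕ._* (R ℕ.* j)) (sym (ℕ.suc-pred Q))) (lem₁ R j (ℕ.pred Q))) (m∣m*n (R ℕ.* j))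
          lem₂ : ∀ c Q Rj′ d e → Q ℕ.* c ℕ.+ d ℕ.+ (Rj′ ℕ.+ e) ≡ c ℕ.* Q ℕ.+ Rj′ ℕ.+ d ℕ.+ e
          lem₂ = ℕ-solve
          left : Q ∣ d → Q ∣ R ℕ.* j′ ℕ.+ ℕ.pred Q ℕ.* R ℕ.* j
          left Q∣d = ∣m+n∣m⇒∣n {m = Q ℕ.* c ℕ.+ d} (subst (Q ∣_) (sym eq) (∣m∣n⇒∣m+n (m∣m*n I) right)) (∣m∣n⇒∣m+n (m∣m*n c) Q∣d)
            where
            eq : Q ℕ.* c ℕ.+ d ℕ.+ (R ℕ.* j′ ℕ.+ ℕ.pred Q ℕ.* R ℕ.* j) ≡ Q ℕ.* I ℕ.+ (R ℕ.* j ℕ.+ ℕ.pred Q ℕ.* R ℕ.* j)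
            eq = trans (lem₂ c Q (R ℕ.* j′) d _) (trans (cong (ℕ._+ ℕ.pred Q ℕ.* R ℕ.* j) (ℕ.m+[n∸m]≡n le)) (ℕ.+-assoc (Q ℕ.* I) _ _))

      weighted-U : ∀ c I j (w : ℕ → ℤ) (x : ℕ → ℕ) → j ℕ.< Q → (∀ d → I ≡ c ℕ.+ d → χ d ≡ χ (x I)) →
        ∑ Q (λ j′ → w j′ * shift (c ℕ.* Q ℕ.+ R ℕ.* j′) (U Q) (Q ℕ.* I ℕ.+ R ℕ.* j)) ≡ w j * (⟦ c ≤? I ⟧ * χ (x I))
      weighted-U c I j w x j<Q class = trans
        (∑-single Q j j<Q (λ j′ j′<Q j′≢j → trans (cong (w j′ *_) (shifted-U-≢ c I j j′ j<Q j′<Q j′≢j)) (*-zeroʳ (w j′))))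
        (cong (w j *_) (shifted-U c I j x class))

      -- Coprimality of R and Q leaves only the term `j′ = j` in each sum. In units of Q, the shift
      -- by 3QR and the further QR before `X₀₁` become the thresholds 3R and 4R; χ(I + 2R) stands
      -- for χ(I - 4R), the difference 6R being divisible by 3.
      B-E : ∀ I j → j ℕ.< Q → shift (3 ℕ.* R ℕ.* Q) B (Q ℕ.* I ℕ.+ R ℕ.* j) ≡ E R Q I j
      B-E I j j<Q = begin
        shift M B N
          ≡⟨ trans (shift-cong M B-coeff N) (shift-⊕ M (∑ˢ Q (λ j → χ j · sU j)) (shift k (∑ˢ Q (λ j → w j · sU j))) N) ⟩
        shift M (∑ˢ Q (λ j → χ j · shift (R ℕ.* j) (U Q))) N + shift M (shift k (∑ˢ Q (λ j → (χ j + χ (j ℕ.+ Q)) · shift (R ℕ.* j) (U Q)))) N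
          ≡⟨ cong₂ _+_ (shift-weighted M Q χ sU N) (trans (shift-shift M k (∑ˢ Q (λ j → w j · sU j)) N) (shift-weighted (M ℕ.+ k) Q w sU N)) ⟩
        ∑ Q (λ j → χ j * shift M (shift (R ℕ.* j) (U Q)) N) + ∑ Q (λ j → (χ j + χ (j ℕ.+ Q)) * shift (M ℕ.+ k) (shift (R ℕ.* j) (U Q)) N)
          ≡⟨ cong₂ _+_
              (trans (∑-cong Q (λ i _ → cong (χ i *_) (shift-shift M (R ℕ.* i) (U Q) N)))
                (weighted-U (3 ℕ.* R) I j χ (λ I → I) j<Q (λ d eq → trans (sym (χ-+3* R d)) (cong χ (trans (ℕ.+-comm d (3 ℕ.* R)) (sym eq))))))
              (trans (∑-cong Q (λ i _ → cong ((χ i + χ (i ℕ.+ Q)) *_) (trans (shift-shift (M ℕ.+ k) (R ℕ.* i) (U Q) N)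
                  (cong (λ m → shift (m ℕ.+ R ℕ.* i) (U Q) N) (lem₁ R Q)))))
                (weighted-U (4 ℕ.* R) I j w (λ I → I ℕ.+ 2 ℕ.* R) j<Q
                  (λ d eq → trans (sym (χ-+3* (2 ℕ.* R) d)) (cong χ (trans (lem₂ d R) (cong (ℕ._+ 2 ℕ.* R) (sym eq))))))) ⟩
        E R Q I j ∎
        where
        open ≡-Reasoning
        M = 3 ℕ.* R ℕ.* Q
        N = Q ℕ.* I ℕ.+ R ℕ.* j
        sU : ℕ → Ser
        sU j = shift (R ℕ.* j) (U Q)
        w : ℕ → ℤ
        w j = χ j + χ (j ℕ.+ Q)
        lem₁ : ∀ R Q → 3 ℕ.* R ℕ.* Q ℕ.+ R ℕ.* Q ≡ 4 ℕ.* R ℕ.* Q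
        lem₁ = ℕ-solve
        lem₂ : ∀ d R → d ℕ.+ 3 ℕ.* (2 ℕ.* R) ≡ 4 ℕ.* R ℕ.+ d ℕ.+ 2 ℕ.* R
        lem₂ = ℕ-solve

-- Flatness of Φ_3QR for suitable inverses of R modulo Q.

module TernaryFlat where

  open import Defs hiding (S; F)
  open import Data.Bool using (true)
  open import Data.Nat using (_+_; _*_; _≤_; _<_)
  open import Data.Nat.Properties
  open import Data.Nat.Divisibility
  open import Data.Nat.Coprimality as Coprimality using (Coprime)
  open import Data.Nat.Primality using (Prime; prime?; prime⇒irreducible)
  open import Data.Integer as ℤ using (ℤ; 0ℤ; 1ℤ; ∣_∣)
  import Data.Integer.Properties as ℤ
  open import Data.List using (List; []; _∷_)
  open import Data.List.Membership.Propositional using (_∈_)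
  open import Data.List.Relation.Unary.Any using (here; there)
  open import Data.List.Relation.Unary.All as All using (All)
  open import Data.List.Relation.Unary.AllPairs as AllPairs using ()
  open import Data.List.Relation.Unary.Unique.Propositional using (Unique)
  open import Relation.Nullary.Decidable using (from-yes)
  open import Algebra.Bundles using (CommutativeRing)
  open Sums
  open Series
  open CyclotomicLists renaming (R to ℜ)
  open SmallCyclotomics
  open Flatness
  open TernaryCoefficients

  module Rearrange₃ {c ℓ} (𝓡 : CommutativeRing c ℓ) where
    open CommutativeRing 𝓡 using (*-commutativeMonoid) renaming (_*_ to _∙_; _≈_ to _∼_; refl to ∼-refl)
    open import Algebra.Solver.CommutativeMonoid *-commutativeMonoid using (solve; _⊜_) renaming (_⊕_ to _⊙_)

    collect : ∀ t u v o p q r s₁ s₂ s₃ k →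
      t ∙ (u ∙ v) ∙ (o ∙ (p ∙ (q ∙ (r ∙ (o ∙ s₁ ∙ (o ∙ s₂ ∙ (o ∙ s₃))))))) ∙ k
      ∼ (o ∙ t) ∙ (u ∙ v) ∙ ((o ∙ p) ∙ (o ∙ q) ∙ (o ∙ r) ∙ s₁ ∙ s₂ ∙ s₃) ∙ k
    collect = solve 11 (λ t u v o p q r s₁ s₂ s₃ k →
      ((t ⊙ (u ⊙ v)) ⊙ (o ⊙ (p ⊙ (q ⊙ (r ⊙ ((o ⊙ s₁) ⊙ ((o ⊙ s₂) ⊙ (o ⊙ s₃)))))))) ⊙ k
      ⊜ (((o ⊙ t) ⊙ (u ⊙ v)) ⊙ (((((((o ⊙ p) ⊙ (o ⊙ q)) ⊙ (o ⊙ r)) ⊙ s₁) ⊙ s₂) ⊙ s₃))) ⊙ k) ∼-refl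

    pair-up : ∀ u v s₁ s₂ s₃ a b c →
      a ∙ (u ∙ v) ∙ (a ∙ b ∙ c ∙ s₁ ∙ s₂ ∙ s₃) ∙ (a ∙ (b ∙ c))
      ∼ a ∙ (u ∙ (a ∙ b ∙ s₁)) ∙ ((b ∙ c ∙ s₃) ∙ v ∙ (a ∙ c ∙ s₂))
    pair-up = solve 8 (λ u v s₁ s₂ s₃ a b c →
      ((a ⊙ (u ⊙ v)) ⊙ (((((a ⊙ b) ⊙ c) ⊙ s₁) ⊙ s₂) ⊙ s₃)) ⊙ (a ⊙ (b ⊙ c))
      ⊜ (a ⊙ (u ⊙ ((a ⊙ b) ⊙ s₁))) ⊙ ((((b ⊙ c) ⊙ s₃) ⊙ v) ⊙ ((a ⊙ c) ⊙ s₂))) ∼-refl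

    regroup : ∀ a b c g → a ∙ b ∙ (c ∙ g) ∼ g ∙ (a ∙ (b ∙ c))
    regroup = solve 4 (λ a b c g → (a ⊙ b) ⊙ (c ⊙ g) ⊜ g ⊙ (a ⊙ (b ⊙ c))) ∼-refl

  open Rearrange₃ series

  semigroup-z′ : ∀ p q .{{_ : NonZero p}} → z p ⊛ z q ⊛ semigroup p q ≈ z (q * p)
  semigroup-z′ p q = ≈-trans (mid (z p) (z q) (G p) (∑ˢ p (λ j → X (q * j)))) (semigroup-z p q)
    where
    open CommutativeRing series using (*-commutativeMonoid)
    open import Algebra.Solver.CommutativeMonoid *-commutativeMonoid using (solve; _⊜_) renaming (_⊕_ to _⊙_)
    mid : ∀ a b c d → a ⊛ b ⊛ (c ⊛ d) ≈ a ⊛ c ⊛ (b ⊛ d)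
    mid = solve 4 (λ a b c d → (a ⊙ b) ⊙ (c ⊙ d) ⊜ (a ⊙ c) ⊙ (b ⊙ d)) (λ _ → refl)

  semigroup-0 : ∀ p q .{{_ : NonZero p}} .{{_ : NonZero q}} → semigroup p q 0 ≡ 1ℤ
  semigroup-0 p q = trans (sym (ℤ.*-identityˡ (semigroup p q 0)))
    (trans (cong (ℤ._* semigroup p q 0) (sym (⊛-0 {z p} {z q} (z-0 p) (z-0 q))))
      (trans (semigroup-z′ p q 0) (z-0 (q * p) {{m*n≢0 q p}})))

  prime[3] : Prime 3
  prime[3] = from-yes (prime? 3)

  module _ (q r : ℕ) (pQ : Prime (suc q)) (pR : Prime (suc r)) (3<Q : 3 < suc q) (Q<R : suc q < suc r) where

    private
      Q R n e d : ℕ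
      Q = suc q
      R = suc r
      -- `suc n` is definitionally `3 * Q * R`, and `e` is the total degree of the cyclotomic
      -- polynomials of the seven proper divisors, in the order of `ds`.
      n = r + (q + (suc q + (suc q + 0))) * suc r
      e = 1 + (2 + (q + (r + (2 * q + (2 * r + (q * r + 0))))))
      d = suc n ∸ e

      3<R : 3 < R
      3<R = <-trans 3<Q Q<R

      3∤Q : ¬ 3 ∣ Q
      3∤Q 3∣Q = <⇒≢ 3<Q (prime∣prime⇒≡ prime[3] pQ 3∣Q)

      3∤R : ¬ 3 ∣ R
      3∤R 3∣R = <⇒≢ 3<R (prime∣prime⇒≡ prime[3] pR 3∣R)

      Q∤R : ¬ Q ∣ R
      Q∤R Q∣R = <⇒≢ Q<R (prime∣prime⇒≡ pQ pR Q∣R)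

      R⊥Q : Coprime R Q
      R⊥Q = prime⇒coprime′ pQ Q∤R

      ds : List ℕ
      ds = 1 ∷ 3 ∷ Q ∷ R ∷ 3 * Q ∷ 3 * R ∷ Q * R ∷ []

      S₁ S₂ S₃ D W : Ser
      S₁ = semigroup 3 Q
      S₂ = semigroup 3 R
      S₃ = semigroup Q R
      D = z 1 ⊛ (repunit 3 ⊛ (repunit Q ⊛ (repunit R ⊛ (z 1 ⊛ S₁ ⊛ (z 1 ⊛ S₂ ⊛ (z 1 ⊛ S₃))))))
      W = repunit 3 ⊛ B Q R

      product : Product ds e D
      product = cons Φ₁ (cons (Φₚ prime[3]) (cons (Φₚ pQ) (cons (Φₚ pR)
        (cons (Φₚᵩ 2 q prime[3] pQ (<⇒≢ 3<Q)) (cons (Φₚᵩ 2 r prime[3] pR (<⇒≢ 3<R)) (cons (Φₚᵩ q r pQ pR (<⇒≢ Q<R))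
          (nil ≈-refl) refl (λ k → trans (⊛-comm (z 1 ⊛ S₃) 𝟙 k) (𝟙-⊛ (z 1 ⊛ S₃) k)))
          refl ≈-refl) refl ≈-refl) refl ≈-refl) refl ≈-refl) refl ≈-refl) refl ≈-refl

      K : Ser
      K = z 3 ⊛ (z Q ⊛ z R)

      -- The auxiliary factor K = (1 - x³)(1 - x^Q)(1 - x^R) supplies each `semigroup` with the two
      -- binomials that clear its denominators; the binomials so obtained then clear those of `U`
      -- and `V`. Having constant term 1, K cancels in the end.
      W-⊛-D : W ⊛ D ≈ z (suc n)
      W-⊛-D = ⊛-cancelʳ K (⊛-0 {z 3} {z Q ⊛ z R} refl (⊛-0 {z Q} {z R} refl refl))
        (≈-trans (collect (repunit 3) (U Q) (V Q R) (z 1) (repunit 3) (repunit Q) (repunit R) S₁ S₂ S₃ K)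
          (≈-trans (⊛-cong (⊛-cong (⊛-cong (z-repunit 3) (≈-refl {U Q ⊛ V Q R}))
              (⊛-cong (⊛-cong (⊛-cong (⊛-cong (⊛-cong (z-repunit 3) (z-repunit Q)) (z-repunit R)) (≈-refl {S₁})) (≈-refl {S₂})) (≈-refl {S₃}))) (≈-refl {K}))
          (≈-trans (pair-up (U Q) (V Q R) S₁ S₂ S₃ (z 3) (z Q) (z R))
          (≈-trans (⊛-cong
              (⊛-cong (≈-refl {z 3}) (≈-trans (⊛-cong (≈-refl {U Q}) (semigroup-z′ 3 Q)) (U-z Q)))
              (≈-trans (⊛-cong (⊛-cong (semigroup-z′ Q R) (≈-refl {V Q R})) (semigroup-z′ 3 R)) (V-z Q R 3∤Q)))
          (≈-trans (regroup (z 3) (z Q) (z R) (z (R * 3 * Q)))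
            (⊛-cong {g = K} (λ k → cong (λ m → z m k) (order R Q)) ≈-refl))))))
        where
        order : ∀ R Q → R * 3 * Q ≡ 3 * Q * R
        order = ℕ-solve

      D-0 : D 0 ≡ 1ℤ
      D-0 = ⊛-0 {z 1} {D₁} refl (⊛-0 {repunit 3} {D₂} refl (⊛-0 {repunit Q} {D₃} (repunit-0 Q) (⊛-0 {repunit R} {D₄} (repunit-0 R)
        (⊛-0 {z 1 ⊛ S₁} {D₅} (⊛-0 {z 1} {S₁} refl (semigroup-0 3 Q)) (⊛-0 {z 1 ⊛ S₂} {D₆} (⊛-0 {z 1} {S₂} refl (semigroup-0 3 R))
          (⊛-0 {z 1} {S₃} refl (semigroup-0 Q R)))))))
        where
        D₆ = z 1 ⊛ S₃
        D₅ = z 1 ⊛ S₂ ⊛ D₆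
        D₄ = z 1 ⊛ S₁ ⊛ D₅
        D₃ = repunit R ⊛ D₄
        D₂ = repunit Q ⊛ D₃
        D₁ = repunit 3 ⊛ D₂

      e≤n : e ≤ suc n
      e≤n = subst (e ≤_) (lem q r) (m≤m+n e (2 * (q * r)))
        where
        lem : ∀ q r → 1 + (2 + (q + (r + (2 * q + (2 * r + (q * r + 0)))))) + 2 * (q * r) ≡ 3 * (1 + q) * (1 + r)
        lem = ℕ-solve

      1<3 : 1 < 3
      1<3 = s≤s (s≤s z≤n)

      Q<3Q : Q < 3 * Q
      Q<3Q = m<m+n Q (s≤s z≤n)

      R<3R : R < 3 * R
      R<3R = m<m+n R (s≤s z≤n)

      3Q<3R : 3 * Q < 3 * R
      3Q<3R = *-monoʳ-< 3 Q<R

      3R<QR : 3 * R < Q * R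
      3R<QR = *-monoˡ-< R 3<Q

      R≢3Q : R ≢ 3 * Q
      R≢3Q eq = Q∤R (subst (Q ∣_) (sym eq) (n∣m*n 3))

      unique : Unique ds
      unique =
        (<⇒≢ 1<3 All.∷ <⇒≢ 1<Q All.∷ <⇒≢ 1<R All.∷ <⇒≢ (<-trans 1<Q Q<3Q) All.∷ <⇒≢ (<-trans 1<R R<3R) All.∷ <⇒≢ (<-trans (<-trans 1<R R<3R) 3R<QR) All.∷ All.[]) AllPairs.∷
        (<⇒≢ 3<Q All.∷ <⇒≢ 3<R All.∷ <⇒≢ (<-trans 3<Q Q<3Q) All.∷ <⇒≢ (<-trans 3<R R<3R) All.∷ <⇒≢ (<-trans (<-trans 3<R R<3R) 3R<QR) All.∷ All.[]) AllPairs.∷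
        (<⇒≢ Q<R All.∷ <⇒≢ Q<3Q All.∷ <⇒≢ (<-trans Q<R R<3R) All.∷ <⇒≢ (<-trans (<-trans Q<R R<3R) 3R<QR) All.∷ All.[]) AllPairs.∷
        (R≢3Q All.∷ <⇒≢ R<3R All.∷ <⇒≢ (<-trans R<3R 3R<QR) All.∷ All.[]) AllPairs.∷
        (<⇒≢ 3Q<3R All.∷ <⇒≢ (<-trans 3Q<3R 3R<QR) All.∷ All.[]) AllPairs.∷
        (<⇒≢ 3R<QR All.∷ All.[]) AllPairs.∷
        All.[] AllPairs.∷ AllPairs.[]
        where
        1<Q = <-trans 1<3 3<Q
        1<R = <-trans 1<3 3<R

      proper : ∀ {x} → x ≤ Q * R → x ≢ 3 * Q * R
      proper x≤ = <⇒≢ (≤-<-trans x≤ (*-monoˡ-< R Q<3Q))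

      sound : ∀ {x} → x ∈ ds → x ∣ 3 * Q * R × x ≢ 3 * Q * R
      sound (here refl) = 1∣ (3 * Q * R) , proper (s≤s z≤n)
      sound (there (here refl)) = ∣-trans (m∣m*n Q) (m∣m*n R) , proper (<⇒≤ (<-trans (<-trans 3<R R<3R) 3R<QR))
      sound (there (there (here refl))) = ∣-trans (n∣m*n 3) (m∣m*n R) , proper (<⇒≤ (<-trans (<-trans Q<R R<3R) 3R<QR))
      sound (there (there (there (here refl)))) = n∣m*n (3 * Q) , proper (<⇒≤ (<-trans R<3R 3R<QR))
      sound (there (there (there (there (here refl))))) = m∣m*n R , proper (<⇒≤ (<-trans 3Q<3R 3R<QR))
      sound (there (there (there (there (there (here refl)))))) = *-monoˡ-∣ R (m∣m*n {3} Q) , proper (<⇒≤ 3R<QR)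
      sound (there (there (there (there (there (there (here refl))))))) = *-monoˡ-∣ R (n∣m*n 3 {Q}) , proper ≤-refl

      divisors-QR : ∀ {x} → x ∣ Q * R → (x ≡ 1 ⊎ x ≡ Q) ⊎ (x ≡ R ⊎ x ≡ Q * R)
      divisors-QR x∣ with ∣-prime-* pQ x∣
      divisors-QR x∣ | inj₁ x∣R with prime⇒irreducible pR x∣R
      ... | inj₁ x≡1 = inj₁ (inj₁ x≡1)
      ... | inj₂ x≡R = inj₂ (inj₁ x≡R)
      divisors-QR x∣ | inj₂ (y , refl , y∣R) with prime⇒irreducible pR y∣R
      ... | inj₁ refl = inj₁ (inj₂ (*-identityʳ Q))
      ... | inj₂ refl = inj₂ (inj₂ refl)

      complete : ∀ {x} → x ∣ 3 * Q * R → x ≢ 3 * Q * R → x ∈ ds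
      complete {x} x∣ x≢ with ∣-prime-* prime[3] (subst (x ∣_) (*-assoc 3 Q R) x∣)
      complete x∣ x≢ | inj₁ x∣QR with divisors-QR x∣QR
      ... | inj₁ (inj₁ refl) = here refl
      ... | inj₁ (inj₂ refl) = there (there (here refl))
      ... | inj₂ (inj₁ refl) = there (there (there (here refl)))
      ... | inj₂ (inj₂ refl) = there (there (there (there (there (there (here refl))))))
      complete x∣ x≢ | inj₂ (y , refl , y∣QR) with divisors-QR y∣QR
      ... | inj₁ (inj₁ refl) = there (here refl)
      ... | inj₁ (inj₂ refl) = there (there (there (there (here refl))))
      ... | inj₂ (inj₁ refl) = there (there (there (there (there (here refl)))))
      ... | inj₂ (inj₂ refl) = ⊥-elim (x≢ (sym (*-assoc 3 Q R)))

      M : ℕ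
      M = 3 * R * Q

      -- Choose j < Q with Rj ≡ N modulo Q and divide the rest by Q. As Rj ≤ QR, a rest of at least
      -- QR remains, so I ≥ R; since R > 2v, there is room for the two descents by v in
      -- `flat-steps`.
      representation : ∀ N → 2 * R * Q ≤ N → ∃[ I ] ∃[ j ] (j < Q × R ≤ I × Q * I + R * j ≡ N)
      representation N N≥ = represent (linear-congruence (q * R) N Q qR⊥Q)
        where
        qR⊥Q : Coprime (q * R) Q
        qR⊥Q {x} (x∣qR , x∣Q) = R⊥Q
          (∣m+n∣m⇒∣n (subst (x ∣_) (+-comm R (q * R)) (∣m⇒∣m*n R x∣Q)) x∣qR , x∣Q)
        represent : ∃[ j ] (j < Q × Q ∣ q * R * j + N) → ∃[ I ] ∃[ j ] (j < Q × R ≤ I × Q * I + R * j ≡ N)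
        represent (j , j<Q , Q∣) = _∣_.quotient Q∣rest , j , j<Q , R≤I , total
          where
          lem₁ : ∀ R Q → 2 * R * Q ≡ R * Q + R * Q
          lem₁ = ℕ-solve
          N≥′ : R * Q + R * j ≤ N
          N≥′ = ≤-trans (+-monoʳ-≤ (R * Q) (*-monoʳ-≤ R (<⇒≤ j<Q))) (≤-trans (≤-reflexive (sym (lem₁ R Q))) N≥)
          Rj≤N : R * j ≤ N
          Rj≤N = ≤-trans (m≤n+m (R * j) (R * Q)) N≥′
          rest = N ∸ R * j
          lem₂ : ∀ q R j d → q * R * j + (R * j + d) ≡ (1 + q) * (R * j) + d
          lem₂ = ℕ-solve
          Q∣rest : Q ∣ rest
          Q∣rest = ∣m+n∣m⇒∣n (subst (Q ∣_) (trans (cong (q * R * j +_) (sym (m+[n∸m]≡n Rj≤N))) (lem₂ q R j rest)) Q∣) (m∣m*n (R * j))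
          total : Q * _∣_.quotient Q∣rest + R * j ≡ N
          total = trans (cong (_+ R * j) (trans (*-comm Q (_∣_.quotient Q∣rest)) (sym (_∣_.equality Q∣rest)))) (m∸n+n≡m Rj≤N)
          R≤I : R ≤ _∣_.quotient Q∣rest
          R≤I = *-cancelʳ-≤ R (_∣_.quotient Q∣rest) Q (subst (R * Q ≤_) (_∣_.equality Q∣rest) (m+n≤o⇒m≤o∸n (R * Q) N≥′))

    module _ (v t : ℕ) (3∣t : 3 ∣ t) (2t<Q : 2 * t < Q) (3∣v+R : 3 ∣ v + R)
      (inverse : (R * t ≡ Q * v + 1) ⊎ (R * t + 1 ≡ Q * v)) where

      private
        lem₁ : ∀ Q v → Q * (2 * v) ≡ 2 * (Q * v)
        lem₁ = ℕ-solve
        lem₂ : ∀ R t → 2 * (R * t) ≡ R * (2 * t)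
        lem₂ = ℕ-solve

        2v<R : 2 * v < R
        2v<R = *-cancelˡ-< Q (2 * v) R (by inverse)
          where
          open ≤-Reasoning
          by : (R * t ≡ Q * v + 1) ⊎ (R * t + 1 ≡ Q * v) → Q * (2 * v) < Q * R
          by (inj₁ eq) = begin-strict
            Q * (2 * v)      ≡⟨ lem₁ Q v ⟩
            2 * (Q * v)      ≤⟨ *-monoʳ-≤ 2 (≤-trans (m≤m+n (Q * v) 1) (≤-reflexive (sym eq))) ⟩
            2 * (R * t)      ≡⟨ lem₂ R t ⟩
            R * (2 * t)      <⟨ *-monoʳ-< R 2t<Q ⟩
            R * Q            ≡⟨ *-comm R Q ⟩
            Q * R            ∎
          by (inj₂ eq) = begin-strict
            Q * (2 * v)      ≡⟨ lem₁ Q v ⟩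
            2 * (Q * v)      ≡⟨ cong (2 *_) (sym eq) ⟩
            2 * (R * t + 1)  ≡⟨ *-distribˡ-+ 2 (R * t) 1 ⟩
            2 * (R * t) + 2  <⟨ +-monoʳ-< (2 * (R * t)) (<-trans ≤-refl 3<R) ⟩
            2 * (R * t) + R  ≡⟨ cong (_+ R) (lem₂ R t) ⟩
            R * (2 * t) + R  ≡⟨ trans (+-comm (R * (2 * t)) R) (sym (*-suc R (2 * t))) ⟩
            R * suc (2 * t)  ≤⟨ *-monoʳ-≤ R 2t<Q ⟩
            R * Q            ≡⟨ *-comm R Q ⟩
            Q * R            ∎

        -- Reading B behind a shift by 3QR extends it by zero to negative indices. The first
        -- coefficients of W then need no separate treatment, and all indices are large enough for
        -- `representation`.
        ε : ℕ → ℤ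
        ε N = shift M (B Q R) N

        W-ε : ∀ N k → 2 + N ≡ M + k → W k ≡ ε N ℤ.+ ε (suc N) ℤ.+ ε (suc (suc N))
        W-ε N k eq = trans (∑ˢ-⊛ 3 (λ j → X (1 * j)) (B Q R) k) (trans
          (cong₂ ℤ._+_ (cong₂ ℤ._+_ (cong (λ w → 0ℤ ℤ.+ w) (value 0)) (value 1)) (value 2))
          (trans (cong₂ ℤ._+_ (cong₂ ℤ._+_ (cong (λ w → 0ℤ ℤ.+ w) e₀) e₁) e₂) (lem (ε N) (ε (suc N)) (ε (suc (suc N))))))
          where
          lem : ∀ a b c → 0ℤ ℤ.+ c ℤ.+ b ℤ.+ a ≡ a ℤ.+ b ℤ.+ c
          lem = ℤ-solve
          value : ∀ j → (X (1 * j) ⊛ B Q R) k ≡ shift (j + M) (B Q R) (2 + N)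
          value j = trans (X-⊛ (1 * j) (B Q R) k) (trans (sym (shift-+ M (shift (1 * j) (B Q R)) k))
            (trans (shift-shift M (1 * j) (B Q R) (M + k)) (cong₂ (λ a b → shift a (B Q R) b)
              (trans (+-comm M (1 * j)) (cong (_+ M) (*-identityˡ j))) (sym eq))))
          e₀ : shift M (B Q R) (2 + N) ≡ ε (2 + N)
          e₀ = refl
          e₁ : shift (1 + M) (B Q R) (2 + N) ≡ ε (1 + N)
          e₁ = refl
          e₂ : shift (2 + M) (B Q R) (2 + N) ≡ ε N
          e₂ = refl

        point : ∀ {I j N} → j < Q → Q * I + R * j ≡ N → ε N ≡ E R Q I j
        point {I} {j} j<Q refl = B-E Q R R⊥Q I j j<Q

        big : ∀ {N k} → 2 + N ≡ M + k → 2 * R * Q ≤ N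
        big {N} {k} eq = ≤-pred (≤-pred (≤-trans (≤-reflexive (lem (2 * R * Q))) (≤-trans (+-monoʳ-≤ (2 * R * Q) (≤-trans (<⇒≤ (<-trans ≤-refl 3<R)) (m≤m*n R Q)))
          (≤-trans (≤-reflexive (lem′ R Q)) (≤-trans (m≤m+n M k) (≤-reflexive (sym eq)))))))
          where
          lem : ∀ a → suc (suc a) ≡ a + 2
          lem = ℕ-solve
          lem′ : ∀ R Q → 2 * R * Q + R * Q ≡ 3 * R * Q
          lem′ = ℕ-solve

        walk : ∀ N → 2 * R * Q ≤ N → ∃[ I ] ∃[ j ] (j < Q × Q * I + R * j ≡ N × Steps R Q v t I j)
        walk N N≥ = let I , j , j<Q , R≤I , eq = representation N N≥ in
          I , j , j<Q , eq , subst (λ I → Steps R Q v t I j) (m∸n+n≡m (≤-trans (<⇒≤ 2v<R) R≤I))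
            (flat-steps R Q v t (I ∸ 2 * v) j 2v<R 2t<Q j<Q 3∤R 3∤Q 3∣v+R 3∣t)

        forward : R * t ≡ Q * v + 1 → ∀ {a b} → b + Q * v ≡ a + R * t → b ≡ suc a
        forward Rt≡ {a} {b} eq = +-cancelʳ-≡ (Q * v) b (suc a) (trans eq (trans (cong (a +_) Rt≡) (lem a (Q * v))))
          where
          lem : ∀ a c → a + (c + 1) ≡ suc a + c
          lem = ℕ-solve

        backward : R * t + 1 ≡ Q * v → ∀ {a b} → b + Q * v ≡ a + R * t → suc b ≡ a
        backward Rt≡ {a} {b} eq = +-cancelʳ-≡ (R * t) (suc b) a (trans (lem b (R * t)) (trans (cong (b +_) Rt≡) eq))
          where
          lem : ∀ a c → suc a + c ≡ a + (c + 1)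
          lem = ℕ-solve

        W-bound : ∀ k → ∣ W k ∣ ≤ 1
        W-bound k = subst (λ w → ∣ w ∣ ≤ 1) (sym (W-ε N k eq)) (by inverse)
          where
          N = M + k ∸ 2
          eq : 2 + N ≡ M + k
          eq = m+[n∸m]≡n (≤-trans (≤-trans (<⇒≤ (<-trans ≤-refl 3<R)) (≤-trans (<⇒≤ R<3R) (m≤m*n (3 * R) Q))) (m≤m+n M k))
          flip : ∀ a b c → a ℤ.+ b ℤ.+ c ≡ c ℤ.+ b ℤ.+ a
          flip = ℤ-solve
          Walk : ℕ → Set
          Walk N = ∃[ I ] ∃[ j ] (j < Q × Q * I + R * j ≡ N × Steps R Q v t I j)
          up : R * t ≡ Q * v + 1 → Walk N → ∣ ε N ℤ.+ ε (suc N) ℤ.+ ε (suc (suc N)) ∣ ≤ 1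
          up Rt≡ (I , j , j<Q , N≡ , steps {I₁} {j₁} {I₂} {j₂} j₁<Q j₂<Q s₁ s₂ bound) = subst (λ w → ∣ w ∣ ≤ 1)
            (sym (cong₂ ℤ._+_ (cong₂ ℤ._+_ (point {I} {j} j<Q N≡) (point {I₁} {j₁} j₁<Q N₁≡))
              (point {I₂} {j₂} j₂<Q (trans (forward Rt≡ s₂) (cong suc N₁≡))))) bound
            where
            N₁≡ : Q * I₁ + R * j₁ ≡ suc N
            N₁≡ = trans (forward Rt≡ s₁) (cong suc N≡)
          down : R * t + 1 ≡ Q * v → Walk (2 + N) → ∣ ε N ℤ.+ ε (suc N) ℤ.+ ε (suc (suc N)) ∣ ≤ 1
          down Rt≡ (I , j , j<Q , N≡ , steps {I₁} {j₁} {I₂} {j₂} j₁<Q j₂<Q s₁ s₂ bound) = subst (λ w → ∣ w ∣ ≤ 1)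
            (trans (sym (cong₂ ℤ._+_ (cong₂ ℤ._+_ (point {I} {j} j<Q N≡) (point {I₁} {j₁} j₁<Q N₁≡))
                (point {I₂} {j₂} j₂<Q (suc-injective (trans (backward Rt≡ s₂) N₁≡)))))
              (flip (ε (2 + N)) (ε (1 + N)) (ε N))) bound
            where
            N₁≡ : Q * I₁ + R * j₁ ≡ suc N
            N₁≡ = suc-injective (trans (backward Rt≡ s₁) N≡)
          by : (R * t ≡ Q * v + 1) ⊎ (R * t + 1 ≡ Q * v) → ∣ ε N ℤ.+ ε (suc N) ℤ.+ ε (suc (suc N)) ∣ ≤ 1
          by (inj₁ Rt≡) = up Rt≡ (walk N (big {N} {k} eq))
          -- With this sign a step lowers the index by one, so the walk starts at the largest of the
          -- three.
          by (inj₂ Rt≡) = down Rt≡ (walk (2 + N) (m≤n⇒m≤1+n (m≤n⇒m≤1+n (big {N} {k} eq))))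

      Φ₃ᵩᵣ-flat : isFlat (cyclotomic (3 * Q * R)) ≡ true
      Φ₃ᵩᵣ-flat = isFlat-R (suc d) (cyclotomic (suc n)) (proj₁ main)
        (λ k k≤d → subst (λ w → ∣ w ∣ ≤ 1) (sym (proj₂ main k (≤-pred k≤d))) (W-bound k))
        where
        main = polyDivMonic-series W (Reversed-xPowMinusOne n) (newCyclo-divisor n (divisors-↭ n ds unique sound complete) product)
          D-0 e≤n (λ k _ → W-⊛-D k)

-- Chebyshev's lower bound for the number of primes.

module Chebyshev where

  open import Data.Nat
  open import Data.Nat.Properties
  open import Data.Nat.Divisibility
  open import Data.Nat.Primality using (Prime; prime?; prime⇒nonTrivial; prime⇒nonZero)
  open import Data.Nat.Primality.Factorisation using (PrimeFactorisation; factorise)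
  open import Data.Nat.Induction using (<-wellFounded; Acc; acc)
  open import Data.List using ([]; _∷_)
  open import Data.Nat.ListAction using (product)
  open import Data.List.Relation.Unary.All as All using (All)
  open import Data.Bool using (if_then_else_)
  open import Data.Integer as ℤ using (ℤ)
  open Sums using (∑; ⟦_⟧)

  -- Primes strictly below n, in step with the half-open sums `∑`, so that the block [Y, 2Y)
  -- contains π(2Y) - π(Y) of them.
  π : ℕ → ℕ
  π zero    = 0
  π (suc n) = π n + (if does (prime? n) then 1 else 0)

  π-∑ : ∀ n → ℤ.+ π n ≡ ∑ n (λ i → ⟦ prime? i ⟧)
  π-∑ zero    = refl
  π-∑ (suc n) = cong₂ ℤ._+_ (π-∑ n) (indicator (prime? n))
    where
    indicator : ∀ {P : Set} (d : Dec P) → ℤ.+ (if does d then 1 else 0) ≡ ⟦ d ⟧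
    indicator (yes _) = refl
    indicator (no _)  = refl

  prime≥2 : ∀ {p} → Prime p → 2 ≤ p
  prime≥2 pp = nonTrivial⇒n>1 _ {{prime⇒nonTrivial pp}}

  largest-power : ∀ p N → 2 ≤ p → 1 ≤ N → ∃[ e ] (p ^ e ≤ N × N < p ^ suc e)
  largest-power p N 2≤p 1≤N = search N (≤-trans (n<2^n N) (^-monoˡ-≤ N 2≤p))
    where
    n<2^n : ∀ n → n < 2 ^ n
    n<2^n zero    = s≤s z≤n
    n<2^n (suc n) = ≤-trans (+-mono-≤ (≤-trans (s≤s z≤n) (n<2^n n)) (n<2^n n)) (≤-reflexive (lem (2 ^ n)))
      where
      lem : ∀ a → a + a ≡ 2 * a
      lem = ℕ-solve
    search : ∀ e → N < p ^ e → ∃[ e ] (p ^ e ≤ N × N < p ^ suc e)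
    search zero    N<1 = ⊥-elim (<⇒≱ N<1 1≤N)
    search (suc e) N<  with <-≤-connex N (p ^ e)
    ... | inj₁ N<′ = search e N<′
    ... | inj₂ ≤N  = e , ≤N , N<

  split-power : ∀ p k → 2 ≤ p → 1 ≤ k → ∃[ a ] ∃[ m ] (k ≡ p ^ a * m × ¬ p ∣ m)
  split-power p k 2≤p 1≤k = go k (<-wellFounded k) 1≤k
    where
    go : ∀ k → Acc _<_ k → 1 ≤ k → ∃[ a ] ∃[ m ] (k ≡ p ^ a * m × ¬ p ∣ m)
    go k (acc rec) 1≤k with p ∣? k
    ... | no p∤k = 0 , k , sym (*-identityˡ k) , p∤k
    ... | yes (divides zero refl) = ⊥-elim (<⇒≱ 1≤k z≤n)
    ... | yes (divides q@(suc q′) refl) =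
      let a , m , q≡ , p∤m = go q (rec (m<m*n q p 2≤p)) (s≤s z≤n)
      in suc a , m , trans (cong (_* p) q≡) (lem p (p ^ a) m) , p∤m
      where
      lem : ∀ p b m → b * m * p ≡ p * b * m
      lem = ℕ-solve

  module _ (N : ℕ) (1≤N : 1 ≤ N) where

    prime-power : ∀ {p} → Dec (Prime p) → ℕ
    prime-power {p} (yes pp) = p ^ proj₁ (largest-power p N (prime≥2 pp) 1≤N)
    prime-power     (no _)   = 1

    prime-power-∣ : ∀ {p} (d : Dec (Prime p)) → Prime p → ∀ a → p ^ a ≤ N → p ^ a ∣ prime-power d
    prime-power-∣ (no ¬p) pp a _ = ⊥-elim (¬p pp)
    prime-power-∣ {p} (yes pp) _ a pᵃ≤N = m≤n⇒m^o∣ a e (≮⇒≥ λ e<a →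
        <⇒≱ (proj₂ (proj₂ (largest-power p N (prime≥2 pp) 1≤N))) (≤-trans (^-monoʳ-≤ p {{prime⇒nonZero pp}} e<a) pᵃ≤N))
      where
      e = proj₁ (largest-power p N (prime≥2 pp) 1≤N)
      m≤n⇒m^o∣ : ∀ a e → a ≤ e → p ^ a ∣ p ^ e
      m≤n⇒m^o∣ a e a≤e = divides (p ^ (e ∸ a)) (trans (cong (p ^_) (sym (m∸n+n≡m a≤e))) (^-distribˡ-+-* p (e ∸ a) a))

    prime-power-≤ : ∀ {p} (d : Dec (Prime p)) → prime-power d ≤ N ^ (if does d then 1 else 0)
    prime-power-≤ {p} (yes pp) = ≤-trans (proj₁ (proj₂ (largest-power p N (prime≥2 pp) 1≤N))) (≤-reflexive (sym (*-identityʳ N)))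
    prime-power-≤     (no _)   = ≤-refl

    lcm-below : ℕ → ℕ
    lcm-below zero    = 1
    lcm-below (suc t) = lcm-below t * prime-power (prime? t)

    lcm-below-≤ : ∀ t → lcm-below t ≤ N ^ π t
    lcm-below-≤ zero    = ≤-refl
    lcm-below-≤ (suc t) = ≤-trans (*-mono-≤ (lcm-below-≤ t) (prime-power-≤ (prime? t)))
      (≤-reflexive (sym (^-distribˡ-+-* N (π t) _)))

    -- By induction on the bound t for the prime factors of k. If t is prime, k = t^a m with t ∤ m:
    -- the power divides the new factor because t^a ≤ N, and m has only prime factors below t. For t
    -- > N this makes `lcm-below t` a common multiple of 1, ..., N.
    ∣-lcm-below : ∀ t k → 1 ≤ k → k ≤ N → (∀ {p} → Prime p → p ∣ k → p < t) → k ∣ lcm-below t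
    ∣-lcm-below zero k 1≤k k≤N smooth = no-factors (factorise k {{>-nonZero 1≤k}})
      where
      no-factors : PrimeFactorisation k → k ∣ 1
      no-factors record { factors = [] ; isFactorisation = refl } = ∣-refl
      no-factors record { factors = p ∷ ps ; isFactorisation = refl ; factorsPrime = pp All.∷ _ } =
        ⊥-elim (n≮0 (smooth pp (m∣m*n (product ps))))
    ∣-lcm-below (suc t) k 1≤k k≤N smooth = step (prime? t)
      where
      restrict : ∀ {m} → m ∣ k → ¬ t ∣ m ⊎ ¬ Prime t → ∀ {p} → Prime p → p ∣ m → p < t
      restrict m∣k excl {p} pp p∣m = ≤∧≢⇒< (≤-pred (smooth pp (∣-trans p∣m m∣k))) (λ { refl → contra excl })
        where
        contra : ¬ p ∣ _ ⊎ ¬ Prime p → _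
        contra (inj₁ p∤m) = p∤m p∣m
        contra (inj₂ ¬pp) = ¬pp pp
      step : (d : Dec (Prime t)) → k ∣ lcm-below t * prime-power d
      step (no ¬pt) = subst (k ∣_) (sym (*-identityʳ (lcm-below t)))
        (∣-lcm-below t k 1≤k k≤N (restrict ∣-refl (inj₂ ¬pt)))
      step (yes pt) with split-power t k (prime≥2 pt) 1≤k
      ... | a , m , refl , t∤m = subst (_∣ lcm-below t * prime-power (yes pt)) (*-comm m (t ^ a))
        (*-pres-∣ (∣-lcm-below t m 1≤m (≤-trans m≤k k≤N) (restrict (n∣m*n (t ^ a)) (inj₁ t∤m)))
          (prime-power-∣ (yes pt) pt a (≤-trans tᵃ≤k k≤N)))
        where
        1≤m : 1 ≤ m
        1≤m = n≢0⇒n>0 λ { refl → <⇒≢ 1≤k (sym (*-zeroʳ (t ^ a))) }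
        1≤tᵃ : 1 ≤ t ^ a
        1≤tᵃ = n≢0⇒n>0 λ eq → <⇒≢ 1≤k (sym (cong (_* m) eq))
        m≤k : m ≤ t ^ a * m
        m≤k = m≤n*m m (t ^ a) {{>-nonZero 1≤tᵃ}}
        tᵃ≤k : t ^ a ≤ t ^ a * m
        tᵃ≤k = m≤m*n (t ^ a) m {{>-nonZero 1≤m}}

    -- d i! j! / (i + j + 1)!, that is d times the integral of x^i (1 - x)^j over [0,1],
    -- is a positive integer, and the values for (i+1, j) and (i, j+1) add up to that for (i, j).
    module _ (d : ℕ) (1≤d : 1 ≤ d) (multiple : ∀ k → 1 ≤ k → k ≤ N → k ∣ d) where

      Beta : ℕ → ℕ → ℕ → Set
      Beta i j g = g * suc (i + j) ! ≡ d * (i ! * j !)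

      beta : ∀ i j → suc (i + j) ≤ N → ∃[ g ] Beta i j g
      beta zero j j<N with multiple (suc j) (s≤s z≤n) j<N
      ... | divides g d≡ = g , trans (lem g (suc j) (j !)) (cong (_* (1 * j !)) (sym d≡))
        where
        lem : ∀ g k f → g * (k * f) ≡ g * k * (1 * f)
        lem = ℕ-solve
      beta (suc i) j i+j<N =
        let g₁ , b₁ = beta i j (<⇒≤ i+j<N)
            g₂ , b₂ = beta i (suc j) (subst (λ k → suc k ≤ N) (sym (+-suc i j)) i+j<N)
        in g₁ ∸ g₂ , (begin
          (g₁ ∸ g₂) * (suc (suc (i + j)) !)                       ≡⟨ *-distribʳ-∸ (suc (suc (i + j)) !) g₁ g₂ ⟩
          g₁ * (suc (suc (i + j)) !) ∸ g₂ * (suc (suc (i + j)) !)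
            ≡⟨ cong₂ _∸_ (trans (lem₁ g₁ (suc (suc (i + j))) (suc (i + j) !)) (cong (suc (suc (i + j)) *_) b₁))
                 (trans (cong (λ k → g₂ * suc k !) (sym (+-suc i j))) b₂) ⟩
          suc (suc (i + j)) * (d * (i ! * j !)) ∸ d * (i ! * (suc j * j !))
            ≡⟨ cong₂ _∸_ (lem₂ i j d (i !) (j !)) (lem₃ j d (i !) (j !)) ⟩
          d * (suc i * i ! * j !) + d * i ! * j ! * suc j ∸ d * i ! * j ! * suc j
            ≡⟨ m+n∸n≡m (d * (suc i * i ! * j !)) (d * i ! * j ! * suc j) ⟩
          d * (suc i * i ! * j !) ∎)
        where
        open ≡-Reasoning
        lem₁ : ∀ g k f → g * (k * f) ≡ k * (g * f)
        lem₁ = ℕ-solve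
        lem₂ : ∀ i j d a b → (2 + (i + j)) * (d * (a * b)) ≡ d * ((1 + i) * a * b) + d * a * b * (1 + j)
        lem₂ = ℕ-solve
        lem₃ : ∀ j d a b → d * (a * ((1 + j) * b)) ≡ d * a * b * (1 + j)
        lem₃ = ℕ-solve

      -- Inserting 1 = x + (1 - x) under the integral k times splits it into 2^k integrals of the
      -- same kind, each a positive integer after multiplication by d.
      beta-≥ : ∀ k i j g → suc (i + j) + k ≤ N → Beta i j g → 2 ^ k ≤ g
      beta-≥ zero i j g _ b = n≢0⇒n>0 λ { refl → <⇒≢ (*-mono-≤ 1≤d (*-mono-≤ (n!≥1 i) (n!≥1 j))) b }
        where
        n!≥1 : ∀ n → 1 ≤ n !
        n!≥1 zero    = ≤-refl
        n!≥1 (suc n) = *-mono-≤ (s≤s (z≤n {n})) (n!≥1 n)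
      beta-≥ (suc k) i j g bound b =
        let g₁ , b₁ = beta (suc i) j (≤-trans (m≤m+n _ k) bound₁)
            g₂ , b₂ = beta i (suc j) (≤-trans (m≤m+n _ k) bound₂)
        in subst (2 ^ suc k ≤_) (add g₁ g₂ b₁ b₂)
             (≤-trans (≤-reflexive (cong (2 ^ k +_) (+-identityʳ (2 ^ k))))
               (+-mono-≤ (beta-≥ k (suc i) j g₁ bound₁ b₁) (beta-≥ k i (suc j) g₂ bound₂ b₂)))
        where
        bound₁ : suc (suc i + j) + k ≤ N
        bound₁ = subst (_≤ N) (cong suc (+-suc (i + j) k)) bound
        bound₂ : suc (i + suc j) + k ≤ N
        bound₂ = subst (λ m → suc m + k ≤ N) (sym (+-suc i j)) bound₁
        lem₁ : ∀ i j d a b → d * ((1 + i) * a * b) + d * (a * ((1 + j) * b)) ≡ (d * (a * b)) * (2 + (i + j))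
        lem₁ = ℕ-solve
        lem₂ : ∀ g k f → g * f * k ≡ g * (k * f)
        lem₂ = ℕ-solve
        add : ∀ g₁ g₂ → Beta (suc i) j g₁ → Beta i (suc j) g₂ → g₁ + g₂ ≡ g
        add g₁ g₂ b₁ b₂ = *-cancelʳ-≡ (g₁ + g₂) g (suc (suc (i + j)) !) {{(suc (suc (i + j))) !≢0}} (begin
          (g₁ + g₂) * suc (suc (i + j)) !                        ≡⟨ *-distribʳ-+ (suc (suc (i + j)) !) g₁ g₂ ⟩
          g₁ * suc (suc (i + j)) ! + g₂ * suc (suc (i + j)) !
            ≡⟨ cong₂ _+_ b₁ (trans (cong (λ m → g₂ * suc m !) (sym (+-suc i j))) b₂) ⟩
          d * (suc i * i ! * j !) + d * (i ! * (suc j * j !))    ≡⟨ lem₁ i j d (i !) (j !) ⟩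
          (d * (i ! * j !)) * suc (suc (i + j))                  ≡⟨ cong (_* suc (suc (i + j))) (sym b) ⟩
          g * suc (i + j) ! * suc (suc (i + j))                  ≡⟨ lem₂ g (suc (suc (i + j))) (suc (i + j) !) ⟩
          g * suc (suc (i + j)) !                                ∎)
          where open ≡-Reasoning

      common-multiple-≥ : 2 ^ pred N ≤ d
      common-multiple-≥ = beta-≥ (pred N) 0 0 d (≤-reflexive (suc-pred N {{>-nonZero 1≤N}})) (lem d)
        where
        lem : ∀ d → d * 1 ≡ d * 1
        lem d = refl

  -- With n = N - 1, the multiple of 1, ..., n lies between 2^(n-1) and n^π(N). The two units lost
  -- are the passage from N to n, as π is strict, and the exponent n - 1.
  chebyshev : ∀ N L → N ≤ 2 ^ L → N ≤ 2 + L * π N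
  chebyshev zero          L _ = z≤n
  chebyshev (suc zero)    L _ = s≤s z≤n
  chebyshev (suc n@(suc m)) L n<2ᴸ = s≤s (s≤s (2^-cancel-≤ m (L * π (suc n)) (begin
      2 ^ m                          ≤⟨ common-multiple-≥ n (s≤s z≤n) D 1≤D multiple ⟩
      D                              ≤⟨ lcm-below-≤ n (s≤s z≤n) (suc n) ⟩
      n ^ π (suc n)                  ≤⟨ ^-monoˡ-≤ (π (suc n)) (<⇒≤ n<2ᴸ) ⟩
      (2 ^ L) ^ π (suc n)            ≡⟨ ^-*-assoc 2 L (π (suc n)) ⟩
      2 ^ (L * π (suc n))            ∎)))
    where
    open ≤-Reasoning
    D = lcm-below n (s≤s z≤n) (suc n)
    multiple : ∀ k → 1 ≤ k → k ≤ n → k ∣ D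
    multiple k 1≤k k≤n = ∣-lcm-below n (s≤s z≤n) (suc n) k 1≤k k≤n
      (λ _ p∣k → s≤s (≤-trans (∣⇒≤ {{>-nonZero 1≤k}} p∣k) k≤n))
    1≤D : 1 ≤ D
    1≤D = n≢0⇒n>0 (λ D≡0 → D≢0 (suc n) D≡0)
      where
      D≢0 : ∀ t → lcm-below n (s≤s z≤n) t ≢ 0
      D≢0 (suc t) eq with m*n≡0⇒m≡0∨n≡0 (lcm-below n (s≤s z≤n) t) eq
      ... | inj₁ z = D≢0 t z
      ... | inj₂ z = nonzero (prime? t) z
        where
        nonzero : (d : Dec (Prime t)) → prime-power n (s≤s z≤n) d ≢ 0
        nonzero (yes pp) = let e = proj₁ (largest-power t n (prime≥2 pp) (s≤s z≤n)) in
          ≢-nonZero⁻¹ (t ^ e) {{m^n≢0 t e {{prime⇒nonZero pp}}}}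
        nonzero (no _) ()
    2^-cancel-≤ : ∀ a b → 2 ^ a ≤ 2 ^ b → a ≤ b
    2^-cancel-≤ a b le = ≮⇒≥ λ b<a → <⇒≱ (^-monoʳ-< 2 ≤-refl b<a) le

-- Orthogonality of periodic functions with coprime periods.

module Correlation where

  open import Data.Nat.DivMod using (_%_; _/_; m≡m%n+[m/n]*n; m%n<n)
  open import Data.Nat.Coprimality using (Coprime; coprime-Bézout)
  open import Data.Nat.GCD using (module Bézout)
  open import Data.Integer as ℤ using (ℤ; +_; -_; _+_; _-_; _*_; _≤_; +≤+; 0ℤ)
  open import Data.Integer.Properties
  open Sums

  Periodic : ℕ → (ℕ → ℤ) → Set
  Periodic p f = ∀ n → f (n ℕ.+ p) ≡ f n

  Periodic-* : ∀ {p f} → Periodic p f → ∀ k → Periodic (p ℕ.* k) f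
  Periodic-* {p} {f} per zero    n = cong f (trans (cong (n ℕ.+_) (ℕ.*-zeroʳ p)) (ℕ.+-identityʳ n))
  Periodic-* {p} {f} per (suc k) n = trans (cong f (lem n p k)) (trans (per (n ℕ.+ p ℕ.* k)) (Periodic-* per k n))
    where
    lem : ∀ n p k → n ℕ.+ p ℕ.* (1 ℕ.+ k) ≡ n ℕ.+ p ℕ.* k ℕ.+ p
    lem = ℕ-solve

  ∑-shift : ∀ n f → ∑ n (λ i → f (suc i)) ≡ ∑ n f - f 0 + f n
  ∑-shift n f = trans (sym (undo (f 0) (∑ n (λ i → f (suc i))))) (trans (cong (_- f 0) (sym (∑-head n f))) (lem (∑ n f) (f n) (f 0)))
    where
    undo : ∀ a b → a + b - a ≡ b
    undo = ℤ-solve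
    lem : ∀ a b c → a + b - c ≡ a - c + b
    lem = ℤ-solve

  ∑-blocks : ∀ p q f → ∑ (p ℕ.* q) f ≡ ∑ q (λ t → ∑ p (λ s → f (p ℕ.* t ℕ.+ s)))
  ∑-blocks p zero    f = cong (λ n → ∑ n f) (ℕ.*-zeroʳ p)
  ∑-blocks p (suc q) f = trans (cong (λ n → ∑ n f) (trans (ℕ.*-suc p q) (ℕ.+-comm p (p ℕ.* q))))
    (trans (∑-split (p ℕ.* q) p f) (cong (_+ ∑ p (λ s → f (p ℕ.* q ℕ.+ s))) (∑-blocks p q f)))

  module _ {p q : ℕ} {f g : ℕ → ℤ} .{{_ : NonZero q}} (p⊥q : Coprime p q)
    (f-per : Periodic p f) (g-per : Periodic q g) (g-sum : ∑ q g ≡ 0ℤ) where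

    private
      -- The sum of g over a progression of difference p takes the place of an explicit Chinese
      -- remainder bijection: it has both periods p and q, hence is constant by Bézout, and its mean
      -- is zero because the sum of g over a period is.
      H : ℕ → ℤ
      H s = ∑ q (λ t → g (s ℕ.+ p ℕ.* t))

      H-p : Periodic p H
      H-p s = begin
        ∑ q (λ t → g (s ℕ.+ p ℕ.+ p ℕ.* t))         ≡⟨ ∑-cong q (λ t _ → cong g (lem s p t)) ⟩
        ∑ q (λ t → g (s ℕ.+ p ℕ.* suc t))           ≡⟨ ∑-shift q (λ t → g (s ℕ.+ p ℕ.* t)) ⟩
        H s - g (s ℕ.+ p ℕ.* 0) + g (s ℕ.+ p ℕ.* q)
          ≡⟨ cong₂ (λ a b → H s - a + b) (cong g (trans (cong (s ℕ.+_) (ℕ.*-zeroʳ p)) (ℕ.+-identityʳ s)))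
               (trans (cong (λ m → g (s ℕ.+ m)) (ℕ.*-comm p q)) (Periodic-* g-per p s)) ⟩
        H s - g s + g s                             ≡⟨ undo (H s) (g s) ⟩
        H s                                         ∎
        where
        open ≡-Reasoning
        lem : ∀ s p t → s ℕ.+ p ℕ.+ p ℕ.* t ≡ s ℕ.+ p ℕ.* (1 ℕ.+ t)
        lem = ℕ-solve
        undo : ∀ a b → a - b + b ≡ a
        undo = ℤ-solve

      H-q : Periodic q H
      H-q s = ∑-cong q (λ t _ → trans (cong g (lem s q (p ℕ.* t))) (g-per (s ℕ.+ p ℕ.* t)))
        where
        lem : ∀ s q a → s ℕ.+ q ℕ.+ a ≡ s ℕ.+ a ℕ.+ q
        lem = ℕ-solve

      H-suc : ∀ s → H (suc s) ≡ H s
      H-suc s = by (coprime-Bézout p⊥q)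
        where
        by : Bézout.Identity 1 p q → H (suc s) ≡ H s
        by (Bézout.+- x y eq) = begin
          H (suc s)                 ≡⟨ sym (Periodic-* H-q y (suc s)) ⟩
          H (suc s ℕ.+ q ℕ.* y)     ≡⟨ cong H (trans (lem s q y) (cong (s ℕ.+_) (trans eq (ℕ.*-comm x p)))) ⟩
          H (s ℕ.+ p ℕ.* x)         ≡⟨ Periodic-* H-p x s ⟩
          H s                       ∎
          where
          open ≡-Reasoning
          lem : ∀ s q y → suc s ℕ.+ q ℕ.* y ≡ s ℕ.+ (1 ℕ.+ y ℕ.* q)
          lem = ℕ-solve
        by (Bézout.-+ x y eq) = begin
          H (suc s)                 ≡⟨ sym (Periodic-* H-p x (suc s)) ⟩
          H (suc s ℕ.+ p ℕ.* x)     ≡⟨ cong H (trans (lem s p x) (cong (s ℕ.+_) (trans eq (ℕ.*-comm y q)))) ⟩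
          H (s ℕ.+ q ℕ.* y)         ≡⟨ Periodic-* H-q y s ⟩
          H s                       ∎
          where
          open ≡-Reasoning
          lem : ∀ s q y → suc s ℕ.+ q ℕ.* y ≡ s ℕ.+ (1 ℕ.+ y ℕ.* q)
          lem = ℕ-solve

      H-const : ∀ s → H s ≡ H 0
      H-const zero    = refl
      H-const (suc s) = trans (H-suc s) (H-const s)

      period-sum : ∀ m → ∑ q (λ s → g (s ℕ.+ m)) ≡ 0ℤ
      period-sum zero    = trans (∑-cong q (λ s _ → cong g (ℕ.+-identityʳ s))) g-sum
      period-sum (suc m) = begin
        ∑ q (λ s → g (s ℕ.+ suc m))               ≡⟨ ∑-cong q (λ s _ → cong g (ℕ.+-suc s m)) ⟩
        ∑ q (λ s → g (suc s ℕ.+ m))               ≡⟨ ∑-shift q (λ s → g (s ℕ.+ m)) ⟩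
        ∑ q (λ s → g (s ℕ.+ m)) - g m + g (q ℕ.+ m)
          ≡⟨ cong₂ (λ a b → a - g m + b) (period-sum m) (trans (cong g (ℕ.+-comm q m)) (g-per m)) ⟩
        0ℤ - g m + g m                            ≡⟨ undo (g m) ⟩
        0ℤ                                        ∎
        where
        open ≡-Reasoning
        undo : ∀ b → 0ℤ - b + b ≡ 0ℤ
        undo = ℤ-solve

      H-zero : ∀ s → H s ≡ 0ℤ
      H-zero s = trans (H-const s) (*-cancelˡ-≡ (+ q) (H 0) 0ℤ {{ℕ-nonZero}} (begin
        + q * H 0                                 ≡⟨ sym (∑-const q (H 0)) ⟩
        ∑ q (λ _ → H 0)                           ≡⟨ ∑-cong q (λ s _ → sym (H-const s)) ⟩
        ∑ q H                                     ≡⟨ ∑-swap q q (λ s t → g (s ℕ.+ p ℕ.* t)) ⟩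
        ∑ q (λ t → ∑ q (λ s → g (s ℕ.+ p ℕ.* t))) ≡⟨ ∑-zero q (λ t _ → period-sum (p ℕ.* t)) ⟩
        0ℤ                                        ≡⟨ sym (*-zeroʳ (+ q)) ⟩
        + q * 0ℤ                                  ∎))
        where
        open ≡-Reasoning
        ℕ-nonZero : ℤ.NonZero (+ q)
        ℕ-nonZero = ℤ.≢-nonZero (λ eq → ℕ.≢-nonZero⁻¹ q (+-injective eq))

    -- Writing n = s + pt with s < p, the factor f depends on s alone, and what remains is the
    -- vanishing inner sum `H s`.
    correlation : ∑ (p ℕ.* q) (λ n → f n * g n) ≡ 0ℤ
    correlation = begin
      ∑ (p ℕ.* q) (λ n → f n * g n)
        ≡⟨ ∑-blocks p q (λ n → f n * g n) ⟩
      ∑ q (λ t → ∑ p (λ s → f (p ℕ.* t ℕ.+ s) * g (p ℕ.* t ℕ.+ s)))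
        ≡⟨ ∑-cong q (λ t _ → ∑-cong p (λ s _ → cong₂ _*_
             (trans (cong f (ℕ.+-comm (p ℕ.* t) s)) (Periodic-* f-per t s)) (cong g (ℕ.+-comm (p ℕ.* t) s)))) ⟩
      ∑ q (λ t → ∑ p (λ s → f s * g (s ℕ.+ p ℕ.* t)))
        ≡⟨ ∑-swap q p (λ t s → f s * g (s ℕ.+ p ℕ.* t)) ⟩
      ∑ p (λ s → ∑ q (λ t → f s * g (s ℕ.+ p ℕ.* t)))
        ≡⟨ ∑-zero p (λ s _ → trans (∑-*ˡ q (f s) (λ t → g (s ℕ.+ p ℕ.* t))) (trans (cong (f s *_) (H-zero s)) (*-zeroʳ (f s)))) ⟩
      0ℤ ∎
      where open ≡-Reasoning

  -- Full periods contribute nothing, so only one incomplete period, of length below T, has to be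
  -- estimated.
  periodic-∑-≤ : ∀ {T F} .{{_ : NonZero T}} N B → Periodic T F → ∑ T F ≡ 0ℤ → (∀ n → F n ≤ + B) → ∑ N F ≤ + (T ℕ.* B)
  periodic-∑-≤ {T} {F} N B per sum≡0 F≤B = begin
    ∑ N F                                     ≡⟨ cong (λ m → ∑ m F) (trans (m≡m%n+[m/n]*n N T) (trans (ℕ.+-comm (N % T) _) (cong (ℕ._+ N % T) (ℕ.*-comm (N / T) T)))) ⟩
    ∑ (T ℕ.* (N / T) ℕ.+ N % T) F             ≡⟨ ∑-split (T ℕ.* (N / T)) (N % T) F ⟩
    ∑ (T ℕ.* (N / T)) F + ∑ (N % T) rest      ≡⟨ cong (_+ ∑ (N % T) rest) full ⟩
    0ℤ + ∑ (N % T) rest                       ≡⟨ +-identityˡ (∑ (N % T) rest) ⟩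
    ∑ (N % T) rest                            ≤⟨ ∑-mono (N % T) (λ i _ → F≤B (T ℕ.* (N / T) ℕ.+ i)) ⟩
    ∑ (N % T) (λ _ → + B)                     ≡⟨ trans (∑-const (N % T) (+ B)) (sym (pos-* (N % T) B)) ⟩
    + (N % T ℕ.* B)                           ≤⟨ +≤+ (ℕ.*-monoˡ-≤ B (ℕ.<⇒≤ (m%n<n N T))) ⟩
    + (T ℕ.* B)                               ∎
    where
    open ≤-Reasoning
    rest : ℕ → ℤ
    rest i = F (T ℕ.* (N / T) ℕ.+ i)
    full : ∑ (T ℕ.* (N / T)) F ≡ 0ℤ
    full = trans (∑-blocks T (N / T) F) (∑-zero (N / T) (λ t _ → trans
      (∑-cong T (λ s _ → trans (cong F (ℕ.+-comm (T ℕ.* t) s)) (Periodic-* per t s))) sum≡0))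

-- The count of small inverses modulo q and its centred version.

module Variance where

  open import Data.Nat.Divisibility
  open import Data.Nat.Primality using (Prime; prime?; prime⇒nonZero; euclidsLemma)
  open import Data.Integer as ℤ using (ℤ; +_; -_; _+_; _-_; _*_; _≤_; +≤+; 0ℤ; 1ℤ; ∣_∣)
  open import Data.Integer.Properties
  open Sums
  open Correlation
  open SmallCyclotomics using (prime⇒coprime′; prime∣prime⇒≡)

  *-mono-≤ : ∀ {a b c d} → 0ℤ ≤ a → a ≤ b → 0ℤ ≤ c → c ≤ d → a * c ≤ b * d
  *-mono-≤ {a} {b} {c} {d} 0≤a a≤b 0≤c c≤d = ≤-trans
    (*-monoʳ-≤-nonNeg c {{ℤ.nonNegative 0≤c}} a≤b)
    (*-monoˡ-≤-nonNeg b {{ℤ.nonNegative (≤-trans 0≤a a≤b)}} c≤d)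

  *-nonneg : ∀ {a b} → 0ℤ ≤ a → 0ℤ ≤ b → 0ℤ ≤ a * b
  *-nonneg {a} {b} 0≤a 0≤b = subst (_≤ a * b) (*-zeroˡ b) (*-monoʳ-≤-nonNeg b {{ℤ.nonNegative 0≤b}} 0≤a)

  *-pos : ∀ {a b} → 0ℤ ℤ.< a → 0ℤ ℤ.< b → 0ℤ ℤ.< a * b
  *-pos {a} {b} 0<a 0<b = subst (ℤ._< a * b) (*-zeroˡ b) (*-monoʳ-<-pos b {{ℤ.positive 0<b}} 0<a)

  square-nonneg : ∀ a → 0ℤ ≤ a * a
  square-nonneg (+ n)      = subst (0ℤ ≤_) (pos-* n n) (+≤+ z≤n)
  square-nonneg (ℤ.-[1+ n ]) = +≤+ z≤n

  -- For c = q - 1 or c = 1 this counts the u in [1, U] with 3un ≡ 1 or 3un ≡ -1 modulo q. For q ≥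
  -- 8U such u satisfy 6u < q, as flatness demands.
  h : ℕ → ℕ → ℕ → ℕ → ℤ
  h U q c n = ∑ U (λ u → ⟦ q ∣? 3 ℕ.* suc u ℕ.* n ℕ.+ c ⟧)

  isP : ℕ → ℤ
  isP q = ⟦ prime? q ⟧

  h-periodic : ∀ U q c → Periodic q (h U q c)
  h-periodic U q c n = ∑-cong U (λ u _ → ⟦⟧-cong (q ∣? 3 ℕ.* suc u ℕ.* (n ℕ.+ q) ℕ.+ c) (q ∣? 3 ℕ.* suc u ℕ.* n ℕ.+ c)
      (λ d → ∣m+n∣m⇒∣n (subst (q ∣_) (lem u n q c) d) (m∣m*n (3 ℕ.* suc u)))
      (λ d → subst (q ∣_) (sym (lem u n q c)) (∣m∣n⇒∣m+n (m∣m*n (3 ℕ.* suc u)) d)))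
    where
    lem : ∀ u n q c → 3 ℕ.* (1 ℕ.+ u) ℕ.* (n ℕ.+ q) ℕ.+ c ≡ q ℕ.* (3 ℕ.* (1 ℕ.+ u)) ℕ.+ (3 ℕ.* (1 ℕ.+ u) ℕ.* n ℕ.+ c)
    lem = ℕ-solve

  h-nonneg : ∀ U q c n → 0ℤ ≤ h U q c n
  h-nonneg U q c n = ∑-nonneg U (λ u _ → 0≤⟦⟧ (q ∣? 3 ℕ.* suc u ℕ.* n ℕ.+ c))

  module _ {U q : ℕ} (pq : Prime q) (3<q : 3 ℕ.< q) (U<q : U ℕ.< q) where

    private
      instance
        q≢0 : NonZero q
        q≢0 = prime⇒nonZero pq

      q∤3 : ¬ q ∣ 3
      q∤3 q∣3 = ℕ.<⇒≱ 3<q (∣⇒≤ q∣3)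

    h-sum : ∀ c → ∑ q (h U q c) ≡ + U
    h-sum c = trans (∑-swap q U (λ n u → ⟦ q ∣? 3 ℕ.* suc u ℕ.* n ℕ.+ c ⟧))
      (trans (∑-cong U (λ u u<U → ∑-linear-congruence (3 ℕ.* suc u) c q (prime⇒coprime′ pq (q∤3u u u<U))))
        (trans (∑-const U 1ℤ) (*-identityʳ (+ U))))
      where
      q∤3u : ∀ u → u ℕ.< U → ¬ q ∣ 3 ℕ.* suc u
      q∤3u u u<U q∣ with euclidsLemma 3 (suc u) pq q∣
      ... | inj₁ q∣3 = q∤3 q∣3
      ... | inj₂ q∣u = ℕ.<⇒≱ (ℕ.≤-<-trans u<U U<q) (∣⇒≤ q∣u)

    -- As q ∤ c, a hit forces n to be invertible modulo q, and then u is determined modulo q; it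
    -- lies in [1, U] with U < q.
    h≤1 : ∀ c → ¬ q ∣ c → ∀ n → h U q c n ≤ 1ℤ
    h≤1 c q∤c n = ∑-exclusive U (λ u _ → ⟦⟧≤1 (q ∣? 3 ℕ.* suc u ℕ.* n ℕ.+ c)) λ u u′ u<U u′<U u≢0 u′≢0 →
      ℕ.suc-injective (congruence-unique {3 ℕ.* n} {c} (prime⇒coprime′ pq (q∤3n u u≢0))
        (ℕ.≤-<-trans u<U U<q) (ℕ.≤-<-trans u′<U U<q) (divisible u u≢0) (divisible u′ u′≢0))
      where
      lem : ∀ u n → 3 ℕ.* (1 ℕ.+ u) ℕ.* n ≡ 3 ℕ.* n ℕ.* (1 ℕ.+ u)
      lem = ℕ-solve
      divisible : ∀ u → ⟦ q ∣? 3 ℕ.* suc u ℕ.* n ℕ.+ c ⟧ ≢ 0ℤ → q ∣ 3 ℕ.* n ℕ.* suc u ℕ.+ c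
      divisible u ≢0 = subst (λ m → q ∣ m ℕ.+ c) (lem u n) (⟦⟧-≢0 (q ∣? 3 ℕ.* suc u ℕ.* n ℕ.+ c) ≢0)
      q∤3n : ∀ u → ⟦ q ∣? 3 ℕ.* suc u ℕ.* n ℕ.+ c ⟧ ≢ 0ℤ → ¬ q ∣ 3 ℕ.* n
      q∤3n u ≢0 q∣3n = q∤c (∣m+n∣m⇒∣n (divisible u ≢0) (∣m⇒∣m*n (suc u) q∣3n))

  -- The mean of h over a period is U/q; the factor q keeps the centred function integral.
  g : ℕ → ℕ → ℕ → ℕ → ℤ
  g U q c n = + q * h U q c n - + U

  g-periodic : ∀ U q c → Periodic q (g U q c)
  g-periodic U q c n = cong (λ w → + q * w - + U) (h-periodic U q c n)

  g-sum : ∀ {U q} → Prime q → 3 ℕ.< q → U ℕ.< q → ∀ c → ∑ q (g U q c) ≡ 0ℤ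
  g-sum {U} {q} pq 3<q U<q c = begin
    ∑ q (λ n → + q * h U q c n - + U)              ≡⟨ ∑-+ q (λ n → + q * h U q c n) (λ _ → - + U) ⟩
    ∑ q (λ n → + q * h U q c n) + ∑ q (λ _ → - + U)
      ≡⟨ cong₂ _+_ (trans (∑-*ˡ q (+ q) (h U q c)) (cong (+ q *_) (h-sum pq 3<q U<q c))) (∑-const q (- + U)) ⟩
    + q * + U + + q * - + U                        ≡⟨ lem (+ q) (+ U) ⟩
    0ℤ                                             ∎
    where
    open ≡-Reasoning
    lem : ∀ a b → a * b + a * - b ≡ 0ℤ
    lem = ℤ-solve

  -- From -U ≤ g ≤ q - U.
  g-product : ∀ {U q q′ K c c′} → Prime q → Prime q′ → 3 ℕ.< q → 3 ℕ.< q′ → U ℕ.< q → U ℕ.< q′ →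
    q ℕ.≤ K → q′ ℕ.≤ K → ¬ q ∣ c → ¬ q′ ∣ c′ → ∀ n m → g U q c n * g U q′ c′ m ≤ + (K ℕ.* K)
  g-product {U} {q} {q′} {K} {c} {c′} pq pq′ 3<q 3<q′ U<q U<q′ q≤K q′≤K q∤c q′∤c′ n m =
    subst (g U q c n * g U q′ c′ m ≤_) (sym (pos-* K K))
      (product-≤ (upper pq 3<q U<q q≤K q∤c n) (lower U<q q≤K n) (upper pq′ 3<q′ U<q′ q′≤K q′∤c′ m) (lower U<q′ q′≤K m))
    where
    upper : ∀ {q c} → Prime q → 3 ℕ.< q → U ℕ.< q → q ℕ.≤ K → ¬ q ∣ c → ∀ n → g U q c n ≤ + K
    upper {q} {c} pq 3<q U<q q≤K q∤c n = begin
      + q * h U q c n - + U    ≤⟨ +-monoˡ-≤ (- + U) (*-monoˡ-≤-nonNeg (+ q) (h≤1 pq 3<q U<q c q∤c n)) ⟩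
      + q * 1ℤ - + U           ≤⟨ i≤j⇒i-k≤j (+ U) (≤-reflexive (*-identityʳ (+ q))) ⟩
      + q                      ≤⟨ +≤+ q≤K ⟩
      + K                      ∎
      where
      open ≤-Reasoning
    lower : ∀ {q c} → U ℕ.< q → q ℕ.≤ K → ∀ n → - + K ≤ g U q c n
    lower {q} {c} U<q q≤K n = begin
      - + K                    ≤⟨ neg-mono-≤ (+≤+ (ℕ.≤-trans (ℕ.<⇒≤ U<q) q≤K)) ⟩
      - + U                    ≡⟨ sym (+-identityˡ (- + U)) ⟩
      0ℤ - + U                 ≤⟨ +-monoˡ-≤ (- + U) (*-nonneg {+ q} (+≤+ z≤n) (h-nonneg U q c n)) ⟩
      + q * h U q c n - + U    ∎
      where open ≤-Reasoning
    product-≤ : ∀ {a b k} → a ≤ k → - k ≤ a → b ≤ k → - k ≤ b → a * b ≤ k * k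
    product-≤ {a} {b} {k} a≤k -k≤a b≤k -k≤b = 0≤i-j⇒j≤i (2*-cancel (k * k - a * b) (subst (0ℤ ≤_) (lem k a b)
      (+-mono-≤ (*-nonneg (i≤j⇒0≤j-i a≤k) (plus -k≤b)) (*-nonneg (plus -k≤a) (i≤j⇒0≤j-i b≤k)))))
      where
      lem : ∀ k a b → (k - a) * (b + k) + (a + k) * (k - b) ≡ (k * k - a * b) + (k * k - a * b)
      lem = ℤ-solve
      plus : ∀ {a} → - k ≤ a → 0ℤ ≤ a + k
      plus {a} -k≤a = subst (_≤ a + k) (+-inverseˡ k) (+-monoˡ-≤ k -k≤a)
      2*-cancel : ∀ a → 0ℤ ≤ a + a → 0ℤ ≤ a
      2*-cancel (+ n)        _  = +≤+ z≤n
      2*-cancel (ℤ.-[1+ n ]) ()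

-- The second moment over one dyadic block of primes q.

module Block where

  open import Data.Nat.DivMod using (_%_; m%n<n)
  open import Data.Nat.Divisibility
  open import Data.Nat.Coprimality using (Coprime)
  open import Data.Nat.Primality using (Prime; prime?; prime⇒nonZero; prime⇒nonTrivial)
  open import Data.Integer as ℤ using (ℤ; +_; -_; _+_; _-_; _*_; _≤_; +≤+; 0ℤ; 1ℤ)
  open import Data.Integer.Properties
  open import Relation.Nullary.Decidable using (from-yes)
  open Sums
  open Correlation
  open Variance
  open SmallCyclotomics using (prime⇒coprime′; prime∣prime⇒≡; prime∤1)

  -- The offset c for which 3un + c ≡ 0 modulo q says 3un ≡ ±1, with the sign making ±qn ≡ 1 modulo 3.
  off : ℕ → ℕ → ℕ
  off q ρ with q ℕ.* ρ % 3 ℕ.≟ 1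
  ... | yes _ = ℕ.pred q
  ... | no  _ = 1

  ∤off : ∀ {q} → Prime q → ∀ ρ → ¬ q ∣ off q ρ
  ∤off {q} pq ρ with q ℕ.* ρ % 3 ℕ.≟ 1
  ... | no  _ = prime∤1 pq
  ... | yes _ = λ q∣ → ℕ.<⇒≱ (ℕ.≤-reflexive (ℕ.suc-pred q {{prime⇒nonZero pq}})) (∣⇒≤ {{nz}} q∣)
    where
    nz : NonZero (ℕ.pred q)
    nz = ℕ.>-nonZero (ℕ.≤-pred (ℕ.≤-trans (ℕ.nonTrivial⇒n>1 q {{prime⇒nonTrivial pq}}) (ℕ.≤-reflexive (sym (ℕ.suc-pred q {{prime⇒nonZero pq}})))))

  module _ (U N : ℕ) (1≤U : 1 ℕ.≤ U) where

    Y K : ℕ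
    Y = 8 ℕ.* U
    K = 2 ℕ.* Y

    q : ℕ → ℕ
    q t = Y ℕ.+ t

    p : ℕ → ℤ
    p t = isP (q t)

    a : ℤ
    a = ∑ Y p

    a-nonneg : 0ℤ ≤ a
    a-nonneg = ∑-nonneg Y (λ t _ → 0≤⟦⟧ (prime? (q t)))

    private
      8≤Y : 8 ℕ.≤ Y
      8≤Y = ℕ.*-monoʳ-≤ 8 1≤U

      3<q : ∀ t → 3 ℕ.< q t
      3<q t = ℕ.≤-trans (ℕ.≤-trans (s≤s (s≤s (s≤s (s≤s z≤n)))) 8≤Y) (ℕ.m≤m+n Y t)

      U<q : ∀ t → U ℕ.< q t
      U<q t = ℕ.≤-trans (ℕ.≤-trans (ℕ.≤-trans (ℕ.m<m+n U 1≤U) (ℕ.≤-reflexive (lem U))) (ℕ.m≤m+n (2 ℕ.* U) (6 ℕ.* U)))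
        (ℕ.≤-trans (ℕ.≤-reflexive (lem′ U)) (ℕ.m≤m+n Y t))
        where
        lem : ∀ U → U ℕ.+ U ≡ 2 ℕ.* U
        lem = ℕ-solve
        lem′ : ∀ U → 2 ℕ.* U ℕ.+ 6 ℕ.* U ≡ 8 ℕ.* U
        lem′ = ℕ-solve

      q≤K : ∀ t → t ℕ.< Y → q t ℕ.≤ K
      q≤K t t<Y = ℕ.≤-trans (ℕ.+-monoʳ-≤ Y (ℕ.<⇒≤ t<Y)) (ℕ.≤-reflexive (lem Y))
        where
        lem : ∀ Y → Y ℕ.+ Y ≡ 2 ℕ.* Y
        lem = ℕ-solve

    module _ (c : ℕ → ℕ) where

      G : ℕ → ℤ
      G n = ∑ Y (λ t → p t * g U (q t) (c (q t)) n)

      w : ℕ → ℤ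
      w n = ∑ Y (λ t → p t * (+ q t * h U (q t) (c (q t)) n))

      G-w : ∀ n → G n ≡ w n - a * + U
      G-w n = begin
        G n
          ≡⟨ ∑-cong Y (λ t _ → *-distribˡ-+ (p t) (+ q t * h U (q t) (c (q t)) n) (- + U)) ⟩
        ∑ Y (λ t → p t * (+ q t * h U (q t) (c (q t)) n) + p t * - + U)
          ≡⟨ ∑-+ Y (λ t → p t * (+ q t * h U (q t) (c (q t)) n)) (λ t → p t * - + U) ⟩
        w n + ∑ Y (λ t → p t * - + U)
          ≡⟨ cong (λ z → w n + z) (trans (∑-*ʳ Y (- + U) p) (sym (neg-distribʳ-* a (+ U)))) ⟩
        w n - a * + U ∎
        where open ≡-Reasoning

      hits : ℕ → ℤ
      hits n = ∑ Y (λ t → p t * h U (q t) (c (q t)) n)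

      w≤K*hits : ∀ n → w n ≤ + K * hits n
      w≤K*hits n = ≤-trans (∑-mono Y (λ t t<Y → ≤-trans
          (*-monoˡ-≤-nonNeg (p t) {{ℤ.nonNegative (0≤⟦⟧ (prime? (q t)))}}
            (*-monoʳ-≤-nonNeg (h U (q t) (c (q t)) n) {{ℤ.nonNegative (h-nonneg U (q t) (c (q t)) n)}} (+≤+ (q≤K t t<Y))))
          (≤-reflexive (lem (p t) (+ K) (h U (q t) (c (q t)) n)))))
        (≤-reflexive (∑-*ˡ Y (+ K) (λ t → p t * h U (q t) (c (q t)) n)))
        where
        lem : ∀ a b c → a * (b * c) ≡ b * (a * c)
        lem = ℤ-solve

      -- w² ≥ 0, so that 2μw - μ² ≥ -(w - μ)² for the mean μ = aU.
      hits-≥ : ∀ n → - (G n * G n) ≤ + 2 * (a * + U) * (+ K * hits n) - a * + U * (a * + U)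
      hits-≥ n = begin
        - (G n * G n)                                      ≡⟨ cong (λ z → - (z * z)) (G-w n) ⟩
        - ((w n - μ) * (w n - μ))                          ≡⟨ sym (+-identityˡ _) ⟩
        0ℤ - (w n - μ) * (w n - μ)                         ≤⟨ +-monoˡ-≤ (- ((w n - μ) * (w n - μ))) (square-nonneg (w n)) ⟩
        w n * w n - (w n - μ) * (w n - μ)                  ≡⟨ lem (w n) μ ⟩
        + 2 * μ * w n - μ * μ                              ≤⟨ +-monoˡ-≤ (- (μ * μ)) (*-monoˡ-≤-nonNeg (+ 2 * μ) {{ℤ.nonNegative 0≤2μ}} (w≤K*hits n)) ⟩
        + 2 * μ * (+ K * hits n) - μ * μ                   ∎
        where
        open ≤-Reasoning
        μ = a * + U
        0≤2μ : 0ℤ ≤ + 2 * μ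
        0≤2μ = *-nonneg {+ 2} {μ} (+≤+ z≤n) (*-nonneg {a} {+ U} a-nonneg (+≤+ z≤n))
        lem : ∀ w μ → w * w - (w - μ) * (w - μ) ≡ + 2 * μ * w - μ * μ
        lem = ℤ-solve

    module _ (c : ℕ → ℕ) (q∤c : ∀ t → Prime (q t) → ¬ q t ∣ c (q t)) where

      private
        γ : ℕ → ℕ → ℤ
        γ t n = g U (q t) (c (q t)) n

        pair : ℕ → ℕ → ℤ
        pair t t′ = ∑ N (λ n → γ t n * γ t′ n)

        K² K⁴ NK² : ℤ
        K²  = + (K ℕ.* K)
        K⁴  = + (K ℕ.* K ℕ.* (K ℕ.* K))
        NK² = + N * K²

        γγ≤ : ∀ {t t′} → t ℕ.< Y → t′ ℕ.< Y → Prime (q t) → Prime (q t′) → ∀ n → γ t n * γ t′ n ≤ K²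
        γγ≤ {t} {t′} t<Y t′<Y pt pt′ n = g-product {U} {q t} {q t′} {K} pt pt′ (3<q t) (3<q t′) (U<q t) (U<q t′)
          (q≤K t t<Y) (q≤K t′ t′<Y) (q∤c t pt) (q∤c t′ pt′) n n

        pair-diagonal : ∀ {t} → t ℕ.< Y → Prime (q t) → pair t t ≤ NK²
        pair-diagonal {t} t<Y pt = ≤-trans (∑-mono N (λ n _ → γγ≤ t<Y t<Y pt pt n)) (≤-reflexive (∑-const N K²))

        pair-distinct : ∀ {t t′} → t ℕ.< Y → t′ ℕ.< Y → Prime (q t) → Prime (q t′) → t ≢ t′ → pair t t′ ≤ K⁴
        pair-distinct {t} {t′} t<Y t′<Y pt pt′ t≢t′ = ≤-trans
          (periodic-∑-≤ {q t ℕ.* q t′} {λ n → γ t n * γ t′ n} {{ℕ.m*n≢0 (q t) (q t′) {{prime⇒nonZero pt}} {{prime⇒nonZero pt′}}}}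
            N (K ℕ.* K) periodic
            (correlation {q t} {q t′} {γ t} {γ t′} {{prime⇒nonZero pt′}} coprime
              (g-periodic U (q t) (c (q t))) (g-periodic U (q t′) (c (q t′))) (g-sum pt′ (3<q t′) (U<q t′) (c (q t′))))
            (γγ≤ t<Y t′<Y pt pt′))
          (+≤+ (ℕ.*-monoˡ-≤ (K ℕ.* K) (ℕ.*-mono-≤ (q≤K t t<Y) (q≤K t′ t′<Y))))
          where
          coprime : Coprime (q t) (q t′)
          coprime = prime⇒coprime′ pt′ (λ d → t≢t′ (sym (ℕ.+-cancelˡ-≡ Y t′ t (prime∣prime⇒≡ pt′ pt d))))
          periodic : Periodic (q t ℕ.* q t′) (λ n → γ t n * γ t′ n)
          periodic n = cong₂ _*_ (Periodic-* {q t} {γ t} (g-periodic U (q t) (c (q t))) (q t′) n)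
            (trans (cong (λ m → γ t′ (n ℕ.+ m)) (ℕ.*-comm (q t) (q t′))) (Periodic-* {q t′} {γ t′} (g-periodic U (q t′) (c (q t′))) (q t) n))

        0≤K⁴ : 0ℤ ≤ K⁴
        0≤K⁴ = +≤+ z≤n

        0≤NK² : 0ℤ ≤ NK²
        0≤NK² = *-nonneg {+ N} {K²} (+≤+ z≤n) (+≤+ z≤n)

        weighted : ∀ {t t′} → t ℕ.< Y → t′ ℕ.< Y → (d : Dec (Prime (q t))) (d′ : Dec (Prime (q t′))) (e : Dec (t ≡ t′)) →
          ⟦ d ⟧ * ⟦ d′ ⟧ * pair t t′ ≤ ⟦ d ⟧ * (⟦ e ⟧ * NK² + ⟦ d′ ⟧ * K⁴)
        weighted {t} {t′} t<Y t′<Y (no _) d′ e = ≤-reflexive (lem ⟦ d′ ⟧ (pair t t′) (⟦ e ⟧ * NK² + ⟦ d′ ⟧ * K⁴))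
          where
          lem : ∀ a b c → 0ℤ * a * b ≡ 0ℤ * c
          lem = ℤ-solve
        weighted {t} {t′} t<Y t′<Y (yes pt) (no _) e = begin
          1ℤ * 0ℤ * pair t t′              ≡⟨ lem (pair t t′) ⟩
          0ℤ                               ≤⟨ *-nonneg {⟦ e ⟧} {NK²} (0≤⟦⟧ e) 0≤NK² ⟩
          ⟦ e ⟧ * NK²                      ≡⟨ lem′ (⟦ e ⟧ * NK²) K⁴ ⟩
          1ℤ * (⟦ e ⟧ * NK² + 0ℤ * K⁴)     ∎
          where
          open ≤-Reasoning
          lem : ∀ a → 1ℤ * 0ℤ * a ≡ 0ℤ
          lem = ℤ-solve
          lem′ : ∀ a b → a ≡ 1ℤ * (a + 0ℤ * b)
          lem′ = ℤ-solve
        weighted {t} {t′} t<Y t′<Y (yes pt) (yes pt′) (yes refl) = begin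
          1ℤ * 1ℤ * pair t t               ≡⟨ *-identityˡ (pair t t) ⟩
          pair t t                         ≤⟨ pair-diagonal t<Y pt ⟩
          NK²                              ≡⟨ sym (+-identityʳ NK²) ⟩
          NK² + 0ℤ                         ≤⟨ +-monoʳ-≤ NK² 0≤K⁴ ⟩
          NK² + K⁴                         ≡⟨ lem NK² K⁴ ⟩
          1ℤ * (1ℤ * NK² + 1ℤ * K⁴)        ∎
          where
          open ≤-Reasoning
          lem : ∀ a b → a + b ≡ 1ℤ * (1ℤ * a + 1ℤ * b)
          lem = ℤ-solve
        weighted {t} {t′} t<Y t′<Y (yes pt) (yes pt′) (no t≢t′) = begin
          1ℤ * 1ℤ * pair t t′              ≡⟨ *-identityˡ (pair t t′) ⟩
          pair t t′                        ≤⟨ pair-distinct t<Y t′<Y pt pt′ t≢t′ ⟩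
          K⁴                               ≡⟨ lem NK² K⁴ ⟩
          1ℤ * (0ℤ * NK² + 1ℤ * K⁴)        ∎
          where
          open ≤-Reasoning
          lem : ∀ a b → b ≡ 1ℤ * (0ℤ * a + 1ℤ * b)
          lem = ℤ-solve

        expand : ∑ N (λ n → G c n * G c n) ≡ ∑ Y (λ t → ∑ Y (λ t′ → p t * p t′ * pair t t′))
        expand = begin
          ∑ N (λ n → G c n * G c n)
            ≡⟨ ∑-cong N (λ n _ → trans (sym (∑-*ʳ Y (G c n) (λ t → p t * γ t n)))
                 (∑-cong Y (λ t _ → sym (∑-*ˡ Y (p t * γ t n) (λ t′ → p t′ * γ t′ n))))) ⟩
          ∑ N (λ n → ∑ Y (λ t → ∑ Y (λ t′ → p t * γ t n * (p t′ * γ t′ n))))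
            ≡⟨ ∑-swap N Y (λ n t → ∑ Y (λ t′ → p t * γ t n * (p t′ * γ t′ n))) ⟩
          ∑ Y (λ t → ∑ N (λ n → ∑ Y (λ t′ → p t * γ t n * (p t′ * γ t′ n))))
            ≡⟨ ∑-cong Y (λ t _ → trans (∑-swap N Y (λ n t′ → p t * γ t n * (p t′ * γ t′ n)))
                 (∑-cong Y (λ t′ _ → trans (∑-cong N (λ n _ → lem (p t) (γ t n) (p t′) (γ t′ n)))
                   (∑-*ˡ N (p t * p t′) (λ n → γ t n * γ t′ n))))) ⟩
          ∑ Y (λ t → ∑ Y (λ t′ → p t * p t′ * pair t t′)) ∎
          where
          open ≡-Reasoning
          lem : ∀ a b c d → a * b * (c * d) ≡ a * c * (b * d)
          lem = ℤ-solve

      -- After expanding the square, the diagonal gives at most N K² for each of the a primes. By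
      -- `correlation`, each off-diagonal pair leaves only an incomplete period of length at most
      -- K², with terms at most K².
      variance : ∑ N (λ n → G c n * G c n) ≤ a * (NK² + a * K⁴)
      variance = begin
        ∑ N (λ n → G c n * G c n)
          ≡⟨ expand ⟩
        ∑ Y (λ t → ∑ Y (λ t′ → p t * p t′ * pair t t′))
          ≤⟨ ∑-mono Y (λ t t<Y → ∑-mono Y (λ t′ t′<Y → weighted t<Y t′<Y (prime? (q t)) (prime? (q t′)) (t ℕ.≟ t′))) ⟩
        ∑ Y (λ t → ∑ Y (λ t′ → p t * (⟦ t ℕ.≟ t′ ⟧ * NK² + p t′ * K⁴)))
          ≡⟨ ∑-cong Y (λ t t<Y → trans (∑-*ˡ Y (p t) (λ t′ → ⟦ t ℕ.≟ t′ ⟧ * NK² + p t′ * K⁴)) (cong (p t *_) (inner t t<Y))) ⟩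
        ∑ Y (λ t → p t * (NK² + a * K⁴))
          ≡⟨ ∑-*ʳ Y (NK² + a * K⁴) p ⟩
        a * (NK² + a * K⁴) ∎
        where
        open ≤-Reasoning
        inner : ∀ t → t ℕ.< Y → ∑ Y (λ t′ → ⟦ t ℕ.≟ t′ ⟧ * NK² + p t′ * K⁴) ≡ NK² + a * K⁴
        inner t t<Y = trans (∑-+ Y (λ t′ → ⟦ t ℕ.≟ t′ ⟧ * NK²) (λ t′ → p t′ * K⁴)) (cong₂ _+_
          (trans (∑-single Y t t<Y (λ t′ _ t′≢t → trans (cong (_* NK²) (⟦⟧-no (t ℕ.≟ t′) (λ eq → t′≢t (sym eq)))) (*-zeroˡ NK²)))
            (trans (cong (_* NK²) (⟦⟧-yes (t ℕ.≟ t) refl)) (*-identityˡ NK²)))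
          (∑-*ʳ Y K⁴ p))

    -- The cut-off at K = 2Y puts each such prime above all q of the block, so q < r is guaranteed.
    r : ℕ → ℤ
    r n = isP n * ⟦ K ℕ.≤? n ⟧

    hitsAt : ℕ → ℕ → ℤ
    hitsAt ρ = hits (λ q → off q ρ)

    Z C : ℤ
    Z = ∑ N r
    C = ∑ N (λ n → r n * hitsAt (n % 3) n)

    r-nonneg : ∀ n → 0ℤ ≤ r n
    r-nonneg n = *-nonneg {isP n} (0≤⟦⟧ (prime? n)) (0≤⟦⟧ (K ℕ.≤? n))

    C-nonneg : 0ℤ ≤ C
    C-nonneg = ∑-nonneg N (λ n _ → *-nonneg {r n} {hitsAt (n % 3) n} (r-nonneg n) (∑-nonneg Y (λ t _ →
      *-nonneg {p t} (0≤⟦⟧ (prime? (q t))) (h-nonneg U (q t) (off (q t) (n % 3)) n))))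

    private
      G² : ℕ → ℕ → ℤ
      G² ρ n = G (λ q → off q ρ) n * G (λ q → off q ρ) n

      μ : ℤ
      μ = a * + U

      excess : ℕ → ℕ → ℤ
      excess ρ n = + 2 * μ * (+ K * hitsAt ρ n) - μ * μ

      drop-right : ∀ a b → 0ℤ ≤ b → - a + - b ≤ - a
      drop-right a b 0≤b = ≤-trans (+-monoʳ-≤ (- a) (neg-mono-≤ 0≤b)) (≤-reflexive (+-identityʳ (- a)))

      -- Subtracting the squares for both classes gives a lower bound that no longer depends on n
      -- modulo 3, so each square can be summed over all n < N with a fixed offset.
      excess-≥ : ∀ n ρ → ρ ℕ.< 3 → ρ ≢ 0 → - G² 1 n + - G² 2 n ≤ excess ρ n
      excess-≥ n zero _ ρ≢0 = ⊥-elim (ρ≢0 refl)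
      excess-≥ n 1 _ _ = ≤-trans (drop-right (G² 1 n) (G² 2 n) (square-nonneg (G (λ q → off q 2) n))) (hits-≥ (λ q → off q 1) n)
      excess-≥ n 2 _ _ = ≤-trans (≤-trans (≤-reflexive (+-comm (- G² 1 n) (- G² 2 n)))
        (drop-right (G² 2 n) (G² 1 n) (square-nonneg (G (λ q → off q 1) n)))) (hits-≥ (λ q → off q 2) n)
      excess-≥ n (suc (suc (suc _))) (s≤s (s≤s (s≤s ()))) _

      -- Unless n is a prime at least K, the right side is 0 and the left side at most 0. For such
      -- primes K > 3 excludes the residue class 0.
      pointwise : ∀ n (d : Dec (Prime n)) (e : Dec (K ℕ.≤ n)) → - G² 1 n + - G² 2 n ≤ ⟦ d ⟧ * ⟦ e ⟧ * excess (n % 3) n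
      pointwise n (yes pn) (yes K≤n) = ≤-trans
        (excess-≥ n (n % 3) (m%n<n n 3) (λ eq → ℕ.<⇒≱ 3<n (ℕ.≤-reflexive (sym (prime∣prime⇒≡ prime[3]′ pn (m%n≡0⇒n∣m n 3 eq))))))
        (≤-reflexive (sym (*-identityˡ (excess (n % 3) n))))
        where
        3<n : 3 ℕ.< n
        3<n = ℕ.≤-trans (ℕ.≤-trans (3<q 0) (ℕ.≤-trans (ℕ.≤-reflexive (ℕ.+-identityʳ Y)) (ℕ.m≤m+n Y (Y ℕ.+ 0)))) K≤n
        prime[3]′ : Prime 3
        prime[3]′ = from-yes (prime? 3)
      pointwise n (no _) e = ≤-trans (both n) (≤-reflexive (lem ⟦ e ⟧ (excess (n % 3) n)))
        where
        lem : ∀ a b → 0ℤ ≡ 0ℤ * a * b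
        lem = ℤ-solve
        both : ∀ n → - G² 1 n + - G² 2 n ≤ 0ℤ
        both n = +-mono-≤ (neg-mono-≤ (square-nonneg (G (λ q → off q 1) n))) (neg-mono-≤ (square-nonneg (G (λ q → off q 2) n)))
      pointwise n (yes _) (no _) = ≤-trans
        (+-mono-≤ (neg-mono-≤ (square-nonneg (G (λ q → off q 1) n))) (neg-mono-≤ (square-nonneg (G (λ q → off q 2) n))))
        (≤-reflexive (lem (excess (n % 3) n)))
        where
        lem : ∀ b → 0ℤ ≡ 1ℤ * 0ℤ * b
        lem = ℤ-solve

      ∑-neg : ∀ n f → ∑ n (λ i → - f i) ≡ - ∑ n f
      ∑-neg zero    f = refl
      ∑-neg (suc n) f = trans (cong (_+ - f n) (∑-neg n f)) (sym (neg-distrib-+ (∑ n f) (f n)))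

      E : ℤ
      E = a * (+ N * + (K ℕ.* K) + a * + (K ℕ.* K ℕ.* (K ℕ.* K)))

      summed : - E + - E ≤ + 2 * μ * + K * C - μ * μ * Z
      summed = begin
        - E + - E
          ≤⟨ +-mono-≤ (neg-mono-≤ (variance (λ q → off q 1) (λ t pt → ∤off pt 1))) (neg-mono-≤ (variance (λ q → off q 2) (λ t pt → ∤off pt 2))) ⟩
        - ∑ N (G² 1) + - ∑ N (G² 2)
          ≡⟨ sym (trans (∑-+ N (λ n → - G² 1 n) (λ n → - G² 2 n)) (cong₂ _+_ (∑-neg N (G² 1)) (∑-neg N (G² 2)))) ⟩
        ∑ N (λ n → - G² 1 n + - G² 2 n)
          ≤⟨ ∑-mono N (λ n _ → pointwise n (prime? n) (K ℕ.≤? n)) ⟩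
        ∑ N (λ n → r n * excess (n % 3) n)
          ≡⟨ ∑-cong N (λ n _ → lem μ (+ K) (r n) (hitsAt (n % 3) n)) ⟩
        ∑ N (λ n → + 2 * μ * + K * (r n * hitsAt (n % 3) n) + - (μ * μ) * r n)
          ≡⟨ trans (∑-+ N (λ n → + 2 * μ * + K * (r n * hitsAt (n % 3) n)) (λ n → - (μ * μ) * r n))
               (cong₂ _+_ (∑-*ˡ N (+ 2 * μ * + K) (λ n → r n * hitsAt (n % 3) n)) (∑-*ˡ N (- (μ * μ)) r)) ⟩
        + 2 * μ * + K * C + - (μ * μ) * Z
          ≡⟨ cong (λ z → + 2 * μ * + K * C + z) (sym (neg-distribˡ-* (μ * μ) Z)) ⟩
        + 2 * μ * + K * C - μ * μ * Z ∎
        where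
        open ≤-Reasoning
        lem : ∀ μ k r h → r * (+ 2 * μ * (k * h) - μ * μ) ≡ + 2 * μ * k * (r * h) + - (μ * μ) * r
        lem = ℤ-solve

    -- This is `summed` divided by a U²; the case a = 0 is trivial. As K = 16U, the coefficients are
    -- 2K/U = 32 for C and 2K²/U² = 512 for both error terms.
    block : a * Z ≤ + 32 * C + + 512 * + N + + 512 * (a * + (K ℕ.* K))
    block = by (sign (a ≟ 0ℤ))
      where
      RHS : ℤ
      RHS = + 32 * C + + 512 * + N + + 512 * (a * + (K ℕ.* K))
      u : ℤ
      u = + U
      K≡ : + K ≡ + 16 * u
      K≡ = trans (cong +_ (lem U)) (pos-* 16 U)
        where
        lem : ∀ U → 2 ℕ.* (8 ℕ.* U) ≡ 16 ℕ.* U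
        lem = ℕ-solve
      K²≡ : + (K ℕ.* K) ≡ + 16 * u * (+ 16 * u)
      K²≡ = trans (pos-* K K) (cong₂ _*_ K≡ K≡)
      K⁴≡ : + (K ℕ.* K ℕ.* (K ℕ.* K)) ≡ + 16 * u * (+ 16 * u) * (+ 16 * u * (+ 16 * u))
      K⁴≡ = trans (pos-* (K ℕ.* K) (K ℕ.* K)) (cong₂ _*_ K²≡ K²≡)
      sign : Dec (a ≡ 0ℤ) → a ≡ 0ℤ ⊎ 0ℤ ℤ.< a
      sign (yes a≡0) = inj₁ a≡0
      sign (no a≢0)  = inj₂ (≤∧≢⇒< a-nonneg (λ eq → a≢0 (sym eq)))
      by : a ≡ 0ℤ ⊎ 0ℤ ℤ.< a → a * Z ≤ RHS
      by (inj₁ a≡0) = ≤-trans (≤-reflexive (trans (cong (_* Z) a≡0) (*-zeroˡ Z)))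
        (+-mono-≤ (+-mono-≤ (*-nonneg {+ 32} {C} (+≤+ z≤n) C-nonneg) (*-nonneg {+ 512} {+ N} (+≤+ z≤n) (+≤+ z≤n)))
          (*-nonneg {+ 512} {a * + (K ℕ.* K)} (+≤+ z≤n) (*-nonneg {a} {+ (K ℕ.* K)} a-nonneg (+≤+ z≤n))))
      by (inj₂ 0<a) = *-cancelˡ-≤-pos (a * Z) RHS (a * (u * u)) {{ℤ.positive 0<auu}} (begin
          a * (u * u) * (a * Z)
            ≡⟨ lem₁ a u Z (+ K) C ⟩
          + 2 * μ * + K * C + - (+ 2 * μ * + K * C - μ * μ * Z)
            ≤⟨ +-monoʳ-≤ (+ 2 * μ * + K * C) (neg-mono-≤ summed) ⟩
          + 2 * μ * + K * C + - (- E + - E)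
            ≡⟨ cong₂ (λ k e → + 2 * μ * k * C + - (- e + - e)) K≡ (cong₂ (λ x y → a * (+ N * x + a * y)) K²≡ K⁴≡) ⟩
          + 2 * μ * (+ 16 * u) * C + - (- E′ + - E′)
            ≡⟨ lem₂ a u C (+ N) ⟩
          a * (u * u) * (+ 32 * C + + 512 * + N + + 512 * (a * (+ 16 * u * (+ 16 * u))))
            ≡⟨ cong (λ x → a * (u * u) * (+ 32 * C + + 512 * + N + + 512 * (a * x))) (sym K²≡) ⟩
          a * (u * u) * RHS ∎)
        where
        open ≤-Reasoning
        E′ : ℤ
        E′ = a * (+ N * (+ 16 * u * (+ 16 * u)) + a * (+ 16 * u * (+ 16 * u) * (+ 16 * u * (+ 16 * u))))
        0<u : 0ℤ ℤ.< u
        0<u = ℤ.+<+ 1≤U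
        0<auu : 0ℤ ℤ.< a * (u * u)
        0<auu = *-pos 0<a (*-pos 0<u 0<u)
        lem₁ : ∀ a u Z K C → a * (u * u) * (a * Z) ≡ + 2 * (a * u) * K * C + - (+ 2 * (a * u) * K * C - a * u * (a * u) * Z)
        lem₁ = ℤ-solve
        lem₂ : ∀ a u C N → + 2 * (a * u) * (+ 16 * u) * C
            + - (- (a * (N * (+ 16 * u * (+ 16 * u)) + a * (+ 16 * u * (+ 16 * u) * (+ 16 * u * (+ 16 * u)))))
               + - (a * (N * (+ 16 * u * (+ 16 * u)) + a * (+ 16 * u * (+ 16 * u) * (+ 16 * u * (+ 16 * u))))))
          ≡ a * (u * u) * (+ 32 * C + + 512 * N + + 512 * (a * (+ 16 * u * (+ 16 * u))))
        lem₂ = ℤ-solve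

-- From hits to numbers counted by F.

module Counting where

  open import Defs hiding (S)
  open import Data.Bool as Bool using (Bool; true; false; _∧_; if_then_else_)
  open import Data.Bool.ListAction using (any)
  open import Data.Bool.Properties using (T-≡; ∨-zeroʳ)
  open import Data.List using (_∷_)
  open import Data.List.Membership.Propositional using (_∈_)
  open import Data.List.Membership.Propositional.Properties using (∈-upTo⁺)
  open import Data.List.Relation.Unary.Any using (here; there)
  open import Data.Nat.DivMod using (_%_; _/_; m%n<n; m≡m%n+[m/n]*n)
  open import Data.Nat.Divisibility
  open import Data.Nat.Primality using (Prime; prime?; prime⇒nonZero; euclidsLemma)
  open import Data.Integer as ℤ using (ℤ; +_; _+_; _*_; _≤_; +≤+; 0ℤ; 1ℤ)
  open import Data.Integer.Properties hiding (_≤?_; _<?_)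
  open import Function.Bundles using (Equivalence)
  open import Relation.Nullary.Decidable using (_×-dec_; isYes)
  open Sums
  open Variance
  open Block
  open SmallCyclotomics using (prime∣prime⇒≡)
  open TernaryFlat using (Φ₃ᵩᵣ-flat; prime[3])

  Flat : ℕ → Set
  Flat n = isFlat (cyclotomic n) ≡ true

  ∑-≢0 : ∀ n {f} → ∑ n f ≢ 0ℤ → ∃[ i ] (i ℕ.< n × f i ≢ 0ℤ)
  ∑-≢0 zero    ≢0 = ⊥-elim (≢0 refl)
  ∑-≢0 (suc n) {f} ≢0 = by (f n ≟ 0ℤ)
    where
    by : Dec (f n ≡ 0ℤ) → ∃[ i ] (i ℕ.< suc n × f i ≢ 0ℤ)
    by (no fn≢0)  = n , ℕ.≤-refl , fn≢0
    by (yes fn≡0) = let i , i<n , fi≢0 = ∑-≢0 n (λ eq → ≢0 (cong₂ _+_ eq fn≡0)) in i , ℕ.m<n⇒m<1+n i<n , fi≢0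

  module _ {q n : ℕ} (pq : Prime q) (pn : Prime n) (3<q : 3 ℕ.< q) (q<n : q ℕ.< n) where

    private
      3∤ : ∀ {m} → Prime m → 3 ℕ.< m → ¬ 3 ∣ m
      3∤ pm 3<m 3∣m = ℕ.<⇒≢ 3<m (prime∣prime⇒≡ prime[3] pm 3∣m)

      3∤q : ¬ 3 ∣ q
      3∤q = 3∤ pq 3<q

      3∤n : ¬ 3 ∣ n
      3∤n = 3∤ pn (ℕ.<-trans 3<q q<n)

    flat : ∀ v u → 6 ℕ.* u ℕ.< q → 3 ∣ v ℕ.+ n →
      (n ℕ.* (3 ℕ.* u) ≡ q ℕ.* v ℕ.+ 1) ⊎ (n ℕ.* (3 ℕ.* u) ℕ.+ 1 ≡ q ℕ.* v) → Flat (3 ℕ.* q ℕ.* n)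
    flat v u 6u<q 3∣v+n inverse = by q n refl refl
      where
      lem : ∀ u → 6 ℕ.* u ≡ 2 ℕ.* (3 ℕ.* u)
      lem = ℕ-solve
      by : ∀ q′ n′ → q ≡ q′ → n ≡ n′ → Flat (3 ℕ.* q′ ℕ.* n′)
      by zero     _        refl _    = ⊥-elim (ℕ.n≮0 3<q)
      by (suc q′) zero     _    refl = ⊥-elim (ℕ.n≮0 q<n)
      by (suc q′) (suc n′) refl refl = Φ₃ᵩᵣ-flat q′ n′ pq pn 3<q q<n v (3 ℕ.* u) (m∣m*n u)
        (subst (ℕ._< q) (lem u) 6u<q) 3∣v+n inverse

    private
      residue : q ℕ.* n ≡ q ℕ.* (n % 3) % 3 ℕ.+ 3 ℕ.* (q ℕ.* (n % 3) / 3 ℕ.+ q ℕ.* (n / 3))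
      residue = trans (cong (q ℕ.*_) (m≡m%n+[m/n]*n n 3)) (trans (lem₁ q (n % 3) (n / 3))
        (trans (cong (ℕ._+ 3 ℕ.* (q ℕ.* (n / 3))) (m≡m%n+[m/n]*n (q ℕ.* (n % 3)) 3)) (lem₂ (q ℕ.* (n % 3) % 3) (q ℕ.* (n % 3) / 3) (q ℕ.* (n / 3)))))
        where
        lem₁ : ∀ q r d → q ℕ.* (r ℕ.+ d ℕ.* 3) ≡ q ℕ.* r ℕ.+ 3 ℕ.* (q ℕ.* d)
        lem₁ = ℕ-solve
        lem₂ : ∀ r a b → r ℕ.+ a ℕ.* 3 ℕ.+ 3 ℕ.* b ≡ r ℕ.+ 3 ℕ.* (a ℕ.+ b)
        lem₂ = ℕ-solve

      k : ℕ
      k = q ℕ.* (n % 3) / 3 ℕ.+ q ℕ.* (n / 3)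

      cancel-q : ∀ {m} → 3 ∣ q ℕ.* m → 3 ∣ m
      cancel-q {m} 3∣ with euclidsLemma q m prime[3] 3∣
      ... | inj₁ 3∣q = ⊥-elim (3∤q 3∣q)
      ... | inj₂ 3∣m = 3∣m

    -- If qn ≡ 1 modulo 3, the offset q - 1 gives 3un = qv + 1; otherwise qn ≡ 2 and 3un + 1 = qv.
    -- Either way q(v + n) = qv + qn is divisible by 3, hence so is v + n.
    divisible⇒flat : ∀ u → 6 ℕ.* u ℕ.< q → q ∣ 3 ℕ.* u ℕ.* n ℕ.+ off q (n % 3) → Flat (3 ℕ.* q ℕ.* n)
    divisible⇒flat u 6u<q q∣ with q ℕ.* (n % 3) % 3 ℕ.≟ 1
    ... | yes ≡1 = plus q∣
      where
      plus : q ∣ 3 ℕ.* u ℕ.* n ℕ.+ ℕ.pred q → Flat (3 ℕ.* q ℕ.* n)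
      plus (divides zero eq) = ⊥-elim (ℕ.<⇒≢ (ℕ.≤-trans 1≤pred (ℕ.m≤n+m (ℕ.pred q) (3 ℕ.* u ℕ.* n))) (sym eq))
        where
        1≤pred : 1 ℕ.≤ ℕ.pred q
        1≤pred = ℕ.≤-pred (ℕ.≤-trans (ℕ.<⇒≤ (ℕ.<-trans (s≤s (s≤s (s≤s z≤n))) 3<q)) (ℕ.≤-reflexive (sym (ℕ.suc-pred q {{prime⇒nonZero pq}}))))
      plus (divides (suc v) eq) = flat v u 6u<q (cancel-q (divides (n ℕ.* u ℕ.+ k) sum)) (inj₁ main)
        where
        lem₁ : ∀ u n → n ℕ.* (3 ℕ.* u) ≡ 3 ℕ.* u ℕ.* n
        lem₁ = ℕ-solve
        lem₂ : ∀ p v → (1 ℕ.+ v) ℕ.* (1 ℕ.+ p) ≡ (1 ℕ.+ p) ℕ.* v ℕ.+ 1 ℕ.+ p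
        lem₂ = ℕ-solve
        main : n ℕ.* (3 ℕ.* u) ≡ q ℕ.* v ℕ.+ 1
        main = trans (lem₁ u n) (ℕ.+-cancelʳ-≡ (ℕ.pred q) (3 ℕ.* u ℕ.* n) (q ℕ.* v ℕ.+ 1) (trans eq
          (trans (cong (suc v ℕ.*_) (sym (ℕ.suc-pred q {{prime⇒nonZero pq}})))
            (trans (lem₂ (ℕ.pred q) v) (cong (λ m → m ℕ.* v ℕ.+ 1 ℕ.+ ℕ.pred q) (ℕ.suc-pred q {{prime⇒nonZero pq}}))))))
        lem₃ : ∀ n u k → n ℕ.* (3 ℕ.* u) ℕ.+ 3 ℕ.* k ≡ (n ℕ.* u ℕ.+ k) ℕ.* 3
        lem₃ = ℕ-solve
        sum : q ℕ.* (v ℕ.+ n) ≡ (n ℕ.* u ℕ.+ k) ℕ.* 3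
        sum = trans (ℕ.*-distribˡ-+ q v n) (trans (cong (q ℕ.* v ℕ.+_) (trans residue (cong (ℕ._+ 3 ℕ.* k) ≡1)))
          (trans (sym (ℕ.+-assoc (q ℕ.* v) 1 (3 ℕ.* k))) (trans (cong (ℕ._+ 3 ℕ.* k) (sym main)) (lem₃ n u k))))
    ... | no ≢1 = minus q∣
      where
      ≡2 : q ℕ.* (n % 3) % 3 ≡ 2
      ≡2 = by (q ℕ.* (n % 3) % 3) refl (m%n<n (q ℕ.* (n % 3)) 3)
        where
        by : ∀ ρ → q ℕ.* (n % 3) % 3 ≡ ρ → ρ ℕ.< 3 → q ℕ.* (n % 3) % 3 ≡ 2
        by 0 eq _ = ⊥-elim (3∤n (cancel-q (divides k (trans residue (trans (cong (ℕ._+ 3 ℕ.* k) eq) (ℕ.*-comm 3 k))))))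
        by 1 eq _ = ⊥-elim (≢1 eq)
        by 2 eq _ = eq
        by (suc (suc (suc _))) _ (s≤s (s≤s (s≤s ())))
      minus : q ∣ 3 ℕ.* u ℕ.* n ℕ.+ 1 → Flat (3 ℕ.* q ℕ.* n)
      minus (divides v eq) = flat v u 6u<q (cancel-q (divides (n ℕ.* u ℕ.+ 1 ℕ.+ k) sum)) (inj₂ main)
        where
        lem₁ : ∀ u n → n ℕ.* (3 ℕ.* u) ℕ.+ 1 ≡ 3 ℕ.* u ℕ.* n ℕ.+ 1
        lem₁ = ℕ-solve
        main : n ℕ.* (3 ℕ.* u) ℕ.+ 1 ≡ q ℕ.* v
        main = trans (lem₁ u n) (trans eq (ℕ.*-comm v q))
        lem₂ : ∀ n u k → n ℕ.* (3 ℕ.* u) ℕ.+ 1 ℕ.+ (2 ℕ.+ 3 ℕ.* k) ≡ (n ℕ.* u ℕ.+ 1 ℕ.+ k) ℕ.* 3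
        lem₂ = ℕ-solve
        sum : q ℕ.* (v ℕ.+ n) ≡ (n ℕ.* u ℕ.+ 1 ℕ.+ k) ℕ.* 3
        sum = trans (ℕ.*-distribˡ-+ q v n) (trans (cong₂ ℕ._+_ (sym main) (trans residue (cong (ℕ._+ 3 ℕ.* k) ≡2))) (lem₂ n u k))

    h≢0⇒flat : ∀ {U} → 8 ℕ.* U ℕ.≤ q → h U q (off q (n % 3)) n ≢ 0ℤ → Flat (3 ℕ.* q ℕ.* n)
    h≢0⇒flat {U} 8U≤q h≢0 = let u , u<U , ≢0 = ∑-≢0 U h≢0 in
      divisible⇒flat (suc u) (ℕ.<-≤-trans (6u<8U u u<U) 8U≤q)
        (⟦⟧-≢0 (q ∣? 3 ℕ.* suc u ℕ.* n ℕ.+ off q (n % 3)) ≢0)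
      where
      6u<8U : ∀ u → u ℕ.< U → 6 ℕ.* suc u ℕ.< 8 ℕ.* U
      6u<8U u u<U = ℕ.<-≤-trans (ℕ.*-monoˡ-< (suc u) {6} {8} (s≤s (s≤s (s≤s (s≤s (s≤s (s≤s (s≤s z≤n)))))))) (ℕ.*-monoʳ-≤ 8 u<U)

  any-true : ∀ {A : Set} (f : A → Bool) {x xs} → x ∈ xs → f x ≡ true → any f xs ≡ true
  any-true f {xs = x ∷ xs} (here refl) fx≡true rewrite fx≡true = refl
  any-true f {xs = y ∷ xs} (there x∈) fx≡true = trans (cong (f y Bool.∨_) (any-true f x∈ fx≡true)) (∨-zeroʳ (f y))

  isPrime-true : ∀ {p} → Prime p → isPrimeᵇ p ≡ true
  isPrime-true {p} pp = by (prime? p)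
    where
    by : (d : Dec (Prime p)) → isYes d ≡ true
    by (yes _) = refl
    by (no ¬p) = ⊥-elim (¬p pp)

  oddTernary : ∀ {q r} → Prime q → Prime r → 3 ℕ.< q → q ℕ.< r → isOddTernary (3 ℕ.* q ℕ.* r) ≡ true
  oddTernary {q} {r} pq pr 3<q q<r =
    any-true _ (∈-upTo⁺ (s≤s (∣⇒≤ {{nz}} 3∣))) (any-true _ (∈-upTo⁺ (s≤s (∣⇒≤ {{nz}} q∣))) (any-true _ (∈-upTo⁺ (s≤s (∣⇒≤ {{nz}} r∣)))
      (∧-true (refl {x = true}) (∧-true (Equivalence.to T-≡ (ℕ.<⇒<ᵇ 3<q)) (∧-true (Equivalence.to T-≡ (ℕ.<⇒<ᵇ q<r))
        (∧-true (isPrime-true prime[3]) (∧-true (isPrime-true pq) (∧-true (isPrime-true pr)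
          (Equivalence.to T-≡ (ℕ.≡⇒≡ᵇ (3 ℕ.* q ℕ.* r) _ refl))))))))))
    where
    ∧-true : ∀ {a b} → a ≡ true → b ≡ true → a ∧ b ≡ true
    ∧-true refl refl = refl
    nz : NonZero (3 ℕ.* q ℕ.* r)
    nz = ℕ.m*n≢0 (3 ℕ.* q) r {{ℕ.m*n≢0 3 q {{_}} {{prime⇒nonZero pq}}}} {{prime⇒nonZero pr}}
    3∣ : 3 ∣ 3 ℕ.* q ℕ.* r
    3∣ = ∣-trans (m∣m*n q) (m∣m*n r)
    q∣ : q ∣ 3 ℕ.* q ℕ.* r
    q∣ = ∣-trans (n∣m*n 3) (m∣m*n r)
    r∣ : r ∣ 3 ℕ.* q ℕ.* r
    r∣ = n∣m*n (3 ℕ.* q)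

  counted : ℕ → Bool
  counted n = isOddTernary n ∧ isFlat (cyclotomic n)

  F-∑ : ∀ x → + F x ≡ ∑ x (λ m → + (if counted (suc m) then 1 else 0))
  F-∑ x = by x
    where
    by : ∀ x → + countUpTo counted x ≡ ∑ x (λ m → + (if counted (suc m) then 1 else 0))
    by zero    = refl
    by (suc x) = cong (_+ + (if counted (suc x) then 1 else 0)) (by x)

  Good : ℕ → ℕ → ℕ → Set
  Good x q r = ((Prime q × Prime r) × (3 ℕ.< q × q ℕ.< r)) × (3 ℕ.* q ℕ.* r ℕ.≤ x × Flat (3 ℕ.* q ℕ.* r))

  good? : ∀ x q r → Dec (Good x q r)
  good? x q r = ((prime? q ×-dec prime? r) ×-dec (3 ℕ.<? q ×-dec q ℕ.<? r))
    ×-dec (3 ℕ.* q ℕ.* r ℕ.≤? x ×-dec (isFlat (cyclotomic (3 ℕ.* q ℕ.* r)) Bool.≟ true))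

  -- By Euclid's lemma q is one of q′ and r′, and the order of the factors rules out the exchanged
  -- pair.
  good-unique : ∀ {x y q r q′ r′} → Good x q r → Good y q′ r′ → 3 ℕ.* q ℕ.* r ≡ 3 ℕ.* q′ ℕ.* r′ → q ≡ q′ × r ≡ r′
  good-unique {x} {y} {q} {r} {q′} {r′} (((pq , pr) , _ , q<r) , _) (((pq′ , pr′) , _ , q′<r′) , _) eq = q≡q′ , r≡r′
    where
    qr≡ : q ℕ.* r ≡ q′ ℕ.* r′
    qr≡ = ℕ.*-cancelˡ-≡ (q ℕ.* r) (q′ ℕ.* r′) 3 (trans (sym (ℕ.*-assoc 3 q r)) (trans eq (ℕ.*-assoc 3 q′ r′)))
    one-of : ∀ {a b c d} → Prime a → Prime c → Prime d → a ℕ.* b ≡ c ℕ.* d → a ≡ c ⊎ a ≡ d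
    one-of {a} {b} {c} {d} pa pc pd e with euclidsLemma c d pa (subst (a ∣_) e (m∣m*n b))
    ... | inj₁ a∣c = inj₁ (prime∣prime⇒≡ pa pc a∣c)
    ... | inj₂ a∣d = inj₂ (prime∣prime⇒≡ pa pd a∣d)
    q≡q′ : q ≡ q′
    q≡q′ with one-of pq pq′ pr′ qr≡
    ... | inj₁ e = e
    ... | inj₂ q≡r′ with one-of pq′ pq pr (sym qr≡)
    ...   | inj₁ e = sym e
    ...   | inj₂ q′≡r = ⊥-elim (ℕ.<-asym q<r (subst₂ ℕ._<_ q′≡r (sym q≡r′) q′<r′))
    r≡r′ : r ≡ r′
    r≡r′ = ℕ.*-cancelˡ-≡ r r′ q {{prime⇒nonZero pq}} (trans qr≡ (cong (ℕ._* r′) (sym q≡q′)))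

  -- Each good pair is filed in the cell m with m + 1 = 3qr. By `good-unique` a cell holds at most
  -- one pair, and it is empty unless m + 1 is counted by F.
  ∑-good-≤-F : ∀ A B x → ∑ A (λ q → ∑ B (λ r → ⟦ good? x q r ⟧)) ≤ + F x
  ∑-good-≤-F A B x = begin
    ∑ A (λ q → ∑ B (λ r → ⟦ good? x q r ⟧))
      ≡⟨ ∑-cong A (λ q _ → ∑-cong B (λ r _ → locate q r (good? x q r))) ⟩
    ∑ A (λ q → ∑ B (λ r → ∑ x (λ m → cell q r m)))
      ≡⟨ ∑-cong A (λ q _ → ∑-swap B x (cell q)) ⟩
    ∑ A (λ q → ∑ x (λ m → ∑ B (λ r → cell q r m)))
      ≡⟨ ∑-swap A x (λ q m → ∑ B (λ r → cell q r m)) ⟩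
    ∑ x (λ m → ∑ A (λ q → ∑ B (λ r → cell q r m)))
      ≤⟨ ∑-mono x (λ m _ → at m (counted (suc m)) refl) ⟩
    ∑ x (λ m → + (if counted (suc m) then 1 else 0))
      ≡⟨ sym (F-∑ x) ⟩
    + F x ∎
    where
    open ≤-Reasoning
    cell : ℕ → ℕ → ℕ → ℤ
    cell q r m = ⟦ good? x q r ⟧ * ⟦ suc m ℕ.≟ 3 ℕ.* q ℕ.* r ⟧

    positive : ∀ {q r} → Good x q r → 1 ℕ.≤ 3 ℕ.* q ℕ.* r
    positive {q} {r} (((pq , pr) , _) , _) =
      ℕ.>-nonZero⁻¹ (3 ℕ.* q ℕ.* r) {{ℕ.m*n≢0 (3 ℕ.* q) r {{ℕ.m*n≢0 3 q {{_}} {{prime⇒nonZero pq}}}} {{prime⇒nonZero pr}}}}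

    locate : ∀ q r (d : Dec (Good x q r)) → ⟦ d ⟧ ≡ ∑ x (λ m → ⟦ d ⟧ * ⟦ suc m ℕ.≟ 3 ℕ.* q ℕ.* r ⟧)
    locate q r (no _) = sym (∑-zero x (λ m _ → *-zeroˡ ⟦ suc m ℕ.≟ 3 ℕ.* q ℕ.* r ⟧))
    locate q r (yes good@(_ , ≤x , _)) = sym (trans (∑-single x m₀ m₀<x λ m _ m≢m₀ →
        trans (*-identityˡ ⟦ suc m ℕ.≟ 3 ℕ.* q ℕ.* r ⟧) (⟦⟧-no (suc m ℕ.≟ 3 ℕ.* q ℕ.* r) (λ eq → m≢m₀ (ℕ.suc-injective (trans eq (sym sm₀))))))
      (trans (*-identityˡ ⟦ suc m₀ ℕ.≟ 3 ℕ.* q ℕ.* r ⟧) (⟦⟧-yes (suc m₀ ℕ.≟ 3 ℕ.* q ℕ.* r) sm₀)))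
      where
      m₀ = ℕ.pred (3 ℕ.* q ℕ.* r)
      sm₀ : suc m₀ ≡ 3 ℕ.* q ℕ.* r
      sm₀ = ℕ.suc-pred (3 ℕ.* q ℕ.* r) {{ℕ.>-nonZero (positive good)}}
      m₀<x : m₀ ℕ.< x
      m₀<x = ℕ.≤-trans (ℕ.≤-reflexive sm₀) ≤x

    cell-≢0 : ∀ {q r m} → cell q r m ≢ 0ℤ → Good x q r × suc m ≡ 3 ℕ.* q ℕ.* r
    cell-≢0 {q} {r} {m} ≢0 =
      ⟦⟧-≢0 (good? x q r) (λ z → ≢0 (trans (cong (_* ⟦ suc m ℕ.≟ 3 ℕ.* q ℕ.* r ⟧) z) (*-zeroˡ ⟦ suc m ℕ.≟ 3 ℕ.* q ℕ.* r ⟧))) ,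
      ⟦⟧-≢0 (suc m ℕ.≟ 3 ℕ.* q ℕ.* r) (λ z → ≢0 (trans (cong (⟦ good? x q r ⟧ *_) z) (*-zeroʳ ⟦ good? x q r ⟧)))

    cell≤1 : ∀ q r m → cell q r m ≤ 1ℤ
    cell≤1 q r m = *-mono-≤ {⟦ good? x q r ⟧} {1ℤ} {⟦ suc m ℕ.≟ 3 ℕ.* q ℕ.* r ⟧} {1ℤ} (0≤⟦⟧ (good? x q r)) (⟦⟧≤1 (good? x q r))
      (0≤⟦⟧ (suc m ℕ.≟ 3 ℕ.* q ℕ.* r)) (⟦⟧≤1 (suc m ℕ.≟ 3 ℕ.* q ℕ.* r))

    same : ∀ {q r q′ r′ m} → cell q r m ≢ 0ℤ → cell q′ r′ m ≢ 0ℤ → q ≡ q′ × r ≡ r′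
    same {q} {r} {q′} {r′} {m} ≢0 ≢0′ = let good , e = cell-≢0 {q} {r} {m} ≢0 ; good′ , e′ = cell-≢0 {q′} {r′} {m} ≢0′ in
      good-unique {x} {x} good good′ (trans (sym e) e′)

    at : ∀ m b → counted (suc m) ≡ b → ∑ A (λ q → ∑ B (λ r → cell q r m)) ≤ + (if counted (suc m) then 1 else 0)
    at m true eq rewrite eq = ∑-exclusive A
      (λ q _ → ∑-exclusive B (λ r _ → cell≤1 q r m) (λ r r′ _ _ ≢0 ≢0′ → proj₂ (same {q} {r} {q} {r′} {m} ≢0 ≢0′)))
      (λ q q′ _ _ ≢0 ≢0′ → let r , _ , c≢0 = ∑-≢0 B ≢0 ; r′ , _ , c≢0′ = ∑-≢0 B ≢0′ in proj₁ (same {q} {r} {q′} {r′} {m} c≢0 c≢0′))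
    at m false eq = ≤-trans (≤-reflexive (∑-zero A (λ q _ → ∑-zero B (λ r _ → vanish q r)))) (+≤+ z≤n)
      where
      vanish : ∀ q r → cell q r m ≡ 0ℤ
      vanish q r = by (cell q r m ≟ 0ℤ)
        where
        absurd : Good x q r × suc m ≡ 3 ℕ.* q ℕ.* r → ⊥
        absurd ((((pq , pr) , 3<q , q<r) , _ , flat) , e) with () ← trans (sym eq) (trans (cong counted e) (cong₂ _∧_ (oddTernary pq pr 3<q q<r) flat))
        by : Dec (cell q r m ≡ 0ℤ) → cell q r m ≡ 0ℤ
        by (yes z) = z
        by (no nz) = ⊥-elim (absurd (cell-≢0 {q} {r} {m} nz))

  -- As h ≤ 1, each pair has weight at most 1 in `C`. The cut-off K ≤ n yields q < n, and q < K, n <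
  -- N keep 3qn below 3KN ≤ x.
  C-≤-good : ∀ U N x (1≤U : 1 ℕ.≤ U) → 3 ℕ.* K U N 1≤U ℕ.* N ℕ.≤ x →
    C U N 1≤U ≤ ∑ (8 ℕ.* U) (λ t → ∑ N (λ n → ⟦ good? x (8 ℕ.* U ℕ.+ t) n ⟧))
  C-≤-good U N x 1≤U fits = begin
    ∑ N (λ n → isP n * ⟦ k ℕ.≤? n ⟧ * ∑ Y′ (λ t → isP (Y′ ℕ.+ t) * H t n))
      ≤⟨ ∑-mono N (λ n n<N → ≤-trans (≤-reflexive (sym (∑-*ˡ Y′ (isP n * ⟦ k ℕ.≤? n ⟧) (λ t → isP (Y′ ℕ.+ t) * H t n))))
           (∑-mono Y′ (λ t t<Y → cell n t n<N t<Y (prime? n) (k ℕ.≤? n) (prime? (Y′ ℕ.+ t)) (good? x (Y′ ℕ.+ t) n)))) ⟩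
    ∑ N (λ n → ∑ Y′ (λ t → ⟦ good? x (Y′ ℕ.+ t) n ⟧))
      ≡⟨ ∑-swap N Y′ (λ n t → ⟦ good? x (Y′ ℕ.+ t) n ⟧) ⟩
    ∑ Y′ (λ t → ∑ N (λ n → ⟦ good? x (Y′ ℕ.+ t) n ⟧)) ∎
    where
    open ≤-Reasoning
    Y′ k : ℕ
    Y′ = 8 ℕ.* U
    k = K U N 1≤U
    H : ℕ → ℕ → ℤ
    H t n = h U (Y′ ℕ.+ t) (off (Y′ ℕ.+ t) (n % 3)) n
    cell : ∀ n t → n ℕ.< N → t ℕ.< Y′ → (d₁ : Dec (Prime n)) (d₂ : Dec (k ℕ.≤ n)) (d₃ : Dec (Prime (Y′ ℕ.+ t)))
      (e : Dec (Good x (Y′ ℕ.+ t) n)) → ⟦ d₁ ⟧ * ⟦ d₂ ⟧ * (⟦ d₃ ⟧ * H t n) ≤ ⟦ e ⟧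
    cell n t n<N t<Y (no _) d₂ d₃ e = ≤-trans (≤-reflexive (lem ⟦ d₂ ⟧ (⟦ d₃ ⟧ * H t n))) (0≤⟦⟧ e)
      where
      lem : ∀ a b → 0ℤ * a * b ≡ 0ℤ
      lem = ℤ-solve
    cell n t n<N t<Y (yes _) (no _) d₃ e = ≤-trans (≤-reflexive (lem (⟦ d₃ ⟧ * H t n))) (0≤⟦⟧ e)
      where
      lem : ∀ b → 1ℤ * 0ℤ * b ≡ 0ℤ
      lem = ℤ-solve
    cell n t n<N t<Y (yes _) (yes _) (no _) e = ≤-trans (≤-reflexive (lem (H t n))) (0≤⟦⟧ e)
      where
      lem : ∀ b → 1ℤ * 1ℤ * (0ℤ * b) ≡ 0ℤ
      lem = ℤ-solve
    cell n t n<N t<Y (yes pn) (yes k≤n) (yes pq) e = ≤-trans (≤-reflexive (lem (H t n))) (by (H t n ≟ 0ℤ))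
      where
      q′ : ℕ
      q′ = Y′ ℕ.+ t
      lem : ∀ b → 1ℤ * 1ℤ * (1ℤ * b) ≡ b
      lem = ℤ-solve
      8≤Y : 8 ℕ.≤ Y′
      8≤Y = ℕ.*-monoʳ-≤ 8 1≤U
      3<q : 3 ℕ.< q′
      3<q = ℕ.≤-trans (ℕ.≤-trans (s≤s (s≤s (s≤s (s≤s z≤n)))) 8≤Y) (ℕ.m≤m+n Y′ t)
      q<k : q′ ℕ.< k
      q<k = ℕ.<-≤-trans (ℕ.+-monoʳ-< Y′ t<Y) (ℕ.≤-reflexive (cong (Y′ ℕ.+_) (sym (ℕ.+-identityʳ Y′))))
      q<n : q′ ℕ.< n
      q<n = ℕ.<-≤-trans q<k k≤n
      U<q : U ℕ.< q′
      U<q = ℕ.<-≤-trans (ℕ.<-≤-trans (ℕ.m<m+n U {U} 1≤U) (ℕ.≤-trans (ℕ.≤-reflexive (cong (U ℕ.+_) (sym (ℕ.+-identityʳ U)))) (ℕ.*-monoˡ-≤ U {2} {8} (s≤s (s≤s z≤n))))) (ℕ.m≤m+n Y′ t)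
      by : Dec (H t n ≡ 0ℤ) → H t n ≤ ⟦ e ⟧
      by (yes z) = ≤-trans (≤-reflexive z) (0≤⟦⟧ e)
      by (no nz) = ≤-trans (h≤1 pq 3<q U<q (off q′ (n % 3)) (∤off pq (n % 3)) n)
        (≤-reflexive (sym (⟦⟧-yes e (((pq , pn) , 3<q , q<n) ,
          ℕ.≤-trans (ℕ.*-mono-≤ (ℕ.*-monoʳ-≤ 3 (ℕ.<⇒≤ q<k)) (ℕ.<⇒≤ n<N)) fits ,
          h≢0⇒flat pq pn 3<q q<n {U} (ℕ.m≤m+n Y′ t) nz))))

-- Partial sums of the exponential series at rational arguments.

module Exponential where

  open import Defs using (expTerm; expSum)
  open import Data.Integer as ℤ using (+_)
  import Data.Integer.Properties as ℤ
  open import Data.Rational as ℚ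
  open import Data.Rational.Properties
  open import Data.Rational.Solver using (module +-*-Solver)
  open import Data.Rational.Unnormalised as ℚᵘ using (ℚᵘ; mkℚᵘ; *≡*; *≤*)
  import Data.Rational.Unnormalised.Properties as ℚᵘ
  open +-*-Solver

  -- The quotient `_/_` is reduced by a gcd, which does not compute on variables; arithmetic is
  -- checked on unnormalised fractions and carried back.
  toℚᵘ-/ : ∀ n d → toℚᵘ (+ n / suc d) ℚᵘ.≃ mkℚᵘ (+ n) d
  toℚᵘ-/ n d = toℚᵘ-fromℚᵘ (mkℚᵘ (+ n) d)

  fromℕ : ℕ → ℚ
  fromℕ n = + n / 1

  fromℕ-+ : ∀ m n → fromℕ m + fromℕ n ≡ fromℕ (m ℕ.+ n)
  fromℕ-+ m n = toℚᵘ-injective (ℚᵘ.≃-trans (toℚᵘ-homo-+ (fromℕ m) (fromℕ n))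
    (ℚᵘ.≃-trans (ℚᵘ.+-cong (toℚᵘ-/ m 0) (toℚᵘ-/ n 0)) (ℚᵘ.≃-trans (*≡* eq) (ℚᵘ.≃-sym (toℚᵘ-/ (m ℕ.+ n) 0)))))
    where
    eq : (+ m ℤ.* + 1 ℤ.+ + n ℤ.* + 1) ℤ.* + 1 ≡ + (m ℕ.+ n) ℤ.* + 1
    eq = cong (ℤ._* + 1) (trans (cong₂ ℤ._+_ (ℤ.*-identityʳ (+ m)) (ℤ.*-identityʳ (+ n))) (sym (ℤ.pos-+ m n)))

  fromℕ-* : ∀ m n → fromℕ m * fromℕ n ≡ fromℕ (m ℕ.* n)
  fromℕ-* m n = toℚᵘ-injective (ℚᵘ.≃-trans (toℚᵘ-homo-* (fromℕ m) (fromℕ n))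
    (ℚᵘ.≃-trans (ℚᵘ.*-cong (toℚᵘ-/ m 0) (toℚᵘ-/ n 0)) (ℚᵘ.≃-trans (*≡* (cong (ℤ._* + 1) (sym (ℤ.pos-* m n)))) (ℚᵘ.≃-sym (toℚᵘ-/ (m ℕ.* n) 0)))))

  fromℕ-inverse : ∀ k → fromℕ (suc k) * (+ 1 / suc k) ≡ 1ℚ
  fromℕ-inverse k = toℚᵘ-injective (ℚᵘ.≃-trans (toℚᵘ-homo-* (fromℕ (suc k)) (+ 1 / suc k))
    (ℚᵘ.≃-trans (ℚᵘ.*-cong (toℚᵘ-/ (suc k) 0) (toℚᵘ-/ 1 k)) (*≡* eq)))
    where
    eq : (+ suc k ℤ.* + 1) ℤ.* + 1 ≡ + 1 ℤ.* + (suc k ℕ.+ 0)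
    eq = trans (ℤ.*-identityʳ (+ suc k ℤ.* + 1)) (trans (ℤ.*-comm (+ suc k) (+ 1)) (cong (λ m → + 1 ℤ.* + m) (sym (ℕ.+-identityʳ (suc k)))))

  fromℕ-mono-≤ : ∀ {m n} → m ℕ.≤ n → fromℕ m ≤ fromℕ n
  fromℕ-mono-≤ {m} {n} m≤n = toℚᵘ-cancel-≤ (ℚᵘ.≤-respˡ-≃ (ℚᵘ.≃-sym (toℚᵘ-/ m 0)) (ℚᵘ.≤-respʳ-≃ (ℚᵘ.≃-sym (toℚᵘ-/ n 0))
    (*≤* (ℤ.*-monoʳ-≤-nonNeg (+ 1) (ℤ.+≤+ m≤n)))))

  0≤/ : ∀ n d → 0ℚ ≤ + n / suc d
  0≤/ n d = toℚᵘ-cancel-≤ (ℚᵘ.≤-respʳ-≃ (ℚᵘ.≃-sym (toℚᵘ-/ n d)) (*≤* (ℤ.*-monoʳ-≤-nonNeg (+ 1) (ℤ.+≤+ {0} {n} ℕ.z≤n))))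

  *-mono-≤ : ∀ {p q r s} → 0ℚ ≤ p → p ≤ q → 0ℚ ≤ r → r ≤ s → p * r ≤ q * s
  *-mono-≤ {p} {q} {r} {s} 0≤p p≤q 0≤r r≤s = ≤-trans
    (*-monoʳ-≤-nonNeg r {{nonNegative 0≤r}} p≤q) (*-monoˡ-≤-nonNeg q {{nonNegative (≤-trans 0≤p p≤q)}} r≤s)

  *-nonneg : ∀ {p q} → 0ℚ ≤ p → 0ℚ ≤ q → 0ℚ ≤ p * q
  *-nonneg {p} {q} 0≤p 0≤q = subst (_≤ p * q) (*-zeroˡ q) (*-monoʳ-≤-nonNeg q {{nonNegative 0≤q}} 0≤p)

  expTerm-nonneg : ∀ {y} → 0ℚ ≤ y → ∀ k → 0ℚ ≤ expTerm y k
  expTerm-nonneg 0≤y zero    = 0≤/ 1 0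
  expTerm-nonneg 0≤y (suc k) = *-nonneg (*-nonneg (expTerm-nonneg 0≤y k) 0≤y) (0≤/ 1 k)

  expTerm-mono : ∀ {y z} → 0ℚ ≤ y → y ≤ z → ∀ k → expTerm y k ≤ expTerm z k
  expTerm-mono 0≤y y≤z zero    = ≤-refl
  expTerm-mono 0≤y y≤z (suc k) = *-monoʳ-≤-nonNeg (+ 1 / suc k) {{nonNegative (0≤/ 1 k)}}
    (*-mono-≤ (expTerm-nonneg 0≤y k) (expTerm-mono 0≤y y≤z k) 0≤y y≤z)

  expSum-mono : ∀ {y z} → 0ℚ ≤ y → y ≤ z → ∀ M → expSum y M ≤ expSum z M
  expSum-mono 0≤y y≤z zero    = ≤-refl
  expSum-mono 0≤y y≤z (suc M) = +-mono-≤ (expSum-mono 0≤y y≤z M) (expTerm-mono 0≤y y≤z (suc M))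

  module _ {y d : ℚ} (0≤y : 0ℚ ≤ y) (0≤d : 0ℚ ≤ d) where

    private
      s : ℚ
      s = y + d

      y≤s : y ≤ s
      y≤s = ≤-trans (≤-reflexive (sym (+-identityʳ y))) (+-monoʳ-≤ y 0≤d)

      0≤s : 0ℚ ≤ s
      0≤s = ≤-trans 0≤y y≤s

    -- The mean value inequality for y^k/k!.
    expTerm-step : ∀ k → expTerm s (suc k) ≤ expTerm y (suc k) + d * expTerm s k
    expTerm-step zero = ≤-reflexive (lem y d)
      where
      lem : ∀ y d → 1ℚ * (y + d) * 1ℚ ≡ 1ℚ * y * 1ℚ + d * 1ℚ
      lem = solve 2 (λ y d → con 1ℚ :* (y :+ d) :* con 1ℚ := con 1ℚ :* y :* con 1ℚ :+ d :* con 1ℚ) refl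
    expTerm-step (suc k) = begin
      expTerm s (suc k) * (y + d) * i
        ≡⟨ lem₁ (expTerm s (suc k)) y d i ⟩
      expTerm s (suc k) * (y * i) + d * (expTerm s (suc k) * i)
        ≤⟨ +-monoˡ-≤ (d * (expTerm s (suc k) * i)) (*-monoʳ-≤-nonNeg (y * i) {{nonNegative (*-nonneg 0≤y (0≤/ 1 (suc k)))}} (expTerm-step k)) ⟩
      (expTerm y (suc k) + d * expTerm s k) * (y * i) + d * (expTerm s (suc k) * i)
        ≡⟨ lem₂ (expTerm y (suc k)) (expTerm s k) (expTerm s (suc k)) y d i ⟩
      expTerm y (suc k) * y * i + d * ((expTerm s k * y + expTerm s (suc k)) * i)
        -- Replacing y by s in the bracket gives s^(k+1)/k! = (k+1) s^(k+1)/(k+1)!. Together with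
        -- the second summand this is k + 2 copies of one term, which the factor 1/(k+2) undoes.
        ≤⟨ +-monoʳ-≤ (expTerm y (suc k) * y * i) (*-monoˡ-≤-nonNeg d {{nonNegative 0≤d}} (*-monoʳ-≤-nonNeg i {{nonNegative (0≤/ 1 (suc k))}}
             (+-monoˡ-≤ (expTerm s (suc k)) (≤-trans (*-monoˡ-≤-nonNeg (expTerm s k) {{nonNegative (expTerm-nonneg 0≤s k)}} y≤s) (≤-reflexive ts))))) ⟩
      expTerm y (suc k) * y * i + d * ((fromℕ (suc k) * expTerm s (suc k) + expTerm s (suc k)) * i)
        ≡⟨ cong (λ w → expTerm y (suc k) * y * i + d * w) collapse ⟩
      expTerm y (suc (suc k)) + d * expTerm s (suc k) ∎
      where
      open ≤-Reasoning
      i : ℚ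
      i = + 1 / suc (suc k)
      lem₁ : ∀ t y d i → t * (y + d) * i ≡ t * (y * i) + d * (t * i)
      lem₁ = solve 4 (λ t y d i → t :* (y :+ d) :* i := t :* (y :* i) :+ d :* (t :* i)) refl
      lem₂ : ∀ a b c y d i → (a + d * b) * (y * i) + d * (c * i) ≡ a * y * i + d * ((b * y + c) * i)
      lem₂ = solve 6 (λ a b c y d i → (a :+ d :* b) :* (y :* i) :+ d :* (c :* i) := a :* y :* i :+ d :* ((b :* y :+ c) :* i)) refl
      lem₃ : ∀ t s n i → t * s * (n * i) ≡ n * (t * s * i)
      lem₃ = solve 4 (λ t s n i → t :* s :* (n :* i) := n :* (t :* s :* i)) refl
      lem₄ : ∀ n t i → (n * t + t) * i ≡ t * ((n + 1ℚ) * i)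
      lem₄ = solve 3 (λ n t i → (n :* t :+ t) :* i := t :* ((n :+ con 1ℚ) :* i)) refl
      ts : expTerm s k * s ≡ fromℕ (suc k) * expTerm s (suc k)
      ts = trans (sym (*-identityʳ (expTerm s k * s))) (trans (cong (λ w → expTerm s k * s * w) (sym (fromℕ-inverse k)))
        (lem₃ (expTerm s k) s (fromℕ (suc k)) (+ 1 / suc k)))
      collapse : (fromℕ (suc k) * expTerm s (suc k) + expTerm s (suc k)) * i ≡ expTerm s (suc k)
      collapse = trans (lem₄ (fromℕ (suc k)) (expTerm s (suc k)) i)
        (trans (cong (λ w → expTerm s (suc k) * w) (trans (cong (_* i) (trans (fromℕ-+ (suc k) 1) (cong fromℕ (ℕ.+-comm (suc k) 1)))) (fromℕ-inverse (suc k))))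
          (*-identityʳ (expTerm s (suc k))))

    expSum-step : ∀ M → expSum s M ≤ expSum y M + d * expSum s M
    expSum-step zero    = ≤-trans (≤-reflexive (sym (+-identityʳ 1ℚ))) (+-monoʳ-≤ 1ℚ (*-nonneg 0≤d (0≤/ 1 0)))
    expSum-step (suc M) = ≤-trans (shifted M) (+-monoʳ-≤ (expSum y (suc M)) (*-monoˡ-≤-nonNeg d {{nonNegative 0≤d}}
        (≤-trans (≤-reflexive (sym (+-identityʳ (expSum s M)))) (+-monoʳ-≤ (expSum s M) (expTerm-nonneg 0≤s (suc M))))))
      where
      lem : ∀ a b c d e → (a + d * b) + (c + d * e) ≡ (a + c) + d * (b + e)
      lem = solve 5 (λ a b c d e → (a :+ d :* b) :+ (c :+ d :* e) := (a :+ c) :+ d :* (b :+ e)) refl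
      shifted : ∀ M → expSum s (suc M) ≤ expSum y (suc M) + d * expSum s M
      shifted zero    = ≤-trans (+-monoʳ-≤ 1ℚ (expTerm-step 0)) (≤-reflexive (sym (+-assoc 1ℚ (expTerm y 1) (d * 1ℚ))))
      shifted (suc M) = ≤-trans (+-mono-≤ (shifted M) (expTerm-step (suc M)))
        (≤-reflexive (lem (expSum y (suc M)) (expSum s M) (expTerm y (suc (suc M))) d (expTerm s (suc M))))

  -- For d = ½ the inequality `expSum-step` can be solved for its left side, with factor 1/(1 - ½) =
  -- 2 for every M. Two half steps show that e may be replaced by 4, which costs only a constant.
  expSum-½ : ∀ {y} → 0ℚ ≤ y → ∀ M → expSum (y + ½) M ≤ expSum y M + expSum y M
  expSum-½ {y} 0≤y M = begin
    e                                ≡⟨ lem₁ e ⟩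
    (e + - (½ * e)) + (e + - (½ * e)) ≤⟨ +-mono-≤ half half ⟩
    expSum y M + expSum y M          ∎
    where
    open ≤-Reasoning
    e : ℚ
    e = expSum (y + ½) M
    lem₁ : ∀ e → e ≡ (e + - (½ * e)) + (e + - (½ * e))
    lem₁ = solve 1 (λ e → e := (e :+ :- (con ½ :* e)) :+ (e :+ :- (con ½ :* e))) refl
    lem₂ : ∀ a b → (a + b) + - b ≡ a
    lem₂ = solve 2 (λ a b → (a :+ b) :+ :- b := a) refl
    half : e + - (½ * e) ≤ expSum y M
    half = ≤-trans (+-monoˡ-≤ (- (½ * e)) (expSum-step 0≤y (0≤/ 1 1) M)) (≤-reflexive (lem₂ (expSum y M) (½ * e)))

  expSum-0 : ∀ M → expSum 0ℚ M ≡ 1ℚ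
  expSum-0 zero    = refl
  expSum-0 (suc M) = trans (cong₂ _+_ (expSum-0 M) (trans (cong (_* (+ 1 / suc M)) (*-zeroʳ (expTerm 0ℚ M))) (*-zeroˡ (+ 1 / suc M)))) (+-identityʳ 1ℚ)

  expSum-fromℕ : ∀ l M → expSum (fromℕ l) M ≤ fromℕ (4 ℕ.^ l)
  expSum-fromℕ zero    M = ≤-reflexive (expSum-0 M)
  expSum-fromℕ (suc l) M = begin
    expSum (fromℕ (suc l)) M                  ≡⟨ cong (λ y → expSum y M) (trans (cong fromℕ (ℕ.+-comm 1 l)) (trans (sym (fromℕ-+ l 1)) (sym (+-assoc (fromℕ l) ½ ½)))) ⟩
    expSum (fromℕ l + ½ + ½) M                ≤⟨ expSum-½ (≤-trans (0≤/ l 0) (≤-trans (≤-reflexive (sym (+-identityʳ (fromℕ l)))) (+-monoʳ-≤ (fromℕ l) (0≤/ 1 1)))) M ⟩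
    expSum (fromℕ l + ½) M + expSum (fromℕ l + ½) M
      ≤⟨ +-mono-≤ (expSum-½ (0≤/ l 0) M) (expSum-½ (0≤/ l 0) M) ⟩
    expSum (fromℕ l) M + expSum (fromℕ l) M + (expSum (fromℕ l) M + expSum (fromℕ l) M)
      ≤⟨ +-mono-≤ (+-mono-≤ ih ih) (+-mono-≤ ih ih) ⟩
    f + f + (f + f)                           ≡⟨ trans (cong₂ _+_ (fromℕ-+ p p) (fromℕ-+ p p)) (trans (fromℕ-+ (p ℕ.+ p) (p ℕ.+ p)) (cong fromℕ (lem p))) ⟩
    fromℕ (4 ℕ.^ suc l)                       ∎
    where
    open ≤-Reasoning
    p : ℕ
    p = 4 ℕ.^ l
    f : ℚ
    f = fromℕ p
    ih = expSum-fromℕ l M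
    lem : ∀ p → p ℕ.+ p ℕ.+ (p ℕ.+ p) ≡ 4 ℕ.* p
    lem = ℕ-solve

  -- With F = k + 1 the hypotheses give cx/F ≤ l, so the exponential sum is at most 4^l ≤ x. The
  -- integer l takes the place of a logarithm of x.
  expSum-quotient : ∀ {c K x k l} M → 0ℚ ≤ c → c ≤ fromℕ K → K ℕ.* x ℕ.≤ l ℕ.* suc k → 4 ℕ.^ l ℕ.≤ x →
    expSum (c * (+ x / 1) * (+ 1 / suc k)) M ≤ + x / 1
  expSum-quotient {c} {K} {x} {k} {l} M 0≤c c≤K Kx≤ 4ˡ≤x = ≤-trans (expSum-mono nonneg bound M)
    (≤-trans (expSum-fromℕ l M) (fromℕ-mono-≤ 4ˡ≤x))
    where
    open ≤-Reasoning
    i : ℚ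
    i = + 1 / suc k
    nonneg : 0ℚ ≤ c * fromℕ x * i
    nonneg = *-nonneg (*-nonneg 0≤c (0≤/ x 0)) (0≤/ 1 k)
    bound : c * fromℕ x * i ≤ fromℕ l
    bound = begin
      c * fromℕ x * i              ≤⟨ *-monoʳ-≤-nonNeg i {{nonNegative (0≤/ 1 k)}} (*-monoʳ-≤-nonNeg (fromℕ x) {{nonNegative (0≤/ x 0)}} c≤K) ⟩
      fromℕ K * fromℕ x * i        ≡⟨ cong (_* i) (fromℕ-* K x) ⟩
      fromℕ (K ℕ.* x) * i          ≤⟨ *-monoʳ-≤-nonNeg i {{nonNegative (0≤/ 1 k)}} (fromℕ-mono-≤ Kx≤) ⟩
      fromℕ (l ℕ.* suc k) * i      ≡⟨ cong (_* i) (sym (fromℕ-* l (suc k))) ⟩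
      fromℕ l * fromℕ (suc k) * i  ≡⟨ *-assoc (fromℕ l) (fromℕ (suc k)) i ⟩
      fromℕ l * (fromℕ (suc k) * i) ≡⟨ cong (fromℕ l *_) (fromℕ-inverse k) ⟩
      fromℕ l * 1ℚ                 ≡⟨ *-identityʳ (fromℕ l) ⟩
      fromℕ l                      ∎

  archimedean : ∀ c → c ≤ fromℕ ℤ.∣ ↥ c ∣
  archimedean c@(mkℚ n d _) = toℚᵘ-cancel-≤ (ℚᵘ.≤-respʳ-≃ (ℚᵘ.≃-sym (toℚᵘ-/ ℤ.∣ n ∣ 0)) (*≤* (le n)))
    where
    le : ∀ n → n ℤ.* + 1 ℤ.≤ + ℤ.∣ n ∣ ℤ.* + suc d
    le (+ n) = subst₂ ℤ._≤_ (ℤ.pos-* n 1) (ℤ.pos-* n (suc d)) (ℤ.+≤+ (ℕ.*-monoʳ-≤ n (ℕ.s≤s ℕ.z≤n)))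
    le (ℤ.-[1+ n ]) = ℤ.≤-trans ℤ.-≤+ (subst (ℤ._≤_ (+ 0)) (ℤ.pos-* (suc n) (suc d)) (ℤ.+≤+ ℕ.z≤n))

-- The block estimate with Chebyshev's bound inserted.

module Summation where

  open import Data.Nat using (_^_)
  open import Data.Nat.Primality using (Prime; prime?)
  open import Data.Integer as ℤ using (ℤ; +_; _+_; _*_; _≤_; +≤+; 0ℤ; 1ℤ)
  open import Data.Integer.Properties hiding (_≤?_; _<?_; _≟_)
  open Sums
  open Chebyshev using (π; π-∑; chebyshev)
  open Variance using (isP; *-nonneg; *-mono-≤)
  open Block
  open Counting

  ∑-≤-count : ∀ N {f} → (∀ n → n ℕ.< N → f n ≤ 1ℤ) → ∑ N f ≤ + N
  ∑-≤-count N f≤1 = ≤-trans (∑-mono N f≤1) (≤-reflexive (trans (∑-const N 1ℤ) (*-identityʳ (+ N))))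

  ∑-below : ∀ N K → ∑ N (λ n → ⟦ n ℕ.<? K ⟧) ≤ + K
  ∑-below N K = by (ℕ.≤-total N K)
    where
    by : N ℕ.≤ K ⊎ K ℕ.≤ N → ∑ N (λ n → ⟦ n ℕ.<? K ⟧) ≤ + K
    by (inj₁ N≤K) = ≤-trans (∑-≤-count N (λ n _ → ⟦⟧≤1 (n ℕ.<? K))) (+≤+ N≤K)
    by (inj₂ K≤N) = begin
      ∑ N (λ n → ⟦ n ℕ.<? K ⟧)
        ≡⟨ cong (λ m → ∑ m (λ n → ⟦ n ℕ.<? K ⟧)) (sym (ℕ.m+[n∸m]≡n K≤N)) ⟩
      ∑ (K ℕ.+ (N ∸ K)) (λ n → ⟦ n ℕ.<? K ⟧)
        ≡⟨ ∑-split K (N ∸ K) (λ n → ⟦ n ℕ.<? K ⟧) ⟩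
      ∑ K (λ n → ⟦ n ℕ.<? K ⟧) + ∑ (N ∸ K) (λ n → ⟦ K ℕ.+ n ℕ.<? K ⟧)
        ≤⟨ +-mono-≤ (∑-≤-count K (λ n _ → ⟦⟧≤1 (n ℕ.<? K)))
             (≤-reflexive (∑-zero (N ∸ K) (λ n _ → ⟦⟧-no (K ℕ.+ n ℕ.<? K) (ℕ.m+n≮m K n)))) ⟩
      + K + 0ℤ
        ≡⟨ +-identityʳ (+ K) ⟩
      + K ∎
      where open ≤-Reasoning

  π≤ : ∀ n → π n ℕ.≤ n
  π≤ n = drop‿+≤+ (≤-trans (≤-reflexive (π-∑ n)) (∑-≤-count n (λ i _ → ⟦⟧≤1 (prime? i))))

  module _ (L U N : ℕ) (1≤L : 1 ℕ.≤ L) (1≤U : 1 ℕ.≤ U) where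

    private
      Y′ k : ℕ
      Y′ = 8 ℕ.* U
      k = K U N 1≤U
      a′ Z′ C′ l n : ℤ
      a′ = a U N 1≤U
      Z′ = Z U N 1≤U
      C′ = C U N 1≤U
      l = + L
      n = + N

    a-π : a′ + + π Y′ ≡ + π (2 ℕ.* Y′)
    a-π = begin
      a′ + + π Y′                          ≡⟨ +-comm a′ (+ π Y′) ⟩
      + π Y′ + a′                          ≡⟨ cong (_+ a′) (π-∑ Y′) ⟩
      ∑ Y′ isP + a′                        ≡⟨ sym (∑-split Y′ Y′ isP) ⟩
      ∑ (Y′ ℕ.+ Y′) isP                    ≡⟨ cong (λ m → ∑ (Y′ ℕ.+ m) isP) (sym (ℕ.+-identityʳ Y′)) ⟩
      ∑ (2 ℕ.* Y′) isP                     ≡⟨ sym (π-∑ (2 ℕ.* Y′)) ⟩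
      + π (2 ℕ.* Y′)                       ∎
      where open ≡-Reasoning

    a≤k : a′ ≤ + k
    a≤k = ≤-trans (∑-≤-count Y′ (λ t _ → ⟦⟧≤1 (prime? (Y′ ℕ.+ t)))) (+≤+ (ℕ.m≤m+n Y′ (Y′ ℕ.+ 0)))

    π≤Z+k : + π N ≤ Z′ + + k
    π≤Z+k = begin
      + π N                                                   ≡⟨ π-∑ N ⟩
      ∑ N isP                                                 ≤⟨ ∑-mono N (λ m _ → split m (prime? m) (k ℕ.≤? m) (m ℕ.<? k)) ⟩
      ∑ N (λ m → isP m * ⟦ k ℕ.≤? m ⟧ + ⟦ m ℕ.<? k ⟧)         ≡⟨ ∑-+ N (λ m → isP m * ⟦ k ℕ.≤? m ⟧) (λ m → ⟦ m ℕ.<? k ⟧) ⟩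
      Z′ + ∑ N (λ m → ⟦ m ℕ.<? k ⟧)                           ≤⟨ +-monoʳ-≤ Z′ (∑-below N k) ⟩
      Z′ + + k                                                ∎
      where
      open ≤-Reasoning
      split : ∀ m (d : Dec (Prime m)) (e : Dec (k ℕ.≤ m)) (e′ : Dec (m ℕ.< k)) → ⟦ d ⟧ ≤ ⟦ d ⟧ * ⟦ e ⟧ + ⟦ e′ ⟧
      split m (no _)  e       e′      = ≤-trans (0≤⟦⟧ e′) (≤-reflexive (trans (sym (+-identityˡ ⟦ e′ ⟧)) (cong (_+ ⟦ e′ ⟧) (sym (*-zeroˡ ⟦ e ⟧)))))
      split m (yes _) (yes _) (yes _) = +≤+ (s≤s z≤n)
      split m (yes _) (yes _) (no _)  = ≤-refl
      split m (yes _) (no _)  (yes _) = ≤-refl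
      split m (yes _) (no k≰) (no m≮) = ⊥-elim (m≮ (ℕ.≰⇒> k≰))

    -- Multiply N ≤ 2 + L(Z + k) by a ≤ k and insert `block`. The terms apart from 512 L N add up to
    -- at most (2 + 1 + 512) L k³ = 515 L k³, which the size condition makes at most L N; hence 513.
    block-estimate : N ℕ.≤ 2 ^ L → 515 ℕ.* (k ℕ.* (k ℕ.* k)) ℕ.≤ N → a′ * n ≤ + 32 * (l * C′) + + 513 * (l * n)
    block-estimate N≤2ᴸ small = begin
      a′ * n
        ≤⟨ *-monoˡ-≤-nonNeg a′ {{ℤ.nonNegative 0≤a}} N≤ ⟩
      a′ * (+ 2 + l * (Z′ + + k))
        ≡⟨ lem₁ a′ l Z′ (+ k) ⟩
      l * (a′ * Z′) + a′ * (+ 2 + l * + k)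
        ≤⟨ +-monoˡ-≤ (a′ * (+ 2 + l * + k)) (*-monoˡ-≤-nonNeg l (block U N 1≤U)) ⟩
      l * (+ 32 * C′ + + 512 * n + + 512 * (a′ * + (k ℕ.* k))) + a′ * (+ 2 + l * + k)
        ≡⟨ lem₂ a′ l C′ n (+ k) (+ (k ℕ.* k)) ⟩
      + 32 * (l * C′) + + 512 * (l * n) + a′ * (+ 2 + l * + k + + 512 * (l * + (k ℕ.* k)))
        ≤⟨ +-monoʳ-≤ (+ 32 * (l * C′) + + 512 * (l * n)) error ⟩
      + 32 * (l * C′) + + 512 * (l * n) + l * n
        ≡⟨ lem₃ (l * C′) (l * n) ⟩
      + 32 * (l * C′) + + 513 * (l * n) ∎
      where
      open ≤-Reasoning
      0≤a : 0ℤ ≤ a′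
      0≤a = a-nonneg U N 1≤U
      N≤ : n ≤ + 2 + l * (Z′ + + k)
      N≤ = ≤-trans (+≤+ (chebyshev N L N≤2ᴸ)) (≤-trans (≤-reflexive (cong (λ w → + 2 + w) (pos-* L (π N))))
        (+-monoʳ-≤ (+ 2) (*-monoˡ-≤-nonNeg l π≤Z+k)))
      lem₁ : ∀ a l z k → a * (+ 2 + l * (z + k)) ≡ l * (a * z) + a * (+ 2 + l * k)
      lem₁ = ℤ-solve
      lem₂ : ∀ a l c n k k² → l * (+ 32 * c + + 512 * n + + 512 * (a * k²)) + a * (+ 2 + l * k)
        ≡ + 32 * (l * c) + + 512 * (l * n) + a * (+ 2 + l * k + + 512 * (l * k²))
      lem₂ = ℤ-solve
      lem₃ : ∀ c n → + 32 * c + + 512 * n + n ≡ + 32 * c + + 513 * n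
      lem₃ = ℤ-solve
      1≤k : 1 ℕ.≤ k
      1≤k = ℕ.*-mono-≤ {1} {2} (s≤s z≤n) (ℕ.*-mono-≤ {1} {8} (s≤s z≤n) 1≤U)
      factor : 2 ℕ.+ L ℕ.* k ℕ.+ 512 ℕ.* (L ℕ.* (k ℕ.* k)) ℕ.≤ 515 ℕ.* (L ℕ.* (k ℕ.* k))
      factor = ℕ.≤-trans (ℕ.+-monoˡ-≤ (512 ℕ.* (L ℕ.* (k ℕ.* k))) (ℕ.+-mono-≤
          (ℕ.*-monoʳ-≤ 2 {1} {L ℕ.* (k ℕ.* k)} (ℕ.*-mono-≤ 1≤L (ℕ.*-mono-≤ 1≤k 1≤k)))
          (ℕ.*-monoʳ-≤ L (ℕ.m≤m*n k k {{ℕ.>-nonZero 1≤k}}))))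
        (ℕ.≤-reflexive (lem (L ℕ.* (k ℕ.* k))))
        where
        lem : ∀ m → 2 ℕ.* m ℕ.+ m ℕ.+ 512 ℕ.* m ≡ 515 ℕ.* m
        lem = ℕ-solve
      casted : + 2 + l * + k + + 512 * (l * + (k ℕ.* k)) ≡ + (2 ℕ.+ L ℕ.* k ℕ.+ 512 ℕ.* (L ℕ.* (k ℕ.* k)))
      casted = cong₂ _+_ (cong (λ w → + 2 + w) (sym (pos-* L k)))
        (trans (cong (+ 512 *_) (sym (pos-* L (k ℕ.* k)))) (sym (pos-* 512 (L ℕ.* (k ℕ.* k)))))
      error : a′ * (+ 2 + l * + k + + 512 * (l * + (k ℕ.* k))) ≤ l * n
      error = begin
        a′ * (+ 2 + l * + k + + 512 * (l * + (k ℕ.* k)))        ≡⟨ cong (a′ *_) casted ⟩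
        a′ * + (2 ℕ.+ L ℕ.* k ℕ.+ 512 ℕ.* (L ℕ.* (k ℕ.* k)))    ≤⟨ *-mono-≤ {a′} {+ k} 0≤a a≤k (+≤+ z≤n) (+≤+ factor) ⟩
        + k * + (515 ℕ.* (L ℕ.* (k ℕ.* k)))                     ≡⟨ sym (pos-* k (515 ℕ.* (L ℕ.* (k ℕ.* k)))) ⟩
        + (k ℕ.* (515 ℕ.* (L ℕ.* (k ℕ.* k))))                   ≤⟨ +≤+ (ℕ.≤-trans (ℕ.≤-reflexive (lem k L)) (ℕ.*-monoʳ-≤ L small)) ⟩
        + (L ℕ.* N)                                             ≡⟨ pos-* L N ⟩
        l * n                                                   ∎
        where
        lem : ∀ k L → k ℕ.* (515 ℕ.* (L ℕ.* (k ℕ.* k))) ≡ L ℕ.* (515 ℕ.* (k ℕ.* (k ℕ.* k)))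
        lem = ℕ-solve

-- Summation over dyadic blocks.

module Scales where

  open import Defs using (F)
  open import Data.Nat using (_^_)
  open import Data.Integer as ℤ using (ℤ; +_; -_; _+_; _-_; _*_; _≤_; +≤+; 0ℤ)
  open import Data.Integer.Properties hiding (_≤?_; _<?_; _≟_)
  open Sums
  open Chebyshev using (π; chebyshev)
  open Variance using (isP; *-nonneg; *-mono-≤)
  open Block
  open Counting
  open Summation

  1≤2^ : ∀ i → 1 ℕ.≤ 2 ^ i
  1≤2^ i = ℕ.>-nonZero⁻¹ (2 ^ i) {{ℕ.m^n≢0 2 i}}

  -- Here k = 2^(4+i), so the size condition of `block-estimate` becomes linear in i.
  cube-bound : ∀ {c s i T} → c ℕ.≤ 2 ^ s → s ℕ.+ ((4 ℕ.+ i) ℕ.+ ((4 ℕ.+ i) ℕ.+ (4 ℕ.+ i))) ℕ.+ i ℕ.≤ T →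
    let k = 2 ℕ.* (8 ℕ.* 2 ^ i) in c ℕ.* (k ℕ.* (k ℕ.* k)) ℕ.≤ 2 ^ (T ∸ i)
  cube-bound {c} {s} {i} {T} c≤ le = begin
    c ℕ.* (k ℕ.* (k ℕ.* k))              ≤⟨ ℕ.*-monoˡ-≤ (k ℕ.* (k ℕ.* k)) c≤ ⟩
    2 ^ s ℕ.* (k ℕ.* (k ℕ.* k))          ≡⟨ cong (λ k → 2 ^ s ℕ.* (k ℕ.* (k ℕ.* k))) (k≡ (2 ^ i)) ⟩
    2 ^ s ℕ.* (2 ^ e ℕ.* (2 ^ e ℕ.* 2 ^ e)) ≡⟨ cong (2 ^ s ℕ.*_) (cong (2 ^ e ℕ.*_) (sym (ℕ.^-distribˡ-+-* 2 e e))) ⟩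
    2 ^ s ℕ.* (2 ^ e ℕ.* 2 ^ (e ℕ.+ e))  ≡⟨ cong (2 ^ s ℕ.*_) (sym (ℕ.^-distribˡ-+-* 2 e (e ℕ.+ e))) ⟩
    2 ^ s ℕ.* 2 ^ (e ℕ.+ (e ℕ.+ e))      ≡⟨ sym (ℕ.^-distribˡ-+-* 2 s (e ℕ.+ (e ℕ.+ e))) ⟩
    2 ^ (s ℕ.+ (e ℕ.+ (e ℕ.+ e)))        ≤⟨ ℕ.^-monoʳ-≤ 2 (ℕ.m+n≤o⇒m≤o∸n (s ℕ.+ (e ℕ.+ (e ℕ.+ e))) le) ⟩
    2 ^ (T ∸ i)                          ∎
    where
    open ℕ.≤-Reasoning
    k e : ℕ
    k = 2 ℕ.* (8 ℕ.* 2 ^ i)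
    e = 4 ℕ.+ i
    k≡ : ∀ u → 2 ℕ.* (8 ℕ.* u) ≡ 2 ℕ.* (2 ℕ.* (2 ℕ.* (2 ℕ.* u)))
    k≡ = ℕ-solve

  module _ (T x : ℕ) (2ᴸ≤x : 2 ^ (6 ℕ.+ T) ℕ.≤ x) where

    private
      L : ℕ
      L = 6 ℕ.+ T

      N : ℕ → ℕ
      N i = 2 ^ (T ∸ i)

      A C′ : ℕ → ℤ
      A i  = a (2 ^ i) (N i) (1≤2^ i)
      C′ i = C (2 ^ i) (N i) (1≤2^ i)

      P : ℕ → ℕ
      P i = π (8 ℕ.* 2 ^ i)

      N-suc : ∀ i → i ℕ.< T → N i ≡ 2 ℕ.* N (suc i)
      N-suc i i<T = cong (2 ^_) (trans (sym (ℕ.m∸n+n≡m {T ∸ i} {1} (ℕ.m<n⇒0<n∸m i<T)))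
        (trans (ℕ.+-comm (T ∸ i ∸ 1) 1) (cong suc (trans (ℕ.∸-+-assoc T i 1) (cong (T ∸_) (ℕ.+-comm i 1))))))

      2^*N : ∀ i → i ℕ.≤ T → 2 ^ i ℕ.* N i ≡ 2 ^ T
      2^*N i i≤T = trans (sym (ℕ.^-distribˡ-+-* 2 i (T ∸ i))) (cong (2 ^_) (ℕ.m+[n∸m]≡n i≤T))

      N≤2ᵀ : ∀ i → N i ℕ.≤ 2 ^ T
      N≤2ᵀ i = ℕ.^-monoʳ-≤ 2 (ℕ.m∸n≤m T i)

    module _ (b : ℕ) where

      -- The blocks [8·2^i, 16·2^i) are adjacent, so after enlarging all ranges of n to 2^T their
      -- sums join into a single sum over q, to which `∑-good-≤-F` applies once.
      ∑C-≤-F : ∀ m → b ℕ.+ m ℕ.≤ T → ∑ m (λ i → C′ (b ℕ.+ i)) ≤ + F x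
      ∑C-≤-F m b+m≤T = ≤-trans (below m b+m≤T) (∑-good-≤-F (8 ℕ.* 2 ^ (b ℕ.+ m)) (2 ^ T) x)
        where
        D : ℕ → ℤ
        D q = ∑ (2 ^ T) (λ n → ⟦ good? x q n ⟧)
        extend : ∀ M M′ (f : ℕ → ℤ) → M ℕ.≤ M′ → (∀ n → 0ℤ ≤ f n) → ∑ M f ≤ ∑ M′ f
        extend M M′ f M≤M′ 0≤f = subst (λ m → ∑ M f ≤ ∑ m f) (ℕ.m+[n∸m]≡n M≤M′)
          (≤-trans (≤-reflexive (sym (+-identityʳ (∑ M f)))) (≤-trans (+-monoʳ-≤ (∑ M f) (∑-nonneg (M′ ∸ M) (λ i _ → 0≤f (M ℕ.+ i))))
            (≤-reflexive (sym (∑-split M (M′ ∸ M) f)))))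
        fits : ∀ i → i ℕ.≤ T → 3 ℕ.* K (2 ^ i) (N i) (1≤2^ i) ℕ.* N i ℕ.≤ x
        -- Here 3KN = 48·2^T ≤ 2^(6+T); this is the origin of the 6 in `L`.
        fits i i≤T = ℕ.≤-trans (ℕ.≤-reflexive (trans (lem (2 ^ i) (N i)) (cong (48 ℕ.*_) (2^*N i i≤T))))
          (ℕ.≤-trans (ℕ.*-monoˡ-≤ (2 ^ T) {48} {64} (ℕ.m≤m+n 48 16)) (ℕ.≤-trans (ℕ.≤-reflexive (sym (ℕ.^-distribˡ-+-* 2 6 T))) 2ᴸ≤x))
          where
          lem : ∀ u n → 3 ℕ.* (2 ℕ.* (8 ℕ.* u)) ℕ.* n ≡ 48 ℕ.* (u ℕ.* n)
          lem = ℕ-solve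
        below : ∀ m → b ℕ.+ m ℕ.≤ T → ∑ m (λ i → C′ (b ℕ.+ i)) ≤ ∑ (8 ℕ.* 2 ^ (b ℕ.+ m)) D
        below zero    _     = ∑-nonneg (8 ℕ.* 2 ^ (b ℕ.+ 0)) (λ q _ → ∑-nonneg (2 ^ T) (λ n _ → 0≤⟦⟧ (good? x q n)))
        below (suc m) b+m<T = begin
          ∑ m (λ i → C′ (b ℕ.+ i)) + C′ i
            ≤⟨ +-mono-≤ (below m (ℕ.≤-trans (ℕ.+-monoʳ-≤ b (ℕ.n≤1+n m)) b+m<T))
                 (≤-trans (C-≤-good (2 ^ i) (N i) x (1≤2^ i) (fits i i≤T))
                   (∑-mono Y′ (λ t _ → extend (N i) (2 ^ T) (λ n → ⟦ good? x (Y′ ℕ.+ t) n ⟧) (N≤2ᵀ i) (λ n → 0≤⟦⟧ (good? x (Y′ ℕ.+ t) n))))) ⟩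
          ∑ Y′ D + ∑ Y′ (λ t → D (Y′ ℕ.+ t))
            ≡⟨ sym (∑-split Y′ Y′ D) ⟩
          ∑ (Y′ ℕ.+ Y′) D
            ≡⟨ cong (λ w → ∑ w D) (trans (lem (2 ^ i)) (cong (λ e → 8 ℕ.* 2 ^ e) (sym (ℕ.+-suc b m)))) ⟩
          ∑ (8 ℕ.* 2 ^ (b ℕ.+ suc m)) D ∎
          where
          open ≤-Reasoning
          i Y′ : ℕ
          i = b ℕ.+ m
          Y′ = 8 ℕ.* 2 ^ i
          i≤T : i ℕ.≤ T
          i≤T = ℕ.≤-trans (ℕ.+-monoʳ-≤ b (ℕ.n≤1+n m)) b+m<T
          lem : ∀ u → 8 ℕ.* u ℕ.+ 8 ℕ.* u ≡ 8 ℕ.* (2 ℕ.* u)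
          lem = ℕ-solve

      ∑N-≤ : ∀ m → b ℕ.+ m ℕ.≤ T → ∑ m (λ i → + N (b ℕ.+ i)) ≤ + (2 ℕ.* N b)
      ∑N-≤ m b+m≤T = ≤-trans (≤-trans (≤-reflexive (sym (+-identityʳ S))) (+-monoʳ-≤ S (+≤+ z≤n)))
          (≤-reflexive (exact m b+m≤T))
        where
        S : ℤ
        S = ∑ m (λ i → + N (b ℕ.+ i))
        exact : ∀ m → b ℕ.+ m ℕ.≤ T → ∑ m (λ i → + N (b ℕ.+ i)) + + (2 ℕ.* N (b ℕ.+ m)) ≡ + (2 ℕ.* N b)
        exact zero    _ = trans (+-identityˡ _) (cong (λ j → + (2 ℕ.* N j)) (ℕ.+-identityʳ b))
        exact (suc m) b+m<T = trans (trans (+-assoc (∑ m (λ i → + N (b ℕ.+ i))) (+ N (b ℕ.+ m)) (+ (2 ℕ.* N (b ℕ.+ suc m))))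
            (cong (λ w → ∑ m (λ i → + N (b ℕ.+ i)) + + w) step)) (exact m (ℕ.<⇒≤ b+m<T′))
          where
          b+m<T′ : b ℕ.+ m ℕ.< T
          b+m<T′ = ℕ.≤-trans (ℕ.≤-reflexive (sym (ℕ.+-suc b m))) b+m<T
          step : N (b ℕ.+ m) ℕ.+ 2 ℕ.* N (b ℕ.+ suc m) ≡ 2 ℕ.* N (b ℕ.+ m)
          step = trans (cong (λ j → N (b ℕ.+ m) ℕ.+ 2 ℕ.* N j) (ℕ.+-suc b m))
            (trans (cong (N (b ℕ.+ m) ℕ.+_) (sym (N-suc (b ℕ.+ m) b+m<T′))) (cong (N (b ℕ.+ m) ℕ.+_) (sym (ℕ.+-identityʳ (N (b ℕ.+ m))))))

      Q : ℕ → ℤ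
      Q i = + (P i ℕ.* N i)

      -- Abel summation: A i N i = 2 P (i+1) N (i+1) - P i N i.
      abel : ∀ m → b ℕ.+ m ℕ.≤ T →
        ∑ m (λ i → A (b ℕ.+ i) * + N (b ℕ.+ i)) + Q b ≡ ∑ m (λ i → Q (suc (b ℕ.+ i))) + Q (b ℕ.+ m)
      abel zero    _ = cong (λ j → 0ℤ + Q j) (sym (ℕ.+-identityʳ b))
      abel (suc m) b+m<T = begin
        S + A i * + N i + Q b           ≡⟨ lem S (A i * + N i) (Q b) ⟩
        S + Q b + A i * + N i           ≡⟨ cong (_+ A i * + N i) (abel m (ℕ.<⇒≤ i<T)) ⟩
        S′ + Q i + A i * + N i          ≡⟨ lem′ S′ (Q i) (A i * + N i) ⟩
        S′ + (A i * + N i + Q i)        ≡⟨ cong (λ w → S′ + w) step ⟩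
        S′ + (Q (suc i) + Q (suc i))    ≡⟨ sym (+-assoc S′ (Q (suc i)) (Q (suc i))) ⟩
        S′ + Q (suc i) + Q (suc i)      ≡⟨ cong (λ j → S′ + Q (suc i) + Q j) (sym (ℕ.+-suc b m)) ⟩
        S′ + Q (suc i) + Q (b ℕ.+ suc m) ∎
        where
        open ≡-Reasoning
        i : ℕ
        i = b ℕ.+ m
        S S′ : ℤ
        S = ∑ m (λ i → A (b ℕ.+ i) * + N (b ℕ.+ i))
        S′ = ∑ m (λ i → Q (suc (b ℕ.+ i)))
        i<T : i ℕ.< T
        i<T = ℕ.≤-trans (ℕ.≤-reflexive (sym (ℕ.+-suc b m))) b+m<T
        lem : ∀ a b c → a + b + c ≡ a + c + b
        lem = ℤ-solve
        lem′ : ∀ a b c → a + b + c ≡ a + (c + b)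
        lem′ = ℤ-solve
        double : ∀ u → 2 ℕ.* (8 ℕ.* u) ≡ 8 ℕ.* (2 ℕ.* u)
        double = ℕ-solve
        lem″ : ∀ p n → p * (+ 2 * n) ≡ p * n + p * n
        lem″ = ℤ-solve
        step : A i * + N i + Q i ≡ Q (suc i) + Q (suc i)
        step = begin
          A i * + N i + Q i                     ≡⟨ cong (λ w → A i * + N i + w) (pos-* (P i) (N i)) ⟩
          A i * + N i + + P i * + N i           ≡⟨ sym (*-distribʳ-+ (+ N i) (A i) (+ P i)) ⟩
          (A i + + P i) * + N i                 ≡⟨ cong₂ _*_ (trans (a-π L (2 ^ i) (N i) (s≤s z≤n) (1≤2^ i)) (cong (λ w → + π w) (double (2 ^ i)))) (trans (cong +_ (N-suc i i<T)) (pos-* 2 (N (suc i)))) ⟩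
          + P (suc i) * (+ 2 * + N (suc i))     ≡⟨ lem″ (+ P (suc i)) (+ N (suc i)) ⟩
          + P (suc i) * + N (suc i) + + P (suc i) * + N (suc i)
            ≡⟨ cong₂ _+_ (sym (pos-* (P (suc i)) (N (suc i)))) (sym (pos-* (P (suc i)) (N (suc i)))) ⟩
          Q (suc i) + Q (suc i)                 ∎

      -- The size condition 515 k³ ≤ N reads 10 + 3(4 + i) ≤ T - i, that is 4i + 22 ≤ T. The errors
      -- 513 L N form a geometric sum of at most 1026 L N b, and 1026 L ≤ 2^b bounds it by 2^b N b =
      -- 2^T.
      summed : ∀ m → b ℕ.+ m ℕ.≤ T → 4 ℕ.* (b ℕ.+ m) ℕ.+ 22 ℕ.≤ T → 1026 ℕ.* L ℕ.≤ 2 ^ b →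
        ∑ m (λ i → A (b ℕ.+ i) * + N (b ℕ.+ i)) ≤ + (32 ℕ.* (L ℕ.* F x) ℕ.+ 2 ^ T)
      summed m b+m≤T small large = begin
        ∑ m (λ i → A (b ℕ.+ i) * + N (b ℕ.+ i))
          ≤⟨ ∑-mono m (λ i i<m → block-estimate L (2 ^ (b ℕ.+ i)) (N (b ℕ.+ i)) (s≤s z≤n) (1≤2^ (b ℕ.+ i))
               (ℕ.^-monoʳ-≤ 2 (ℕ.≤-trans (ℕ.m∸n≤m T (b ℕ.+ i)) (ℕ.m≤n+m T 6)))
               (fits (b ℕ.+ i) (ℕ.≤-trans (ℕ.+-monoˡ-≤ 22 (ℕ.*-monoʳ-≤ 4 (ℕ.+-monoʳ-≤ b (ℕ.<⇒≤ i<m)))) small))) ⟩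
        ∑ m (λ i → + 32 * (+ L * C′ (b ℕ.+ i)) + + 513 * (+ L * + N (b ℕ.+ i)))
          ≡⟨ trans (∑-+ m (λ i → + 32 * (+ L * C′ (b ℕ.+ i))) (λ i → + 513 * (+ L * + N (b ℕ.+ i))))
               (cong₂ _+_ (pull (+ 32) (λ i → C′ (b ℕ.+ i))) (pull (+ 513) (λ i → + N (b ℕ.+ i)))) ⟩
        + 32 * (+ L * ∑ m (λ i → C′ (b ℕ.+ i))) + + 513 * (+ L * ∑ m (λ i → + N (b ℕ.+ i)))
          ≤⟨ +-mono-≤ (*-monoˡ-≤-nonNeg (+ 32) (*-monoˡ-≤-nonNeg (+ L) (∑C-≤-F m b+m≤T)))
               (*-monoˡ-≤-nonNeg (+ 513) (*-monoˡ-≤-nonNeg (+ L) (∑N-≤ m b+m≤T))) ⟩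
        + 32 * (+ L * + F x) + + 513 * (+ L * + (2 ℕ.* N b))
          ≡⟨ cong₂ _+_ (cast 32 (F x)) (cast 513 (2 ℕ.* N b)) ⟩
        + (32 ℕ.* (L ℕ.* F x) ℕ.+ 513 ℕ.* (L ℕ.* (2 ℕ.* N b)))
          ≤⟨ +≤+ (ℕ.+-monoʳ-≤ (32 ℕ.* (L ℕ.* F x)) (ℕ.≤-trans (ℕ.≤-reflexive (lem L (N b)))
               (ℕ.≤-trans (ℕ.*-monoˡ-≤ (N b) large) (ℕ.≤-reflexive (2^*N b (ℕ.≤-trans (ℕ.m≤m+n b m) b+m≤T)))))) ⟩
        + (32 ℕ.* (L ℕ.* F x) ℕ.+ 2 ^ T) ∎
        where
        open ≤-Reasoning
        pull : ∀ c f → ∑ m (λ i → c * (+ L * f i)) ≡ c * (+ L * ∑ m f)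
        pull c f = trans (∑-*ˡ m c (λ i → + L * f i)) (cong (c *_) (∑-*ˡ m (+ L) f))
        cast : ∀ c n → + c * (+ L * + n) ≡ + (c ℕ.* (L ℕ.* n))
        cast c n = trans (cong (+ c *_) (sym (pos-* L n))) (sym (pos-* c (L ℕ.* n)))
        lem : ∀ L n → 513 ℕ.* (L ℕ.* (2 ℕ.* n)) ≡ 1026 ℕ.* L ℕ.* n
        lem = ℕ-solve
        fits : ∀ i → 4 ℕ.* i ℕ.+ 22 ℕ.≤ T → let k = K (2 ^ i) (N i) (1≤2^ i) in 515 ℕ.* (k ℕ.* (k ℕ.* k)) ℕ.≤ N i
        fits i le = cube-bound {515} {10} {i} {T} (ℕ.m≤m+n 515 509) (ℕ.≤-trans (ℕ.≤-reflexive (lem″ i)) le)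
          where
          lem″ : ∀ i → 10 ℕ.+ ((4 ℕ.+ i) ℕ.+ ((4 ℕ.+ i) ℕ.+ (4 ℕ.+ i))) ℕ.+ i ≡ 4 ℕ.* i ℕ.+ 22
          lem″ = ℕ-solve

      J : ℕ → ℕ
      J zero    = b
      J (suc s) = J s ℕ.+ J s

      steps : ℕ → ℕ
      steps zero    = 0
      steps (suc s) = steps s ℕ.+ J s

      b+steps : ∀ s → b ℕ.+ steps s ≡ J s
      b+steps zero    = ℕ.+-identityʳ b
      b+steps (suc s) = trans (sym (ℕ.+-assoc b (steps s) (J s))) (cong (ℕ._+ J s) (b+steps s))

      J≥b : ∀ s → b ℕ.≤ J s
      J≥b s = ℕ.≤-trans (ℕ.m≤m+n b (steps s)) (ℕ.≤-reflexive (b+steps s))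

      -- Put u = 2^i′ with j < i′ ≤ 2j. Chebyshev at 8u gives 8u ≤ 2 + (3 + i′) P, where 3 + i′ ≤ 4j
      -- and 2 ≤ 4u, so u ≤ jP. Multiplying by N i′ makes the left side 2^T.
      2ᵀ≤J*Q : ∀ j i → 2 ℕ.≤ j → i ℕ.< j → j ℕ.+ j ℕ.≤ T → 2 ^ T ℕ.≤ j ℕ.* (P (suc (j ℕ.+ i)) ℕ.* N (suc (j ℕ.+ i)))
      2ᵀ≤J*Q j i 2≤j i<j 2j≤T = begin
        2 ^ T                  ≡⟨ sym (2^*N i′ (ℕ.≤-trans i′≤2j 2j≤T)) ⟩
        2 ^ i′ ℕ.* N i′        ≤⟨ ℕ.*-monoˡ-≤ (N i′) (ℕ.*-cancelˡ-≤ {u} {j ℕ.* P i′} 4 u≤) ⟩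
        j ℕ.* P i′ ℕ.* N i′    ≡⟨ ℕ.*-assoc j (P i′) (N i′) ⟩
        j ℕ.* (P i′ ℕ.* N i′)  ∎
        where
        open ℕ.≤-Reasoning
        i′ u : ℕ
        i′ = suc (j ℕ.+ i)
        u = 2 ^ i′
        i′≤2j : i′ ℕ.≤ j ℕ.+ j
        i′≤2j = ℕ.+-monoʳ-< j i<j
        lem₁ : ∀ u → 2 ℕ.* (2 ℕ.* (2 ℕ.* u)) ≡ 8 ℕ.* u
        lem₁ = ℕ-solve
        lem₂ : ∀ u → 8 ℕ.* u ≡ 4 ℕ.* u ℕ.+ 4 ℕ.* u
        lem₂ = ℕ-solve
        lem₃ : ∀ j → j ℕ.+ j ℕ.+ (j ℕ.+ j) ≡ 4 ℕ.* j
        lem₃ = ℕ-solve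
        3+i′≤4j : 3 ℕ.+ i′ ℕ.≤ 4 ℕ.* j
        3+i′≤4j = ℕ.≤-trans (ℕ.+-mono-≤ (ℕ.≤-trans (ℕ.n≤1+n 3) (ℕ.+-mono-≤ 2≤j 2≤j)) i′≤2j) (ℕ.≤-reflexive (lem₃ j))
        1≤u : 1 ℕ.≤ u
        1≤u = 1≤2^ i′
        u≤ : 4 ℕ.* u ℕ.≤ 4 ℕ.* (j ℕ.* P i′)
        u≤ = ℕ.≤-trans (ℕ.+-cancelˡ-≤ 2 (4 ℕ.* u) ((3 ℕ.+ i′) ℕ.* P i′)
            (ℕ.≤-trans (ℕ.+-monoˡ-≤ (4 ℕ.* u) (ℕ.≤-trans (ℕ.m≤m+n 2 2) (ℕ.*-monoʳ-≤ 4 1≤u)))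
              (ℕ.≤-trans (ℕ.≤-reflexive (sym (lem₂ u))) (chebyshev (8 ℕ.* u) (3 ℕ.+ i′) (ℕ.≤-reflexive (sym (lem₁ u)))))))
          (ℕ.≤-trans (ℕ.*-monoˡ-≤ (P i′) 3+i′≤4j) (ℕ.≤-reflexive (ℕ.*-assoc 4 j (P i′))))

      -- Each doubling of the exponent range contributes at least 2^T: this is where log log x comes from.
      ∑Q-≥ : 2 ℕ.≤ b → ∀ s → J s ℕ.≤ T → + (s ℕ.* 2 ^ T) ≤ ∑ (steps s) (λ i → Q (suc (b ℕ.+ i)))
      ∑Q-≥ 2≤b zero    _ = ≤-refl
      ∑Q-≥ 2≤b (suc s) 2J≤T = begin
        + (2 ^ T ℕ.+ s ℕ.* 2 ^ T)
          ≡⟨ trans (cong +_ (ℕ.+-comm (2 ^ T) (s ℕ.* 2 ^ T))) (pos-+ (s ℕ.* 2 ^ T) (2 ^ T)) ⟩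
        + (s ℕ.* 2 ^ T) + + (2 ^ T)
          ≤⟨ +-mono-≤ (∑Q-≥ 2≤b s (ℕ.≤-trans (ℕ.m≤m+n (J s) (J s)) 2J≤T)) last ⟩
        ∑ (steps s) (λ i → Q (suc (b ℕ.+ i))) + ∑ (J s) (λ i → Q (suc (J s ℕ.+ i)))
          ≡⟨ cong (λ w → ∑ (steps s) (λ i → Q (suc (b ℕ.+ i))) + w) (∑-cong (J s) (λ i _ → cong (λ k → Q (suc k))
               (trans (cong (ℕ._+ i) (sym (b+steps s))) (ℕ.+-assoc b (steps s) i)))) ⟩
        ∑ (steps s) (λ i → Q (suc (b ℕ.+ i))) + ∑ (J s) (λ i → Q (suc (b ℕ.+ (steps s ℕ.+ i))))
          ≡⟨ sym (∑-split (steps s) (J s) (λ i → Q (suc (b ℕ.+ i)))) ⟩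
        ∑ (steps s ℕ.+ J s) (λ i → Q (suc (b ℕ.+ i))) ∎
        where
        open ≤-Reasoning
        2≤J : 2 ℕ.≤ J s
        2≤J = ℕ.≤-trans 2≤b (J≥b s)
        last : + (2 ^ T) ≤ ∑ (J s) (λ i → Q (suc (J s ℕ.+ i)))
        last = *-cancelˡ-≤-pos (+ (2 ^ T)) (∑ (J s) (λ i → Q (suc (J s ℕ.+ i)))) (+ J s) {{ℤ.positive (ℤ.+<+ (ℕ.<⇒≤ 2≤J))}} (begin
          + J s * + (2 ^ T)                                 ≡⟨ sym (∑-const (J s) (+ (2 ^ T))) ⟩
          ∑ (J s) (λ _ → + (2 ^ T))                         ≤⟨ ∑-mono (J s) (λ i i<J → ≤-trans (+≤+ (2ᵀ≤J*Q (J s) i 2≤J i<J 2J≤T)) (≤-reflexive (pos-* (J s) _))) ⟩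
          ∑ (J s) (λ i → + J s * Q (suc (J s ℕ.+ i)))       ≡⟨ ∑-*ˡ (J s) (+ J s) (λ i → Q (suc (J s ℕ.+ i))) ⟩
          + J s * ∑ (J s) (λ i → Q (suc (J s ℕ.+ i)))       ∎)

      -- In Abel's identity the upper boundary term is dropped, being nonnegative. The lower one is
      -- at most 8·2^b N b = 8·2^T by the trivial bound for π.
      F-lower-bound : ∀ s → 2 ℕ.≤ b → 4 ℕ.* J s ℕ.+ 22 ℕ.≤ T → 1026 ℕ.* L ℕ.≤ 2 ^ b →
        s ℕ.* 2 ^ T ℕ.≤ 32 ℕ.* (L ℕ.* F x) ℕ.+ 2 ^ T ℕ.+ 8 ℕ.* 2 ^ T
      F-lower-bound s 2≤b small large = drop‿+≤+ (begin
        + (s ℕ.* 2 ^ T)                                           ≤⟨ ∑Q-≥ 2≤b s J≤T ⟩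
        S′                                                        ≡⟨ sym (+-identityʳ S′) ⟩
        S′ + 0ℤ                                                   ≤⟨ +-monoʳ-≤ S′ {0ℤ} {Q (b ℕ.+ m)} (+≤+ z≤n) ⟩
        S′ + Q (b ℕ.+ m)                                          ≡⟨ sym (abel m b+m≤T) ⟩
        ∑ m (λ i → A (b ℕ.+ i) * + N (b ℕ.+ i)) + Q b
          ≤⟨ +-mono-≤ (summed m b+m≤T (subst (λ j → 4 ℕ.* j ℕ.+ 22 ℕ.≤ T) (sym (b+steps s)) small) large) (+≤+ Qb≤) ⟩
        + (32 ℕ.* (L ℕ.* F x) ℕ.+ 2 ^ T) + + (8 ℕ.* 2 ^ T)        ≡⟨ sym (pos-+ (32 ℕ.* (L ℕ.* F x) ℕ.+ 2 ^ T) (8 ℕ.* 2 ^ T)) ⟩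
        + (32 ℕ.* (L ℕ.* F x) ℕ.+ 2 ^ T ℕ.+ 8 ℕ.* 2 ^ T)          ∎)
        where
        open ≤-Reasoning
        m : ℕ
        m = steps s
        S′ : ℤ
        S′ = ∑ m (λ i → Q (suc (b ℕ.+ i)))
        J≤T : J s ℕ.≤ T
        J≤T = ℕ.≤-trans (ℕ.≤-trans (ℕ.m≤n*m (J s) 4) (ℕ.m≤m+n (4 ℕ.* J s) 22)) small
        b+m≤T : b ℕ.+ m ℕ.≤ T
        b+m≤T = ℕ.≤-trans (ℕ.≤-reflexive (b+steps s)) J≤T
        Qb≤ : P b ℕ.* N b ℕ.≤ 8 ℕ.* 2 ^ T
        Qb≤ = ℕ.≤-trans (ℕ.*-monoˡ-≤ (N b) (π≤ (8 ℕ.* 2 ^ b))) (ℕ.≤-reflexive (trans (ℕ.*-assoc 8 (2 ^ b) (N b))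
          (cong (8 ℕ.*_) (2^*N b (ℕ.≤-trans (ℕ.m≤m+n b m) b+m≤T)))))

-- Choice of parameters.

module Assembly where

  open import Defs using (F)
  open import Data.Nat
  open import Data.Nat.Properties
  open import Data.Nat.DivMod using (_%_; _/_; m≡m%n+[m/n]*n; m%n<n)
  open Chebyshev using (largest-power)
  open Scales using (J; F-lower-bound; 1≤2^)

  2n≤2^n : ∀ n → n + n ≤ 2 ^ n
  2n≤2^n zero          = z≤n
  2n≤2^n (suc zero)    = ≤-refl
  2n≤2^n (suc n@(suc m)) = begin
    suc n + suc n        ≡⟨ lem n ⟩
    n + n + 2            ≤⟨ +-mono-≤ (2n≤2^n n) (≤-trans (*-monoʳ-≤ 2 (1≤2^ m)) ≤-refl) ⟩
    2 ^ n + 2 ^ n        ≡⟨ cong (2 ^ n +_) (sym (+-identityʳ (2 ^ n))) ⟩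
    2 ^ suc n            ∎
    where
    open ≤-Reasoning
    lem : ∀ n → suc n + suc n ≡ n + n + 2
    lem = ℕ-solve

  log₂ : ∀ x → 1 ≤ x → ∃[ e ] (2 ^ e ≤ x × x < 2 ^ suc e)
  log₂ x = largest-power 2 x ≤-refl

  log₂-≥ : ∀ {e x k} → x < 2 ^ suc e → 2 ^ k ≤ x → k ≤ e
  log₂-≥ {e} {x} {k} x< ≤x = ≤-pred (≰⇒> λ e<k → <⇒≱ x< (≤-trans (^-monoʳ-≤ 2 e<k) ≤x))

  scaled-power : ∀ {c L e} k → c ≤ 2 ^ k → L ≤ 2 ^ e → c * L ≤ 2 ^ (k + e)
  scaled-power {c} {L} {e} k c≤ L≤ = ≤-trans (*-mono-≤ c≤ L≤) (≤-reflexive (sym (^-distribˡ-+-* 2 k e)))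

  -- A lower bound for e = ⌊log₂ log₂ x⌋. The part s + 2 is the exponent of 4·2^s, and s + 21 makes
  -- the remainder μ = e - (s + 2) large enough that b + 7 = s + 21 + μ ≤ 2μ ≤ 2^μ.
  threshold : ℕ → ℕ
  threshold s = s + 2 + (s + 21)

  J≡ : ∀ T x 2ᴸ≤x b s → J T x 2ᴸ≤x b s ≡ b * 2 ^ s
  J≡ T x 2ᴸ≤x b zero    = sym (*-identityʳ b)
  J≡ T x 2ᴸ≤x b (suc s) = trans (cong (λ j → j + j) (J≡ T x 2ᴸ≤x b s)) (lem b (2 ^ s))
    where
    lem : ∀ b u → b * u + b * u ≡ b * (2 * u)
    lem = ℕ-solve

  parameters : ∀ s x → 2 ^ (2 ^ threshold s) ≤ x →
    ∃[ T ] ∃[ b ] (2 ^ (6 + T) ≤ x × x ≤ 2 ^ 7 * 2 ^ T × 2 ≤ b × 4 * (b * 2 ^ s) + 22 ≤ T × 1026 * (6 + T) ≤ 2 ^ b)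
  parameters s x X≤x = choose (log₂ x (≤-trans (1≤2^ (2 ^ threshold s)) X≤x))
    where
    Result : Set
    Result = ∃[ T ] ∃[ b ] (2 ^ (6 + T) ≤ x × x ≤ 2 ^ 7 * 2 ^ T × 2 ≤ b × 4 * (b * 2 ^ s) + 22 ≤ T × 1026 * (6 + T) ≤ 2 ^ b)
    choose : ∃[ L ] (2 ^ L ≤ x × x < 2 ^ suc L) → Result
    choose (L , 2ᴸ≤x , x<2ᴸ) = choose′ (log₂ L (≤-trans (1≤2^ (threshold s)) 2^θ≤L))
      where
      2^θ≤L : 2 ^ threshold s ≤ L
      2^θ≤L = log₂-≥ {L} {x} {2 ^ threshold s} x<2ᴸ X≤x
      choose′ : ∃[ e ] (2 ^ e ≤ L × L < 2 ^ suc e) → Result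
      choose′ (e , 2ᵉ≤L , L<2ᵉ) = T , b , subst (λ l → 2 ^ l ≤ x) (sym 6+T≡L) 2ᴸ≤x ,
          ≤-trans (<⇒≤ x<2ᴸ) (≤-reflexive (trans (cong (2 ^_) (cong suc (sym 6+T≡L))) (^-distribˡ-+-* 2 7 T))) ,
          m≤m+n 2 (10 + e) , m+n≤o⇒m≤o∸n (4 * (b * 2 ^ s) + 22) room ,
          scaled-power {1026} {6 + T} {suc e} 11 (m≤m+n 1026 1022) (≤-trans (≤-reflexive 6+T≡L) (<⇒≤ L<2ᵉ))
        where
        open ≤-Reasoning
        b T μ : ℕ
        b = 11 + suc e
        T = L ∸ 6
        μ = e ∸ (s + 2)
        threshold≤e : threshold s ≤ e
        threshold≤e = log₂-≥ {e} {L} {threshold s} L<2ᵉ 2^θ≤L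
        e≡ : s + 2 + μ ≡ e
        e≡ = m+[n∸m]≡n (≤-trans (m≤m+n (s + 2) (s + 21)) threshold≤e)
        μ≥ : s + 21 ≤ μ
        μ≥ = +-cancelˡ-≤ (s + 2) (s + 21) μ (≤-trans threshold≤e (≤-reflexive (sym e≡)))
        b+7≤2^μ : b + 7 ≤ 2 ^ μ
        b+7≤2^μ = begin
          11 + suc e + 7           ≡⟨ cong (λ l → 11 + suc l + 7) (sym e≡) ⟩
          11 + suc (s + 2 + μ) + 7 ≡⟨ lem s μ ⟩
          s + 21 + μ               ≤⟨ +-monoˡ-≤ μ μ≥ ⟩
          μ + μ                    ≤⟨ 2n≤2^n μ ⟩
          2 ^ μ                    ∎
          where
          lem : ∀ s μ → 11 + (1 + (s + 2 + μ)) + 7 ≡ s + 21 + μ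
          lem = ℕ-solve
        room : 4 * (b * 2 ^ s) + 22 + 6 ≤ L
        room = begin
          4 * (b * 2 ^ s) + 22 + 6         ≡⟨ +-assoc (4 * (b * 2 ^ s)) 22 6 ⟩
          4 * (b * 2 ^ s) + 28             ≤⟨ +-monoʳ-≤ (4 * (b * 2 ^ s)) (*-monoʳ-≤ 28 (1≤2^ s)) ⟩
          4 * (b * 2 ^ s) + 28 * 2 ^ s     ≡⟨ lem₁ b (2 ^ s) ⟩
          2 ^ s * 4 * (b + 7)              ≤⟨ *-monoʳ-≤ (2 ^ s * 4) b+7≤2^μ ⟩
          2 ^ s * 4 * 2 ^ μ                ≡⟨ cong (_* 2 ^ μ) (sym (^-distribˡ-+-* 2 s 2)) ⟩
          2 ^ (s + 2) * 2 ^ μ              ≡⟨ sym (^-distribˡ-+-* 2 (s + 2) μ) ⟩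
          2 ^ (s + 2 + μ)                  ≡⟨ cong (2 ^_) e≡ ⟩
          2 ^ e                            ≤⟨ 2ᵉ≤L ⟩
          L                                ∎
          where
          lem₁ : ∀ b u → 4 * (b * u) + 28 * u ≡ u * 4 * (b + 7)
          lem₁ = ℕ-solve
        6+T≡L : 6 + T ≡ L
        6+T≡L = m+[n∸m]≡n (≤-trans (m≤n+m 6 (4 * (b * 2 ^ s) + 22)) room)

  -- With s = 9 + 96 a K doublings, where x ≤ a 2^T.
  combine : ∀ a K x l u L f → x ≤ a * u → (9 + 96 * (a * K)) * u ≤ 32 * (L * f) + u + 8 * u → L ≤ 3 * l → K * x ≤ l * f
  combine a K x l u L f x≤ bound L≤3l = *-cancelˡ-≤ {K * x} {l * f} 96 (begin
      96 * (K * x)            ≤⟨ *-monoʳ-≤ 96 (*-monoʳ-≤ K x≤) ⟩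
      96 * (K * (a * u))      ≡⟨ lem₁ a K u ⟩
      96 * (a * K) * u        ≤⟨ cancelled ⟩
      32 * (L * f)            ≤⟨ *-monoʳ-≤ 32 (*-monoˡ-≤ f L≤3l) ⟩
      32 * (3 * l * f)        ≡⟨ lem₂ l f ⟩
      96 * (l * f)            ∎)
    where
    open ≤-Reasoning
    lem₁ : ∀ a K u → 96 * (K * (a * u)) ≡ 96 * (a * K) * u
    lem₁ = ℕ-solve
    lem₂ : ∀ l f → 32 * (3 * l * f) ≡ 96 * (l * f)
    lem₂ = ℕ-solve
    lem₃ : ∀ w u → w * u + (u + 8 * u) ≡ (9 + w) * u
    lem₃ = ℕ-solve
    cancelled : 96 * (a * K) * u ≤ 32 * (L * f)
    cancelled = +-cancelʳ-≤ (u + 8 * u) (96 * (a * K) * u) (32 * (L * f))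
      (≤-trans (≤-reflexive (lem₃ (96 * (a * K)) u)) (≤-trans bound (≤-reflexive (+-assoc (32 * (L * f)) u (8 * u)))))

  -- With l = ⌊L/2⌋ one has 4^l ≤ 2^L, as the bound for the exponential requires; since l ≥ 1,
  -- rounding costs at most L ≤ 3l.
  half : ∀ L → 2 ≤ L → ∃[ l ] (L ≤ 3 * l × 2 * l ≤ L)
  half L 2≤L = l , L≤3l , ≤-trans (≤-reflexive (*-comm 2 l)) (≤-trans (m≤n+m (l * 2) (L % 2)) (≤-reflexive (sym L≡)))
    where
    open ≤-Reasoning
    l : ℕ
    l = L / 2
    L≡ : L ≡ L % 2 + l * 2
    L≡ = m≡m%n+[m/n]*n L 2
    1≤l : 1 ≤ l
    1≤l = n≢0⇒n>0 λ l≡0 → <⇒≱ (m%n<n L 2) (≤-trans 2≤L (≤-reflexive (trans L≡ (trans (cong (λ m → L % 2 + m * 2) l≡0) (+-identityʳ (L % 2))))))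
    L≤3l : L ≤ 3 * l
    L≤3l = begin
      L               ≡⟨ L≡ ⟩
      L % 2 + l * 2   ≤⟨ +-monoˡ-≤ (l * 2) (≤-trans (≤-pred (m%n<n L 2)) 1≤l) ⟩
      l + l * 2       ≡⟨ lem l ⟩
      3 * l           ∎
      where
      lem : ∀ l → l + l * 2 ≡ 3 * l
      lem = ℕ-solve

  -- The 9 pays for the error 2^T and the boundary term 8·2^T, 96 is 3 times 32, and 2^7 enters
  -- through x < 2^(L+1) = 2^7·2^T with T = L - 6.
  doublings : ℕ → ℕ
  doublings K = 9 + 96 * (2 ^ 7 * K)

  F-superlinear : ∀ K x → 2 ^ (2 ^ threshold (doublings K)) ≤ x → ∃[ l ] (K * x ≤ l * F x × 4 ^ l ≤ x)
  F-superlinear K x X≤x =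
    let T , b , 2ᴸ≤x , x≤ , 2≤b , small , large = parameters s x X≤x
        l , L≤3l , 2l≤L = half (6 + T) (m≤m+n 2 (4 + T))
        bound = F-lower-bound T x 2ᴸ≤x b s 2≤b (subst (λ j → 4 * j + 22 ≤ T) (sym (J≡ T x 2ᴸ≤x b s)) small) large
    in l , combine (2 ^ 7) K x l (2 ^ T) (6 + T) (F x) x≤ bound L≤3l ,
       ≤-trans (≤-reflexive (^-*-assoc 2 2 l)) (≤-trans (^-monoʳ-≤ 2 2l≤L) 2ᴸ≤x)
    where
    s : ℕ
    s = doublings K

-- The asymptotic inequality in exponential form.

open import Defs
open import Data.Nat using (ℕ; suc; _≤_)
open import Data.Integer using (+_)
open import Data.Rational using (ℚ; 0ℚ; _/_; _*_) renaming (_<_ to _<ℚ_; _≤_ to _≤ℚ_)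
open import Data.Product using (_×_; ∃-syntax)
open import Relation.Binary.PropositionalEquality using (_≡_)

open import Data.Nat using (_^_)
import Data.Integer as ℤ
import Data.Rational as ℚ
open import Data.Rational.Properties using (<⇒≤; ≤-trans)

-- For F(x) = k + 1 the inequality F(x) ≥ c x / log x says that e^(cx/F(x)) ≤ x, expressed here
-- through all partial sums of the exponential series. As `S N` increases to the square root of C₂,
-- the constants c allowed are the positive rationals below 2C₂.
theorem10 : (c : ℚ) → 0ℚ <ℚ c → (∃[ N ] c <ℚ (+ 2 / 1) * S N * S N) →
    ∃[ X ] ((x : ℕ) → X ≤ x →
    ∃[ k ] ((F x ≡ suc k) ×
    ((M : ℕ) → expSum (c * (+ x / 1) * (+ 1 / suc k)) M ≤ℚ + x / 1)))
theorem10 c 0<c _ = X , λ x X≤x → conclude x X≤x (F x) refl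
  where
  open Exponential
  open Assembly
  K X : ℕ
  -- The successor ensures K ≥ 1, so that F x = 0 contradicts K x ≤ l F(x), where x ≥ 4^l ≥ 1.
  K = suc ℤ.∣ ℚ.↥ c ∣
  X = 2 ^ (2 ^ threshold (doublings K))
  c≤K : c ≤ℚ fromℕ K
  c≤K = ≤-trans (archimedean c) (fromℕ-mono-≤ (ℕ.n≤1+n ℤ.∣ ℚ.↥ c ∣))
  conclude : ∀ x → X ≤ x → ∀ f → F x ≡ f →
    ∃[ k ] ((F x ≡ suc k) × ((M : ℕ) → expSum (c * (+ x / 1) * (+ 1 / suc k)) M ≤ℚ + x / 1))
  conclude x X≤x zero F≡0 = ⊥-elim (absurd (F-superlinear K x X≤x))
    where
    absurd : ∃[ l ] (K ℕ.* x ≤ l ℕ.* F x × 4 ^ l ≤ x) → _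
    absurd (l , Kx≤ , 4ˡ≤x) = ℕ.<⇒≱ (ℕ.*-mono-≤ {1} {K} {1} {x} (s≤s z≤n) (ℕ.≤-trans (ℕ.>-nonZero⁻¹ (4 ^ l) {{ℕ.m^n≢0 4 l}}) 4ˡ≤x))
      (ℕ.≤-trans Kx≤ (ℕ.≤-reflexive (trans (cong (l ℕ.*_) F≡0) (ℕ.*-zeroʳ l))))
  conclude x X≤x (suc k) F≡ = let l , Kx≤ , 4ˡ≤x = F-superlinear K x X≤x in
    k , F≡ , λ M → expSum-quotient {c} {K} {x} {k} {l} M (<⇒≤ 0<c) c≤K (subst (λ f → K ℕ.* x ≤ l ℕ.* f) F≡ Kx≤) 4ˡ≤x
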